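{- Let $q$ be a power of an odd prime with $q\ge 7$ and $q\equiv 1\pmod 3$, and let $R$ be the graph defined below over $\mathbb F_q$. Then: (i) for any line $[A,B,C]$ of $R$ with $(A,B)\neq(0,0)$ and $(A,B)\neq(0,1)$, we have $r_3([A,B,C]) < r_3([0,0,0]) < r_3([0,1,0])$; (ii) for any point $(p_1,p_2,p_3)$ of $R$, we have $r_3((p_1,p_2,p_3)) < r_3([0,0,0])$.
   Context: $R$ is the bipartite graph whose parts are the set of points $(p_1,p_2,p_3)\in\mathbb F_q^3$ and the set of lines $[l_1,l_2,l_3]\in\mathbb F_q^3$ (two disjoint copies of $\mathbb F_q^3$), where $(p_1,p_2,p_3)$ is adjacent to $[l_1,l_2,l_3]$ if and only if $p_2+l_2 = p_1l_1$ and $p_3+l_3 = p_1p_2l_1(p_1+p_2+p_1p_2)$. For a vertex $v$, $r_3(v)$ denotes the number of vertices of $R$ at graph distance exactly $3$ from $v$. -}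

module Defs where

open import Data.Nat using (ℕ; zero; suc)
open import Data.Fin using (Fin)
open import Data.Product using (Σ; ∃; _×_; _,_)
open import Data.Sum using (_⊎_; inj₁; inj₂)
open import Data.Empty using (⊥)
open import Data.List using (List; length)
open import Data.List.Membership.Propositional using (_∈_)
open import Data.List.Relation.Unary.Unique.Propositional using (Unique)
open import Relation.Nullary using (¬_)
open import Relation.Binary.PropositionalEquality using (_≡_; _≢_)
open import Algebra.Structures using (IsCommutativeRing)
open import Function.Bundles using (_↔_; _⇔_)

record FiniteField (q : ℕ) : Set₁ where
  infixl 6 _+_
  infixl 7 _*_
  field
    Carrier : Set
    _+_ _*_ : Carrier → Carrier → Carrier
    -_ : Carrier → Carrier
    0# 1# : Carrier
    isCommutativeRing : IsCommutativeRing _≡_ _+_ _*_ -_ 0# 1#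
    0≢1 : 0# ≢ 1#
    inverse : ∀ x → x ≢ 0# → ∃ λ y → x * y ≡ 1#
    enumeration : Fin q ↔ Carrier

HasCard : {A : Set} → (A → Set) → ℕ → Set
HasCard {A} P n = Σ (List A) λ xs → Unique xs × (length xs ≡ n) × (∀ a → P a ⇔ (a ∈ xs))

module GraphR {q : ℕ} (F : FiniteField q) where
  open FiniteField F

  F³ : Set
  F³ = Carrier × Carrier × Carrier

  Vertex : Set
  Vertex = F³ ⊎ F³

  point : Carrier → Carrier → Carrier → Vertex
  point a b c = inj₁ (a , b , c)

  line : Carrier → Carrier → Carrier → Vertex
  line a b c = inj₂ (a , b , c)

  Incident : F³ → F³ → Set
  Incident (p₁ , p₂ , p₃) (l₁ , l₂ , l₃) =
    (p₂ + l₂ ≡ p₁ * l₁) × (p₃ + l₃ ≡ p₁ * p₂ * l₁ * (p₁ + p₂ + p₁ * p₂))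

  Adj : Vertex → Vertex → Set
  Adj (inj₁ p) (inj₂ l) = Incident p l
  Adj (inj₂ l) (inj₁ p) = Incident p l
  Adj (inj₁ _) (inj₁ _) = ⊥
  Adj (inj₂ _) (inj₂ _) = ⊥

  Within : ℕ → Vertex → Vertex → Set
  Within zero v w = v ≡ w
  Within (suc k) v w = Within k v w ⊎ (Σ Vertex λ u → Adj v u × Within k u w)

  Dist3 : Vertex → Vertex → Set
  Dist3 v w = Within 3 v w × ¬ Within 2 v w

  R3 : Vertex → ℕ → Set
  R3 v n = HasCard (Dist3 v) n

{-# OPTIONS --safe #-}
module Submission where

-- Put G(b, y) = by(b + y + by). A point at distance 3 from the line [A,B,C] is the end of a path
-- through a first point with abscissa b − u; for given b and t ≠ 0 it is (b, bA − B + t, z), and z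
-- is an affine image of φ(u) = D/u + αu + βu² + δu³ with coefficients depending on A, B, b, t.
-- Hence r₃ is the sum over b and t of the number of values of φ on the units, and dually for
-- points. For [0,0,0] and [0,1,0] only D survives, so φ has q − 1 values or one, according to
-- whether D = 0. In all other fibres, except for few that are bounded trivially, δ ≠ 0 or
-- β = δ = 0 with α, D ≠ 0, and it suffices that φ then has at most q − 3 values.
--
-- If it did not, φ would take every value of the field once up to three corrections w, v₁, v₂, so
-- ∑ φᵏ = wᵏ − v₁ᵏ − v₂ᵏ for small k, while ∑ φᵏ is minus the constant term of φᵏ. For D ≠ 0 the
-- exponents k ≤ 4 determine β and δ from w and z = Dα, and k = 6 together with k = 8 (or k = 7 when
-- q = 25) forces z = 0, hence α = β = δ = 0. For D = 0 the exponent (q − 1)/3 gives δ = 0.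
-- This needs q ≥ 25. The orders 13 and 19 are checked by computation; for q = 7 the claim on φ
-- fails, and the totals are compared by computation instead.

open import Data.Nat as ℕ using (ℕ; zero; suc; _≤_; z≤n; s≤s; _<_; _^_; _%_)
import Data.Nat.Properties as ℕₚ
open import Data.Nat.ListAction using (sum)
open import Data.Nat.ListAction.Properties using (sum-↭)
open import Data.List using (List; []; _∷_; _++_; length; map; concatMap; deduplicate; allFin;
  foldr; replicate; upTo)
open import Data.List.Properties using (length-++; length-map; map-∘; length-tabulate; map-id;
  map-++; length-replicate)
open import Data.List.Membership.Propositional using (_∈_)
open import Data.List.Membership.Propositional.Properties using (∈-∃++; ∈-map⁺; ∈-map⁻; ∈-++⁺ˡ;
  ∈-++⁺ʳ; ∈-++⁻; ∈-deduplicate⁺; ∈-deduplicate⁻; ∈-allFin; ∈-upTo⁺)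
open import Data.List.Relation.Unary.Any using (here; there)
open import Data.List.Relation.Unary.All as All using (All; []; _∷_)
open import Data.List.Relation.Unary.AllPairs using ([]; _∷_)
open import Data.List.Relation.Unary.Unique.Propositional using (Unique)
import Data.List.Relation.Unary.Unique.Propositional.Properties as Uniqueₚ
open import Data.List.Relation.Unary.Unique.DecPropositional.Properties using (deduplicate-!)
open import Data.List.Relation.Binary.Permutation.Propositional using (_↭_; ↭-refl; ↭-trans; prep;
  ↭⇒↭ₛ)
open import Data.List.Relation.Binary.Permutation.Propositional.Properties using (↭-length;
  ∈-resp-↭; shift; ++-identityʳ; map⁺)
open import Data.Product using (∃; ∃₂; _×_; _,_; proj₁; proj₂)
open import Data.Sum using (_⊎_; inj₁; inj₂)
open import Data.Empty using (⊥-elim)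
open import Relation.Nullary using (¬_; Dec; yes; no)
open import Relation.Binary.Definitions using (DecidableEquality; tri<; tri≈; tri>)
open import Relation.Binary.PropositionalEquality
open import Defs
open import Data.Nat.DivMod using (_%_; _/_; m≡m%n+[m/n]*n; %-distribˡ-*)
open import Data.Integer as ℤ using (ℤ; -[1+_])
import Data.Integer.Properties as ℤₚ
open import Data.Fin as Fin using (Fin; toℕ)
import Data.List.Relation.Binary.Permutation.Setoid.Properties as Permₛ
open import Data.Maybe using (Maybe; just; nothing)
open import Function.Bundles using (Inverse; module Equivalence)
open import Relation.Nullary.Decidable using (map′; _⊎-dec_; _→-dec_; from-yes)
open import Algebra.Bundles using (CommutativeRing)
import Algebra.Properties.Ring as RingProps
open import Algebra.Solver.Ring.AlmostCommutativeRing using (fromCommutativeRing;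
  _-Raw-AlmostCommutative⟶_)
open import Data.Vec as Vec using (Vec; []; _∷_)
open import Data.Bool using (Bool; T)
open import Data.Bool.ListAction using (all)
import Data.Fin.Properties as Finₚ
import Data.Vec.Properties as Vecₚ
import Data.List.Relation.Unary.All.Properties as Allₚ
open import Data.Unit using (tt)
open import Data.Product.Properties using (,-injectiveˡ)
open import Data.Sum.Properties using (inj₁-injective)
open import Data.Nat.Solver using (module +-*-Solver)
open import Data.Nat.Primality using (Prime)

-- A loss of two values per fibre is exactly what the totals require. With r = q - 1, the line
-- [0,0,0] has total at least r³ - r² + 3r - 1. If the fibres of a point lost one value each, its
-- bound would be r³; a loss of two gives r³ - r², and for the lines [0,B,C] with B ≠ 0, 1 it gives
-- r³ - r² + 2r. The margin is only linear in r, so the exceptional fibres have to be counted with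
-- care. The congruence modulo 3 is natural: for D = α = β = 0 the fibre is δu³, and cubing permutes
-- the units unless 3 divides q - 1. The obstacle in the elimination is the characteristic, since
-- one may divide only by constants that are units in the field at hand; 2 and 3 always are.
-- Exponent 5 would give 5wz(w² - 3z) = 0, which is void in characteristic 5, and the condition from
-- exponent 7 carries a factor 7. The exponents 6 and 8 carry the factors 6 and 8 only, and their
-- resultant is a power of 3 up to powers of z.

private
  variable
    Elem Val : Set
    xs ys : List Elem

-- A pigeonhole principle with witnesses: inside the list of all images the complement consists of
-- the repeated values, inside the whole field it consists of the missed ones.
unique-⊆⇒complement : Unique xs → (∀ {x} → x ∈ xs → x ∈ ys) → ∃ λ zs → ys ↭ xs ++ zs
unique-⊆⇒complement {xs = []} {ys} [] _ = ys , ↭-refl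
unique-⊆⇒complement {xs = x ∷ xs} (x∉ ∷ u) sub with ∈-∃++ (sub (here refl))
... | as , bs , refl with unique-⊆⇒complement {ys = as ++ bs} u sub′
  where
  sub′ : ∀ {z} → z ∈ xs → z ∈ as ++ bs
  sub′ {z} z∈ with ∈-++⁻ as (sub (there z∈))
  ... | inj₁ h = ∈-++⁺ˡ h
  ... | inj₂ (here refl) = ⊥-elim (All.lookup x∉ z∈ refl)
  ... | inj₂ (there h) = ∈-++⁺ʳ as h
... | zs , p = zs , ↭-trans (shift x as bs) (prep x p)

unique-⊆⇒length≤ : Unique xs → (∀ {x} → x ∈ xs → x ∈ ys) → length xs ≤ length ys
unique-⊆⇒length≤ {xs = xs} {ys} u sub with unique-⊆⇒complement u sub
... | zs , p = subst (length xs ≤_) (sym (trans (↭-length p) (length-++ xs))) (ℕₚ.m≤m+n _ _)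

unique-⊆⇒↭ : Unique xs → (∀ {x} → x ∈ xs → x ∈ ys) → length ys ≤ length xs → ys ↭ xs
unique-⊆⇒↭ {xs = xs} {ys} u sub le with unique-⊆⇒complement u sub
... | [] , p = ↭-trans p (++-identityʳ xs)
... | z ∷ zs , p = ⊥-elim (ℕₚ.<-irrefl refl (ℕₚ.<-≤-trans lt le))
  where
  lt : length xs ℕ.< length ys
  lt = subst (length xs ℕ.<_) (sym (trans (↭-length p) (length-++ xs)))
         (ℕₚ.m<m+n _ (s≤s z≤n))

Unique-concatMap : {f : Elem → List Val} → Unique xs → (∀ x → x ∈ xs → Unique (f x)) →
                   (∀ {x y z} → z ∈ f x → z ∈ f y → x ≡ y) → Unique (concatMap f xs)
∈-concatMap-witness : (f : Elem → List Val) (xs : List Elem) {z : Val} →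
                      z ∈ concatMap f xs → ∃ λ x → x ∈ xs × z ∈ f x

∈-concatMap-witness f (x ∷ xs) z∈ with ∈-++⁻ (f x) z∈
... | inj₁ h = x , here refl , h
... | inj₂ h with ∈-concatMap-witness f xs h
... | y , y∈ , k = y , there y∈ , k

Unique-concatMap [] _ _ = []
Unique-concatMap {xs = x ∷ xs} {f = f} (x∉ ∷ u) uf sep =
  Uniqueₚ.++⁺ (uf x (here refl)) (Unique-concatMap u (λ y y∈ → uf y (there y∈)) sep)
    λ { (z∈ , z∈′) → let y , y∈ , k = ∈-concatMap-witness f xs z∈′
                     in All.lookup x∉ y∈ (sep z∈ k) }

∈-concatMap : (f : Elem → List Val) {x : Elem} {z : Val} → x ∈ xs → z ∈ f x → z ∈ concatMap f xs
∈-concatMap f (here refl) z∈ = ∈-++⁺ˡ z∈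
∈-concatMap {xs = y ∷ _} f (there x∈) z∈ = ∈-++⁺ʳ (f y) (∈-concatMap f x∈ z∈)

-- Finite sums of naturals

Σ : List Elem → (Elem → ℕ) → ℕ
Σ xs c = sum (map c xs)

Σ-length : (f : Elem → List Val) (xs : List Elem) → length (concatMap f xs) ≡ Σ xs (λ x → length (f x))
Σ-length f [] = refl
Σ-length f (x ∷ xs) = trans (length-++ (f x)) (cong (length (f x) ℕ.+_) (Σ-length f xs))

Σ-mono : {c d : Elem → ℕ} (xs : List Elem) → (∀ {x} → x ∈ xs → c x ≤ d x) → Σ xs c ≤ Σ xs d
Σ-mono [] _ = z≤n
Σ-mono (x ∷ xs) le = ℕₚ.+-mono-≤ (le (here refl)) (Σ-mono xs (λ x∈ → le (there x∈)))

Σ-const : (xs : List Elem) (n : ℕ) → Σ xs (λ _ → n) ≡ length xs ℕ.* n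
Σ-const [] n = refl
Σ-const (x ∷ xs) n = cong (n ℕ.+_) (Σ-const xs n)

Σ-≤-const : {c : Elem → ℕ} (xs : List Elem) {n : ℕ} → (∀ {x} → x ∈ xs → c x ≤ n) →
            Σ xs c ≤ length xs ℕ.* n
Σ-≤-const xs {n} le = ℕₚ.≤-trans (Σ-mono xs le) (ℕₚ.≤-reflexive (Σ-const xs n))

Σ-≥-const : {c : Elem → ℕ} (xs : List Elem) {n : ℕ} → (∀ {x} → x ∈ xs → n ≤ c x) →
            length xs ℕ.* n ≤ Σ xs c
Σ-≥-const xs {n} le = ℕₚ.≤-trans (ℕₚ.≤-reflexive (sym (Σ-const xs n))) (Σ-mono xs le)

Σ-↭ : {c : Elem → ℕ} → xs ↭ ys → Σ xs c ≡ Σ ys c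
Σ-↭ {c = c} p = sum-↭ (Permₚ.map⁺ c p)
  where import Data.List.Relation.Binary.Permutation.Propositional.Properties as Permₚ

-- `x₀` need not belong to `xs`: it will be the one parameter t at which D may vanish, and that
-- parameter may be 0.
Σ-mono-except : DecidableEquality Elem → {c d : Elem → ℕ} (x₀ : Elem) (e : ℕ) → Unique xs →
                (∀ {x} → x ∈ xs → x ≢ x₀ → c x ≤ d x) → c x₀ ≤ d x₀ ℕ.+ e →
                Σ xs c ≤ Σ xs d ℕ.+ e
Σ-mono-except _≟_ x₀ e [] _ _ = z≤n
Σ-mono-except {xs = x ∷ xs} _≟_ {c} {d} x₀ e (x∉ ∷ u) le le₀ with x ≟ x₀
... | yes refl = ℕₚ.≤-trans
        (ℕₚ.+-mono-≤ le₀ (Σ-mono xs (λ y∈ → le (there y∈) λ { refl → All.lookup x∉ y∈ refl })))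
        (ℕₚ.≤-reflexive (trans (ℕₚ.+-assoc (d x) e _)
          (trans (cong (d x ℕ.+_) (ℕₚ.+-comm e _)) (sym (ℕₚ.+-assoc (d x) _ e)))))
... | no x≢ = ℕₚ.≤-trans
        (ℕₚ.+-mono-≤ (le (here refl) x≢)
          (Σ-mono-except {xs = xs} _≟_ x₀ e u (λ y∈ → le (there y∈)) le₀))
        (ℕₚ.≤-reflexive (sym (ℕₚ.+-assoc (d x) _ e)))

-- Carries a surplus at one summand over to the total; the exceptionally full rows b = -1 and b = -2
-- enter in this way.
Σ-gap : {c d : Elem → ℕ} {x₀ : Elem} {e : ℕ} (xs : List Elem) → x₀ ∈ xs →
        (∀ {x} → x ∈ xs → c x ≤ d x) → c x₀ ℕ.+ e ≤ d x₀ → Σ xs c ℕ.+ e ≤ Σ xs d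
Σ-gap {c = c} {e = e} (x ∷ xs) (here refl) le le₀ = ℕₚ.≤-trans
  (ℕₚ.≤-reflexive (trans (ℕₚ.+-assoc (c x) _ e) (trans (cong (c x ℕ.+_) (ℕₚ.+-comm _ e))
    (sym (ℕₚ.+-assoc (c x) e _)))))
  (ℕₚ.+-mono-≤ le₀ (Σ-mono xs (λ x∈ → le (there x∈))))
Σ-gap {c = c} {e = e} (x ∷ xs) (there x∈) le le₀ = ℕₚ.≤-trans
  (ℕₚ.≤-reflexive (ℕₚ.+-assoc (c x) _ e))
  (ℕₚ.+-mono-≤ (le (here refl)) (Σ-gap xs x∈ (λ y∈ → le (there y∈)) le₀))

Σ-cong : {c d : Elem → ℕ} (xs : List Elem) → (∀ x → c x ≡ d x) → Σ xs c ≡ Σ xs d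
Σ-cong [] _ = refl
Σ-cong (x ∷ xs) eq = cong₂ ℕ._+_ (eq x) (Σ-cong xs eq)

-- Numbers of distinct values

module Distinct (_≟_ : DecidableEquality Val) where

  values : (Elem → Val) → List Elem → List Val
  values f xs = deduplicate _≟_ (map f xs)

  #values : (Elem → Val) → List Elem → ℕ
  #values f xs = length (values f xs)

  ∈-values⁺ : (f : Elem → Val) {x : Elem} → x ∈ xs → f x ∈ values f xs
  ∈-values⁺ f x∈ = ∈-deduplicate⁺ _≟_ (∈-map⁺ f x∈)

  ∈-values⁻ : (f : Elem → Val) (xs : List Elem) {y : Val} → y ∈ values f xs → ∃ λ x → x ∈ xs × y ≡ f x
  ∈-values⁻ f xs y∈ = ∈-map⁻ f (∈-deduplicate⁻ _≟_ (map f xs) y∈)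

  values-unique : (f : Elem → Val) (xs : List Elem) → Unique (values f xs)
  values-unique f xs = deduplicate-! _≟_ (map f xs)

  #values-≤ : (f : Elem → Val) (xs : List Elem) (ys : List Val) → (∀ {x} → x ∈ xs → f x ∈ ys) →
              #values f xs ≤ length ys
  #values-≤ f xs ys cov = unique-⊆⇒length≤ (values-unique f xs)
    λ y∈ → let x , x∈ , eq = ∈-values⁻ f xs y∈ in subst (_∈ ys) (sym eq) (cov x∈)

  #values-≤-length : (f : Elem → Val) (xs : List Elem) → #values f xs ≤ length xs
  #values-≤-length f xs = subst (#values f xs ≤_) (length-map f xs)
    (#values-≤ f xs (map f xs) (∈-map⁺ f))

  #values-injective : (f : Elem → Val) → (∀ {x y} → x ∈ xs → y ∈ xs → f x ≡ f y → x ≡ y) → Unique xs →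
                      length xs ≤ #values f xs
  #values-injective {xs = xs} f inj u = subst (_≤ #values f xs) (length-map f xs)
    (unique-⊆⇒length≤ (go u inj)
      λ y∈ → let x , x∈ , eq = ∈-map⁻ f y∈ in subst (_∈ values f xs) (sym eq) (∈-values⁺ f x∈))
    where
    go : ∀ {zs} → Unique zs → (∀ {x y} → x ∈ zs → y ∈ zs → f x ≡ f y → x ≡ y) → Unique (map f zs)
    go [] _ = []
    go {z ∷ zs} (z∉ ∷ u) inj = All.tabulate (λ y∈ eq → let x , x∈ , eq′ = ∈-map⁻ f y∈ in
        All.lookup z∉ x∈ (inj (here refl) (there x∈) (trans eq eq′)))
      ∷ go u (λ a b → inj (there a) (there b))

  values-split : (f : Elem → Val) (xs : List Elem) → ∃₂ λ ds rs →
                 map f xs ↭ ds ++ rs × Unique ds × (∀ {x} → x ∈ xs → f x ∈ ds)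
  values-split f xs with unique-⊆⇒complement (values-unique f xs)
                          (λ y∈ → ∈-deduplicate⁻ _≟_ (map f xs) y∈)
  ... | rs , p = values f xs , rs , p , values-unique f xs , ∈-values⁺ f

-- Finite fields

module FieldTheory {q : ℕ} (F : FiniteField q) where
  open FiniteField F public

  commutativeRing : CommutativeRing _ _
  commutativeRing = record { isCommutativeRing = isCommutativeRing }

  open CommutativeRing commutativeRing public
    using (+-assoc; +-comm; +-identityˡ; +-identityʳ; *-assoc; *-comm; *-identityˡ; *-identityʳ;
           zeroˡ; zeroʳ; distribˡ; distribʳ; -‿inverseʳ; -‿inverseˡ; ring; semiring;
           +-isCommutativeMonoid; *-isCommutativeMonoid)
  open RingProps ring using (-‿distribˡ-*; -‿distribʳ-*; -0#≈0#; -‿involutive; -‿+-comm)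
  open import Algebra.Properties.Semiring.Exp semiring public renaming (_^_ to _↑_)
    using (^-homo-*)

  -- The clause for suc zero makes ι 1 definitionally 1#, as the solver's numerals require.
  ι : ℕ → Carrier
  ι zero = 0#
  ι (suc zero) = 1#
  ι (suc (suc n)) = 1# + ι (suc n)

  ι-suc : ∀ n → ι (suc n) ≡ 1# + ι n
  ι-suc zero = sym (+-identityʳ 1#)
  ι-suc (suc n) = refl

  ι-+ : ∀ m n → ι (m ℕ.+ n) ≡ ι m + ι n
  ι-+ zero n = sym (+-identityˡ _)
  ι-+ (suc m) n = begin
    ι (suc (m ℕ.+ n)) ≡⟨ ι-suc (m ℕ.+ n) ⟩
    1# + ι (m ℕ.+ n)  ≡⟨ cong (1# +_) (ι-+ m n) ⟩
    1# + (ι m + ι n)  ≡⟨ sym (+-assoc 1# _ _) ⟩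
    1# + ι m + ι n    ≡⟨ cong (_+ ι n) (sym (ι-suc m)) ⟩
    ι (suc m) + ι n   ∎
    where open ≡-Reasoning

  ι-* : ∀ m n → ι (m ℕ.* n) ≡ ι m * ι n
  ι-* zero n = sym (zeroˡ _)
  ι-* (suc m) n = begin
    ι (n ℕ.+ m ℕ.* n)     ≡⟨ ι-+ n (m ℕ.* n) ⟩
    ι n + ι (m ℕ.* n)     ≡⟨ cong₂ _+_ (sym (*-identityˡ _)) (ι-* m n) ⟩
    1# * ι n + ι m * ι n  ≡⟨ sym (distribʳ (ι n) 1# (ι m)) ⟩
    (1# + ι m) * ι n      ≡⟨ cong (_* ι n) (sym (ι-suc m)) ⟩
    ι (suc m) * ι n       ∎
    where open ≡-Reasoning

  private
    -- The solver works with integer coefficients, whose equality is decided by evaluation although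
    -- the field is abstract. One normalisation then serves every characteristic.
    ιℤ : ℤ → Carrier
    ιℤ (ℤ.+ n) = ι n
    ιℤ -[1+ n ] = - ι (suc n)

    ιℤ-⊖ : ∀ m n → ιℤ (m ℤ.⊖ n) ≡ ι m + - ι n
    ιℤ-⊖ m zero = sym (trans (cong (ι m +_) -0#≈0#) (+-identityʳ _))
    ιℤ-⊖ zero (suc n) = sym (+-identityˡ _)
    ιℤ-⊖ (suc m) (suc n) = begin
      ιℤ (suc m ℤ.⊖ suc n)            ≡⟨ cong ιℤ (ℤₚ.[1+m]⊖[1+n]≡m⊖n m n) ⟩
      ιℤ (m ℤ.⊖ n)                    ≡⟨ ιℤ-⊖ m n ⟩
      ι m + - ι n                     ≡⟨ cong (_+ - ι n) (sym (+-identityˡ _)) ⟩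
      0# + ι m + - ι n                ≡⟨ cong (λ z → z + ι m + - ι n) (sym (-‿inverseʳ 1#)) ⟩
      1# + - 1# + ι m + - ι n         ≡⟨ cong (_+ - ι n) (+-assoc 1# _ _) ⟩
      1# + (- 1# + ι m) + - ι n       ≡⟨ cong (λ z → 1# + z + - ι n) (+-comm (- 1#) (ι m)) ⟩
      1# + (ι m + - 1#) + - ι n       ≡⟨ cong (_+ - ι n) (sym (+-assoc 1# _ _)) ⟩
      1# + ι m + - 1# + - ι n         ≡⟨ +-assoc (1# + ι m) _ _ ⟩
      1# + ι m + (- 1# + - ι n)       ≡⟨ cong (1# + ι m +_) (-‿+-comm 1# (ι n)) ⟩
      1# + ι m + - (1# + ι n)         ≡⟨ cong₂ (λ x y → x + - y) (sym (ι-suc m)) (sym (ι-suc n)) ⟩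
      ι (suc m) + - ι (suc n)         ∎
      where open ≡-Reasoning

    ιℤ-neg : ∀ i → ιℤ (ℤ.- i) ≡ - ιℤ i
    ιℤ-neg (ℤ.+ zero) = sym -0#≈0#
    ιℤ-neg (ℤ.+ suc n) = refl
    ιℤ-neg -[1+ n ] = sym (-‿involutive _)

    ιℤ-+ : ∀ i j → ιℤ (i ℤ.+ j) ≡ ιℤ i + ιℤ j
    ιℤ-+ (ℤ.+ m) (ℤ.+ n) = ι-+ m n
    ιℤ-+ (ℤ.+ m) -[1+ n ] = ιℤ-⊖ m (suc n)
    ιℤ-+ -[1+ m ] (ℤ.+ n) = trans (ιℤ-⊖ n (suc m)) (+-comm _ _)
    ιℤ-+ -[1+ m ] -[1+ n ] = begin
      - ι (suc (suc (m ℕ.+ n)))        ≡⟨ cong (λ z → - ι (suc z)) (sym (ℕₚ.+-suc m n)) ⟩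
      - ι (suc m ℕ.+ suc n)            ≡⟨ cong -_ (ι-+ (suc m) (suc n)) ⟩
      - (ι (suc m) + ι (suc n))        ≡⟨ sym (-‿+-comm _ _) ⟩
      - ι (suc m) + - ι (suc n)        ∎
      where open ≡-Reasoning

    ιℤ-*⁺ : ∀ m j → ιℤ (ℤ.+ m ℤ.* j) ≡ ι m * ιℤ j
    ιℤ-*⁺ m (ℤ.+ n) = trans (cong ιℤ (sym (ℤₚ.pos-* m n))) (ι-* m n)
    ιℤ-*⁺ m -[1+ n ] = begin
      ιℤ (ℤ.+ m ℤ.* (ℤ.- ℤ.+ suc n))    ≡⟨ cong ιℤ (sym (ℤₚ.neg-distribʳ-* (ℤ.+ m) (ℤ.+ suc n))) ⟩
      ιℤ (ℤ.- (ℤ.+ m ℤ.* ℤ.+ suc n))    ≡⟨ ιℤ-neg (ℤ.+ m ℤ.* ℤ.+ suc n) ⟩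
      - ιℤ (ℤ.+ m ℤ.* ℤ.+ suc n)        ≡⟨ cong -_ (ιℤ-*⁺ m (ℤ.+ suc n)) ⟩
      - (ι m * ι (suc n))           ≡⟨ -‿distribʳ-* _ _ ⟩
      ι m * - ι (suc n)             ∎
      where open ≡-Reasoning

    ιℤ-* : ∀ i j → ιℤ (i ℤ.* j) ≡ ιℤ i * ιℤ j
    ιℤ-* (ℤ.+ m) j = ιℤ-*⁺ m j
    ιℤ-* -[1+ m ] j = begin
      ιℤ ((ℤ.- ℤ.+ suc m) ℤ.* j)      ≡⟨ cong ιℤ (sym (ℤₚ.neg-distribˡ-* (ℤ.+ suc m) j)) ⟩
      ιℤ (ℤ.- (ℤ.+ suc m ℤ.* j))      ≡⟨ ιℤ-neg (ℤ.+ suc m ℤ.* j) ⟩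
      - ιℤ (ℤ.+ suc m ℤ.* j)          ≡⟨ cong -_ (ιℤ-*⁺ (suc m) j) ⟩
      - (ι (suc m) * ιℤ j)          ≡⟨ -‿distribˡ-* _ _ ⟩
      - ι (suc m) * ιℤ j            ∎
      where open ≡-Reasoning

    ℤ⟶F : ℤ.+-*-rawRing -Raw-AlmostCommutative⟶ fromCommutativeRing commutativeRing
    ℤ⟶F = record { ⟦_⟧ = ιℤ ; +-homo = ιℤ-+ ; *-homo = ιℤ-* ; -‿homo = ιℤ-neg
                 ; 0-homo = refl ; 1-homo = refl }

    ιℤ-≟ : ∀ i j → Maybe (ιℤ i ≡ ιℤ j)
    ιℤ-≟ i j with i ℤ.≟ j
    ... | yes refl = just refl
    ... | no _ = nothing

  open import Algebra.Solver.Ring ℤ.+-*-rawRing (fromCommutativeRing commutativeRing) ℤ⟶F ιℤ-≟ public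
    using (Polynomial; ⟦_⟧; op; [+]; [*]; con; var; _:^_; :-_; _:+_; _:*_; _:-_; _:=_; solve; prove)

  abstract
    _≟_ : DecidableEquality Carrier
    x ≟ y = map′ (λ eq → trans (sym (inverseˡ refl)) (trans (cong to eq) (inverseˡ refl))) (cong from)
              (from x Fin.≟ from y)
      where open Inverse enumeration

  infix 8 _⁻¹
  infix 4 _≟_
  abstract
    _⁻¹ : Carrier → Carrier
    x ⁻¹ with x ≟ 0#
    ... | yes _ = 0#
    ... | no x≢0 = proj₁ (inverse x x≢0)

    ⁻¹-inverseʳ : ∀ {x} → x ≢ 0# → x * x ⁻¹ ≡ 1#
    ⁻¹-inverseʳ {x} x≢0 with x ≟ 0#
    ... | yes x≡0 = ⊥-elim (x≢0 x≡0)
    ... | no x≢0 = proj₂ (inverse x x≢0)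

  *-cancelˡ : ∀ {x y z} → x ≢ 0# → x * y ≡ x * z → y ≡ z
  *-cancelˡ {x} {y} {z} x≢0 eq = begin
    y              ≡⟨ unfold y ⟩
    x ⁻¹ * (x * y) ≡⟨ cong (x ⁻¹ *_) eq ⟩
    x ⁻¹ * (x * z) ≡⟨ sym (unfold z) ⟩
    z              ∎
    where
    open ≡-Reasoning
    unfold : ∀ t → t ≡ x ⁻¹ * (x * t)
    unfold t = trans (sym (*-identityˡ t)) (trans (cong (_* t) (sym (trans (*-comm _ _) (⁻¹-inverseʳ x≢0))))
                 (*-assoc _ _ _))

  *-≢0 : ∀ {x y} → x ≢ 0# → y ≢ 0# → x * y ≢ 0#
  *-≢0 {x} x≢0 y≢0 eq = y≢0 (*-cancelˡ x≢0 (trans eq (sym (zeroʳ x))))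

  ↑-≢0 : ∀ {x} n → x ≢ 0# → x ↑ n ≢ 0#
  ↑-≢0 zero _ eq = 0≢1 (sym eq)
  ↑-≢0 (suc n) x≢0 = *-≢0 x≢0 (↑-≢0 n x≢0)

  *-≡0 : ∀ {x y} → x * y ≡ 0# → x ≡ 0# ⊎ y ≡ 0#
  *-≡0 {x} {y} eq with x ≟ 0# | y ≟ 0#
  ... | yes x≡0 | _ = inj₁ x≡0
  ... | no _ | yes y≡0 = inj₂ y≡0
  ... | no x≢0 | no y≢0 = ⊥-elim (*-≢0 x≢0 y≢0 eq)

  cancel-unit : ∀ {a x} → a ≢ 0# → a * x ≡ 0# → x ≡ 0#
  cancel-unit a≢0 eq with *-≡0 eq
  ... | inj₁ a≡0 = ⊥-elim (a≢0 a≡0)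
  ... | inj₂ x≡0 = x≡0

  ⁻¹-≢0 : ∀ {x} → x ≢ 0# → x ⁻¹ ≢ 0#
  ⁻¹-≢0 {x} x≢0 eq = 0≢1 (trans (sym (zeroʳ x)) (trans (cong (x *_) (sym eq)) (⁻¹-inverseʳ x≢0)))

  x-y≡0⇒x≡y : ∀ {x y} → x + - y ≡ 0# → x ≡ y
  x-y≡0⇒x≡y {x} {y} eq = trans (solve 2 (λ x y → x := (x :- y) :+ y) refl x y)
    (trans (cong (_+ y) eq) (+-identityˡ y))

  abstract
    elements : List Carrier
    elements = map (Inverse.to enumeration) (allFin q)

    elements-unique : Unique elements
    elements-unique = Uniqueₚ.map⁺
      (λ eq → trans (sym (inverseʳ refl)) (trans (cong from eq) (inverseʳ refl))) (Uniqueₚ.allFin⁺ q)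
      where open Inverse enumeration

    ∈-elements : ∀ x → x ∈ elements
    ∈-elements x = subst (_∈ elements) (inverseˡ refl) (∈-map⁺ to (∈-allFin (from x)))
      where open Inverse enumeration

    length-elements : length elements ≡ q
    length-elements = trans (length-map _ (allFin q)) (length-tabulate (λ i → i))

    remove0 : ∃ λ zs → elements ↭ (0# ∷ []) ++ zs
    remove0 = unique-⊆⇒complement ([] ∷ []) λ { (here refl) → ∈-elements 0# }

    units : List Carrier
    units = proj₁ remove0

    elements-↭ : elements ↭ 0# ∷ units
    elements-↭ = proj₂ remove0

  private
    0∷units-unique : Unique (0# ∷ units)
    0∷units-unique = Permₛ.Unique-resp-↭ (setoid Carrier) (↭⇒↭ₛ elements-↭) elements-unique

  units-unique : Unique units
  units-unique with _ ∷ u ← 0∷units-unique = u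

  ∈-units⁻ : ∀ {u} → u ∈ units → u ≢ 0#
  ∈-units⁻ u∈ refl with x∉ ∷ _ ← 0∷units-unique = All.lookup x∉ u∈ refl

  ∈-units⁺ : ∀ {u} → u ≢ 0# → u ∈ units
  ∈-units⁺ {u} u≢0 with ∈-resp-↭ elements-↭ (∈-elements u)
  ... | here u≡0 = ⊥-elim (u≢0 u≡0)
  ... | there u∈ = u∈

  length-units : suc (length units) ≡ q
  length-units = trans (sym (↭-length elements-↭)) length-elements

  ∑ : List Carrier → Carrier
  ∑ = foldr _+_ 0#

  ∏ : List Carrier → Carrier
  ∏ = foldr _*_ 1#

  ∑-↭ : ∀ {xs ys} → xs ↭ ys → ∑ xs ≡ ∑ ys
  ∑-↭ p = Permₛ.foldr-commMonoid (setoid Carrier) +-isCommutativeMonoid (↭⇒↭ₛ p)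

  ∏-↭ : ∀ {xs ys} → xs ↭ ys → ∏ xs ≡ ∏ ys
  ∏-↭ p = Permₛ.foldr-commMonoid (setoid Carrier) *-isCommutativeMonoid (↭⇒↭ₛ p)

  ∑-++ : ∀ xs ys → ∑ (xs ++ ys) ≡ ∑ xs + ∑ ys
  ∑-++ [] ys = sym (+-identityˡ _)
  ∑-++ (x ∷ xs) ys = trans (cong (x +_) (∑-++ xs ys)) (sym (+-assoc x _ _))

  ∑-cong : {A : Set} {f g : A → Carrier} (xs : List A) → (∀ {x} → x ∈ xs → f x ≡ g x) →
           ∑ (map f xs) ≡ ∑ (map g xs)
  ∑-cong [] _ = refl
  ∑-cong (x ∷ xs) eq = cong₂ _+_ (eq (here refl)) (∑-cong xs (λ x∈ → eq (there x∈)))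

  ∑-+ : {A : Set} (f g : A → Carrier) (xs : List A) →
        ∑ (map (λ x → f x + g x) xs) ≡ ∑ (map f xs) + ∑ (map g xs)
  ∑-+ f g [] = sym (+-identityˡ _)
  ∑-+ f g (x ∷ xs) = trans (cong (f x + g x +_) (∑-+ f g xs))
    (solve 4 (λ a b c d → (a :+ b) :+ (c :+ d) := (a :+ c) :+ (b :+ d)) refl _ _ _ _)

  ∑-* : {A : Set} (c : Carrier) (f : A → Carrier) (xs : List A) →
        ∑ (map (λ x → c * f x) xs) ≡ c * ∑ (map f xs)
  ∑-* c f [] = sym (zeroʳ c)
  ∑-* c f (x ∷ xs) = trans (cong (c * f x +_) (∑-* c f xs)) (sym (distribˡ c _ _))

  ∑-const : {A : Set} (c : Carrier) (xs : List A) → ∑ (map (λ _ → c) xs) ≡ ι (length xs) * c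
  ∑-const c [] = sym (zeroˡ c)
  ∑-const c (x ∷ xs) = begin
    c + ∑ (map (λ _ → c) xs)    ≡⟨ cong₂ _+_ (sym (*-identityˡ c)) (∑-const c xs) ⟩
    1# * c + ι (length xs) * c  ≡⟨ sym (distribʳ c _ _) ⟩
    (1# + ι (length xs)) * c    ≡⟨ cong (_* c) (sym (ι-suc (length xs))) ⟩
    ι (suc (length xs)) * c     ∎
    where open ≡-Reasoning

  map-permutes : ∀ {xs : List Carrier} (f : Carrier → Carrier) → (∀ {x y} → f x ≡ f y → x ≡ y) →
                 (∀ {x} → x ∈ xs → f x ∈ xs) → Unique xs → xs ↭ map f xs
  map-permutes {xs} f inj closed u = unique-⊆⇒↭ (Uniqueₚ.map⁺ inj u)
    (λ y∈ → let x , x∈ , eq = ∈-map⁻ f y∈ in subst (_∈ xs) (sym eq) (closed x∈))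
    (ℕₚ.≤-reflexive (sym (length-map f xs)))

  +-cancelʳ : ∀ {x y} z → x + z ≡ y + z → x ≡ y
  +-cancelʳ {x} {y} z eq = trans (solve 2 (λ x z → x := (x :+ z) :- z) refl x z)
    (trans (cong (_+ - z) eq) (solve 2 (λ y z → (y :+ z) :- z := y) refl y z))

  -- Translation by 1 permutes the field, so adding 1 to each of the q elements leaves their sum
  -- unchanged.
  ι-q : ι q ≡ 0#
  ι-q = +-cancelʳ (∑ elements) (begin
    ι q + ∑ elements
      ≡⟨ cong (λ n → ι n + ∑ elements) (sym length-elements) ⟩
    ι (length elements) + ∑ elements
      ≡⟨ cong₂ _+_ (sym (trans (∑-const 1# elements) (*-identityʳ _))) (cong ∑ (sym (map-id elements))) ⟩
    ∑ (map (λ _ → 1#) elements) + ∑ (map (λ x → x) elements)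
      ≡⟨ sym (∑-+ _ _ elements) ⟩
    ∑ (map (1# +_) elements)
      ≡⟨ sym (∑-↭ (map-permutes (1# +_) (λ {x} {y} eq → +-cancelʳ 1# (trans (+-comm x 1#) (trans eq (+-comm 1# y))))
           (λ _ → ∈-elements _) elements-unique)) ⟩
    ∑ elements
      ≡⟨ sym (+-identityˡ _) ⟩
    0# + ∑ elements ∎)
    where open ≡-Reasoning

  -- `ι` sends q to 0, so `ι a` = 0 would leave 0 = 1. This makes 2 and 3 units.
  ι-≢0 : ∀ a b → q ≡ 1 ℕ.+ a ℕ.* b → ι a ≢ 0#
  ι-≢0 a b eq ιa≡0 = 0≢1 (begin
    0#              ≡⟨ sym ι-q ⟩
    ι q             ≡⟨ cong ι eq ⟩
    ι (1 ℕ.+ a ℕ.* b) ≡⟨ ι-suc (a ℕ.* b) ⟩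
    1# + ι (a ℕ.* b) ≡⟨ cong (1# +_) (trans (ι-* a b) (trans (cong (_* ι b) ιa≡0) (zeroˡ _))) ⟩
    1# + 0#         ≡⟨ +-identityʳ 1# ⟩
    1#              ∎)
    where open ≡-Reasoning

  1≢0 : 1# ≢ 0#
  1≢0 eq = 0≢1 (sym eq)

  -- Scaling by x permutes the units, so their product absorbs one factor x for each unit.
  fermat : ∀ {x} → x ≢ 0# → x ↑ length units ≡ 1#
  fermat {x} x≢0 = *-cancelˡ (∏-≢0 units ∈-units⁻) (begin
    ∏ units * x ↑ length units ≡⟨ *-comm _ _ ⟩
    x ↑ length units * ∏ units ≡⟨ sym (∏-scale units) ⟩
    ∏ (map (x *_) units)       ≡⟨ sym (∏-↭ (map-permutes (x *_) (*-cancelˡ x≢0)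
                                    (λ u∈ → ∈-units⁺ (*-≢0 x≢0 (∈-units⁻ u∈))) units-unique)) ⟩
    ∏ units                    ≡⟨ sym (*-identityʳ _) ⟩
    ∏ units * 1#               ∎)
    where
    open ≡-Reasoning
    ∏-≢0 : ∀ xs → (∀ {y} → y ∈ xs → y ≢ 0#) → ∏ xs ≢ 0#
    ∏-≢0 [] _ = 1≢0
    ∏-≢0 (y ∷ xs) ne = *-≢0 (ne (here refl)) (∏-≢0 xs (λ y∈ → ne (there y∈)))
    ∏-scale : ∀ xs → ∏ (map (x *_) xs) ≡ x ↑ length xs * ∏ xs
    ∏-scale [] = sym (*-identityˡ _)
    ∏-scale (y ∷ xs) = trans (cong (x * y *_) (∏-scale xs))
      (solve 4 (λ x y p s → (x :* y) :* (p :* s) := (x :* p) :* (y :* s)) refl x y _ _)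

-- Power sums over the units

module PowerSums {q : ℕ} (F : FiniteField q) where
  open FieldTheory F
  open Distinct _≟_ public
  open import Algebra.Properties.CommutativeSemiring.Exp
    (CommutativeRing.commutativeSemiring commutativeRing)
    public using (^-distrib-*)

  r : ℕ
  r = length units

  -- The monic polynomial with lower coefficients cs, constant term first.
  monic : List Carrier → Carrier → Carrier
  monic [] x = 1#
  monic (c ∷ cs) x = c + x * monic cs x

  -- Synthetic division by x - a in Horner form; the remainder is the value at a.
  divide : ∀ c cs a → ∃ λ ds → length ds ≡ length cs ×
           (∀ x → monic (c ∷ cs) x ≡ (x + - a) * monic ds x + monic (c ∷ cs) a)
  divide c [] a = [] , refl ,
    λ x → solve 3 (λ c a x → c :+ x :* con (ℤ.+ 1) :=
                    (x :- a) :* con (ℤ.+ 1) :+ (c :+ a :* con (ℤ.+ 1))) refl c a x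
  divide c (c′ ∷ cs) a with divide c′ cs a
  ... | ds , len , eq = monic (c′ ∷ cs) a ∷ ds , cong suc len ,
    λ x → trans (cong (λ p → c + x * p) (eq x))
      (solve 5 (λ c a x p d → c :+ x :* ((x :- a) :* d :+ p) :=
                    (x :- a) :* (p :+ x :* d) :+ (c :+ a :* p)) refl c a x _ _)

  roots-≤-degree : ∀ cs {xs} → Unique xs → (∀ {x} → x ∈ xs → monic cs x ≡ 0#) → length xs ≤ length cs
  roots-≤-degree cs {[]} _ _ = z≤n
  roots-≤-degree [] {x ∷ xs} _ root = ⊥-elim (1≢0 (root (here refl)))
  roots-≤-degree (c ∷ cs) {a ∷ xs} (a∉ ∷ u) root with divide c cs a
  ... | ds , len , eq = s≤s (subst (length xs ≤_) len (roots-≤-degree ds u rest))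
    where
    rest : ∀ {x} → x ∈ xs → monic ds x ≡ 0#
    rest {x} x∈ with *-≡0 {x + - a} {monic ds x} (begin
          (x + - a) * monic ds x                      ≡⟨ sym (+-identityʳ _) ⟩
          (x + - a) * monic ds x + 0#                 ≡⟨ cong ((x + - a) * monic ds x +_) (sym (root (here refl))) ⟩
          (x + - a) * monic ds x + monic (c ∷ cs) a   ≡⟨ sym (eq x) ⟩
          monic (c ∷ cs) x                            ≡⟨ root (there x∈) ⟩
          0# ∎)
      where open ≡-Reasoning
    ... | inj₁ x-a≡0 = ⊥-elim (All.lookup a∉ x∈ (sym (x-y≡0⇒x≡y x-a≡0)))
    ... | inj₂ h = h

  -- Otherwise the monic polynomial of degree m + 1 with value x^(m+1) - 1 would have too many
  -- roots. This takes the place of a primitive element: below exponent r the power map is a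
  -- nontrivial character.
  unity-exponent : ∀ m → (∀ {x} → x ∈ units → x ↑ suc m ≡ 1#) → r ≤ suc m
  unity-exponent m all1 = subst (r ≤_) (cong suc (length-replicate m))
    (roots-≤-degree (- 1# ∷ replicate m 0#) units-unique
      λ {x} x∈ → trans (cong (λ p → - 1# + x * p) (zeros m x)) (trans (cong (- 1# +_) (all1 x∈)) (-‿inverseˡ 1#)))
    where
    zeros : ∀ m x → monic (replicate m 0#) x ≡ x ↑ m
    zeros zero x = refl
    zeros (suc m) x = trans (+-identityˡ _) (cong (x *_) (zeros m x))

  -- A sum of a character over the units is unchanged by multiplication with its values.
  character-sum : (χ : Carrier → Carrier) → (∀ {x y} → x ≢ 0# → y ≢ 0# → χ (x * y) ≡ χ x * χ y) →
                  ¬ (∀ {x} → x ≢ 0# → χ x ≡ 1#) → ∑ (map χ units) ≡ 0#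
  character-sum χ χ-* nontrivial with ∑ (map χ units) ≟ 0#
  ... | yes eq = eq
  ... | no S≢0 = ⊥-elim (nontrivial λ {x} x≢0 → *-cancelˡ S≢0 (begin
    S * χ x                              ≡⟨ *-comm _ _ ⟩
    χ x * S                              ≡⟨ sym (∑-* (χ x) χ units) ⟩
    ∑ (map (λ u → χ x * χ u) units)      ≡⟨ ∑-cong units (λ u∈ → sym (χ-* x≢0 (∈-units⁻ u∈))) ⟩
    ∑ (map (λ u → χ (x * u)) units)      ≡⟨ cong ∑ (map-∘ units) ⟩
    ∑ (map χ (map (x *_) units))         ≡⟨ sym (∑-↭ (map⁺ χ (map-permutes (x *_) (*-cancelˡ x≢0)
                                              (λ u∈ → ∈-units⁺ (*-≢0 x≢0 (∈-units⁻ u∈))) units-unique))) ⟩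
    S                                    ≡⟨ sym (*-identityʳ S) ⟩
    S * 1# ∎))
    where
    open ≡-Reasoning
    S = ∑ (map χ units)

  ⁻¹-* : ∀ {x y} → x ≢ 0# → y ≢ 0# → (x * y) ⁻¹ ≡ x ⁻¹ * y ⁻¹
  ⁻¹-* {x} {y} x≢0 y≢0 = *-cancelˡ (*-≢0 x≢0 y≢0) (begin
    x * y * (x * y) ⁻¹        ≡⟨ ⁻¹-inverseʳ (*-≢0 x≢0 y≢0) ⟩
    1#                        ≡⟨ sym (*-identityˡ 1#) ⟩
    1# * 1#                   ≡⟨ sym (cong₂ _*_ (⁻¹-inverseʳ x≢0) (⁻¹-inverseʳ y≢0)) ⟩
    (x * x ⁻¹) * (y * y ⁻¹)   ≡⟨ solve 4 (λ x i y j → (x :* i) :* (y :* j) := (x :* y) :* (i :* j)) refl _ _ _ _ ⟩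
    x * y * (x ⁻¹ * y ⁻¹)     ∎)
    where open ≡-Reasoning

  1↑ : ∀ n → 1# ↑ n ≡ 1#
  1↑ zero = refl
  1↑ (suc n) = trans (*-identityˡ _) (1↑ n)

  ⁻¹-↑ : ∀ {x} n → x ≢ 0# → x ↑ n * (x ⁻¹) ↑ n ≡ 1#
  ⁻¹-↑ {x} n x≢0 = trans (sym (^-distrib-* x (x ⁻¹) n)) (trans (cong (_↑ n) (⁻¹-inverseʳ x≢0)) (1↑ n))

  ∑-↑ : ∀ m → suc m < r → ∑ (map (_↑ suc m) units) ≡ 0#
  ∑-↑ m m<r = character-sum (_↑ suc m) (λ {x} {y} _ _ → ^-distrib-* x y (suc m))
    λ all1 → ℕₚ.<⇒≱ m<r (unity-exponent m (λ x∈ → all1 (∈-units⁻ x∈)))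

  ∑-⁻¹↑ : ∀ m → suc m < r → ∑ (map (λ u → (u ⁻¹) ↑ suc m) units) ≡ 0#
  ∑-⁻¹↑ m m<r = character-sum (λ u → (u ⁻¹) ↑ suc m)
    (λ {x} {y} x≢0 y≢0 → trans (cong (_↑ suc m) (⁻¹-* x≢0 y≢0)) (^-distrib-* (x ⁻¹) (y ⁻¹) (suc m)))
    λ all1 → ℕₚ.<⇒≱ m<r (unity-exponent m (λ {x} x∈ → begin
      x ↑ suc m                         ≡⟨ sym (*-identityʳ _) ⟩
      x ↑ suc m * 1#                    ≡⟨ cong (x ↑ suc m *_) (sym (all1 (∈-units⁻ x∈))) ⟩
      x ↑ suc m * (x ⁻¹) ↑ suc m        ≡⟨ ⁻¹-↑ (suc m) (∈-units⁻ x∈) ⟩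
      1# ∎))
    where open ≡-Reasoning

  ι-r : ι r ≡ - 1#
  ι-r = +-cancelʳ 1# (trans (+-comm _ _) (trans (sym (ι-suc r)) (trans (cong ι length-units)
          (trans ι-q (sym (-‿inverseˡ 1#))))))

  ∑-1 : ∑ (map (λ _ → 1#) units) ≡ - 1#
  ∑-1 = trans (∑-const 1# units) (trans (*-identityʳ _) ι-r)

  ∑-elements-↑ : ∀ m → suc m < r → ∑ (map (_↑ suc m) elements) ≡ 0#
  ∑-elements-↑ m m<r = trans (∑-↭ (map⁺ (_↑ suc m) elements-↭))
    (trans (cong₂ _+_ (zeroˡ _) (∑-↑ m m<r)) (+-identityˡ 0#))

  -- A function on the units missing at most one value of the maximal r takes every value of
  -- the field exactly once, up to the correction terms w, v₁, v₂.
  few-values⊎almost-permutation : (φ : Carrier → Carrier) →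
    #values φ units ℕ.+ 2 ≤ r ⊎
    (∃ λ w → ∃₂ λ v₁ v₂ → (h : Carrier → Carrier) →
       ∑ (map (λ u → h (φ u)) units) + (h v₁ + h v₂) ≡ ∑ (map h elements) + h w)
  few-values⊎almost-permutation φ with values-split φ units
  ... | ds , rs , p , ds! , cover with unique-⊆⇒complement {ys = elements} ds! (λ _ → ∈-elements _)
  ... | ms , p′ = cases rs ms p p′ lenr lenm
    where
    lenr : length ds ℕ.+ length rs ≡ r
    lenr = trans (sym (length-++ ds)) (trans (sym (↭-length p)) (length-map φ units))
    lenm : length ds ℕ.+ length ms ≡ suc r
    lenm = trans (sym (length-++ ds)) (trans (sym (↭-length p′)) (trans length-elements (sym length-units)))
    expand : ∀ {xs} zs (h : Carrier → Carrier) → xs ↭ ds ++ zs →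
             ∑ (map h xs) ≡ ∑ (map h ds) + ∑ (map h zs)
    expand zs h p = trans (∑-↭ (map⁺ h p)) (trans (cong ∑ (map-++ h ds zs)) (∑-++ (map h ds) (map h zs)))
    -- `rs` lists the repetitions and `ms` the missed values. The field has one element more than
    -- the units, so there is always one missed value more than there are repetitions.
    cases : ∀ rs ms → map φ units ↭ ds ++ rs → elements ↭ ds ++ ms →
            length ds ℕ.+ length rs ≡ r → length ds ℕ.+ length ms ≡ suc r → _
    cases (x ∷ y ∷ rs) ms p p′ lenr lenm = inj₁ (ℕₚ.≤-trans
      (ℕₚ.+-monoˡ-≤ 2 (#values-≤ φ units ds cover))
      (subst (length ds ℕ.+ 2 ≤_) lenr (ℕₚ.+-monoʳ-≤ (length ds) (s≤s (s≤s z≤n)))))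
    cases [] ms p p′ lenr lenm with ms | ℕₚ.+-cancelˡ-≡ (length ds) (length ms) 1
                                  (trans lenm (trans (cong suc (sym (trans (sym (ℕₚ.+-identityʳ _)) lenr)))
                                    (ℕₚ.+-comm 1 (length ds))))
    -- Without repetition only `v` is missed. Taking `0#` for both `w` and `v₂` adds the same term
    -- on both sides and gives this case the form of the next one.
    ... | v ∷ [] | _ = inj₂ (0# , v , 0# , λ h → begin
      ∑ (map (λ u → h (φ u)) units) + (h v + h 0#) ≡⟨ cong (_+ _) (trans (cong ∑ (map-∘ units)) (expand [] h p)) ⟩
      ∑ (map h ds) + 0# + (h v + h 0#)             ≡⟨ solve 3 (λ d v z → d :+ con (ℤ.+ 0) :+ (v :+ z) := d :+ (v :+ con (ℤ.+ 0)) :+ z) refl _ _ _ ⟩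
      ∑ (map h ds) + (h v + 0#) + h 0#             ≡⟨ cong (_+ h 0#) (sym (expand (v ∷ []) h p′)) ⟩
      ∑ (map h elements) + h 0# ∎)
      where open ≡-Reasoning
    cases (w ∷ []) ms p p′ lenr lenm with ms | ℕₚ.+-cancelˡ-≡ (length ds) (length ms) 2
                                        (trans lenm (trans (cong suc (sym lenr)) (sym (ℕₚ.+-suc (length ds) 1))))
    ... | v₁ ∷ v₂ ∷ [] | _ = inj₂ (w , v₁ , v₂ , λ h → begin
      ∑ (map (λ u → h (φ u)) units) + (h v₁ + h v₂)  ≡⟨ cong (_+ _) (trans (cong ∑ (map-∘ units)) (expand (w ∷ []) h p)) ⟩
      ∑ (map h ds) + (h w + 0#) + (h v₁ + h v₂)      ≡⟨ solve 4 (λ d w a b → d :+ (w :+ con (ℤ.+ 0)) :+ (a :+ b)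
                                                         := d :+ (a :+ (b :+ con (ℤ.+ 0))) :+ w) refl _ _ _ _ ⟩
      ∑ (map h ds) + (h v₁ + (h v₂ + 0#)) + h w      ≡⟨ cong (_+ h w) (sym (expand (v₁ ∷ v₂ ∷ []) h p′)) ⟩
      ∑ (map h elements) + h w ∎)
      where open ≡-Reasoning

-- Values of D/u + αu + βu² + δu³

module Quartic {q : ℕ} (F : FiniteField q) where
  open FieldTheory F
  open PowerSums F

  laurent : (D α β δ u : Carrier) → Carrier
  laurent D α β δ u = D * u ⁻¹ + (α * u + (β * (u * u) + δ * (u * u * u)))

  :n : ∀ {m} → ℕ → Polynomial m
  :n k = con (ℤ.+ k)

  -- Minus the sum over all units u of u⁻⁸ uʲ (u·laurent u)ᵏ, for j + 4k < r + 8.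
  coefficient : ℕ → ℕ → Polynomial 4
  coefficient zero j with j ℕ.≟ 8
  ... | yes _ = :n 1
  ... | no _ = :n 0
  coefficient (suc k) j with 8 ℕ.<? j
  ... | yes _ = :n 0
  ... | no _ = (D :* coefficient k j :+ α :* coefficient k (2 ℕ.+ j)) :+
               (β :* coefficient k (3 ℕ.+ j) :+ δ :* coefficient k (4 ℕ.+ j))
    where
    open import Data.Fin.Patterns
    D = var 0F
    α = var 1F
    β = var 2F
    δ = var 3F

  -- Closed forms of coefficient k (8 ∸ k) in z = Dα, B = D²β and E = D³δ; the first one vanishes.
  :excess : ∀ {m} (z B E : Polynomial m) → ℕ → Polynomial m
  :excess z B E 2 = :n 2 :* z
  :excess z B E 3 = :n 3 :* B
  :excess z B E 4 = :n 4 :* E :+ :n 6 :* z :^ 2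
  :excess z B E 6 = :n 20 :* z :^ 3 :+ :n 15 :* (:n 2 :* z :* E :+ B :^ 2)
  :excess z B E 7 = :n 105 :* z :^ 2 :* B :+ :n 42 :* B :* E
  :excess z B E 8 = :n 70 :* z :^ 4 :+ :n 168 :* (z :^ 2 :* E :+ z :* B :^ 2) :+ :n 28 :* E :^ 2
  :excess z B E _ = :n 0

  module Sums (D α β δ : Carrier) where
    φ = laurent D α β δ

    ρ : Vec Carrier 4
    ρ = D ∷ α ∷ β ∷ δ ∷ []

    -- This is u·φ(u), so φ(u)ᵏ = u⁻ᵏN(u)ᵏ. Over the common denominator u⁸ all exponents k ≤ 8 are
    -- treated by one recursion on a natural exponent j, started at j = 8 - k.
    N : Carrier → Carrier
    N u = (D + α * (u * u)) + (β * (u * u * u) + δ * (u * u * u * u))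

    term : ℕ → ℕ → Carrier → Carrier
    term k j u = (u ⁻¹) ↑ 8 * u ↑ j * N u ↑ k

    M : ℕ → ℕ → Carrier
    M k j = ∑ (map (term k j) units)

    -- Multiplying out one factor `N u` raises the exponent j by 0, 2, 3 or 4; `coefficient` obeys
    -- the same recursion.
    M-suc : ∀ k j → M (suc k) j ≡ (D * M k j + α * M k (2 ℕ.+ j)) + (β * M k (3 ℕ.+ j) + δ * M k (4 ℕ.+ j))
    M-suc k j = begin
      M (suc k) j
        ≡⟨ ∑-cong units (λ {u} _ → solve 8 (λ i u D α β δ uʲ n →
             i :* uʲ :* (((D :+ α :* (u :* u)) :+ (β :* (u :* u :* u) :+ δ :* (u :* u :* u :* u))) :* n) :=
             (D :* (i :* uʲ :* n) :+ α :* (i :* (u :* (u :* uʲ)) :* n)) :+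
             (β :* (i :* (u :* (u :* (u :* uʲ))) :* n) :+ δ :* (i :* (u :* (u :* (u :* (u :* uʲ)))) :* n)))
             refl ((u ⁻¹) ↑ 8) u D α β δ (u ↑ j) (N u ↑ k)) ⟩
      ∑ (map (λ u → (D * term k j u + α * term k (2 ℕ.+ j) u) +
                    (β * term k (3 ℕ.+ j) u + δ * term k (4 ℕ.+ j) u)) units)
        ≡⟨ ∑-+ _ _ units ⟩
      ∑ (map (λ u → D * term k j u + α * term k (2 ℕ.+ j) u) units) +
      ∑ (map (λ u → β * term k (3 ℕ.+ j) u + δ * term k (4 ℕ.+ j) u) units)
        ≡⟨ cong₂ _+_ (trans (∑-+ _ _ units) (cong₂ _+_ (∑-* _ _ units) (∑-* _ _ units)))
                     (trans (∑-+ _ _ units) (cong₂ _+_ (∑-* _ _ units) (∑-* _ _ units))) ⟩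
      (D * M k j + α * M k (2 ℕ.+ j)) + (β * M k (3 ℕ.+ j) + δ * M k (4 ℕ.+ j)) ∎
      where open ≡-Reasoning

    private
      cancel : ∀ {u} a b → u ≢ 0# → (u ⁻¹) ↑ a * u ↑ (a ℕ.+ b) ≡ u ↑ b
      cancel {u} a b u≢0 = begin
        (u ⁻¹) ↑ a * u ↑ (a ℕ.+ b)     ≡⟨ cong ((u ⁻¹) ↑ a *_) (^-homo-* u a b) ⟩
        (u ⁻¹) ↑ a * (u ↑ a * u ↑ b)   ≡⟨ solve 3 (λ i x y → i :* (x :* y) := (x :* i) :* y) refl _ _ _ ⟩
        u ↑ a * (u ⁻¹) ↑ a * u ↑ b     ≡⟨ cong (_* u ↑ b) (⁻¹-↑ a u≢0) ⟩
        1# * u ↑ b                     ≡⟨ *-identityˡ _ ⟩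
        u ↑ b ∎
        where open ≡-Reasoning

      cancel′ : ∀ {u} a b → u ≢ 0# → (u ⁻¹) ↑ (a ℕ.+ b) * u ↑ a ≡ (u ⁻¹) ↑ b
      cancel′ {u} a b u≢0 = begin
        (u ⁻¹) ↑ (a ℕ.+ b) * u ↑ a             ≡⟨ cong (_* u ↑ a) (^-homo-* (u ⁻¹) a b) ⟩
        (u ⁻¹) ↑ a * (u ⁻¹) ↑ b * u ↑ a        ≡⟨ solve 3 (λ i j x → i :* j :* x := (x :* i) :* j) refl _ _ _ ⟩
        u ↑ a * (u ⁻¹) ↑ a * (u ⁻¹) ↑ b        ≡⟨ cong (_* (u ⁻¹) ↑ b) (⁻¹-↑ a u≢0) ⟩
        1# * (u ⁻¹) ↑ b                        ≡⟨ *-identityˡ _ ⟩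
        (u ⁻¹) ↑ b ∎
        where open ≡-Reasoning

    M0-high : ∀ j → 8 < j → j < r ℕ.+ 8 → M 0 j ≡ 0#
    M0-high j 8<j j<r with ℕₚ.m≤n⇒∃[o]m+o≡n 8<j
    ... | d , refl = trans (∑-cong units (λ {u} u∈ → trans (*-identityʳ _)
                        (trans (cong ((u ⁻¹) ↑ 8 *_) (cong (u ↑_) (sym (ℕₚ.+-suc 8 d)))) (cancel 8 (suc d) (∈-units⁻ u∈)))))
                       (∑-↑ d (ℕₚ.+-cancelˡ-< 8 (suc d) r
                         (subst₂ _<_ (sym (ℕₚ.+-suc 8 d)) (ℕₚ.+-comm r 8) j<r)))

    M0-low : ∀ j → j < 8 → 8 < r → M 0 j ≡ 0#
    M0-low j j<8 8<r with ℕₚ.m≤n⇒∃[o]m+o≡n j<8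
    ... | d , eq = trans (∑-cong units (λ {u} u∈ → trans (*-identityʳ _)
                        (trans (cong (λ e → (u ⁻¹) ↑ e * u ↑ j) (trans (sym eq) (sym (ℕₚ.+-suc j d))))
                          (cancel′ j (suc d) (∈-units⁻ u∈)))))
                     (∑-⁻¹↑ d (ℕₚ.≤-<-trans (ℕₚ.≤-trans (ℕₚ.m≤n+m (suc d) j) (ℕₚ.≤-reflexive (trans (ℕₚ.+-suc j d) eq))) 8<r))

    M0-diag : M 0 8 ≡ - 1#
    M0-diag = trans (∑-cong units (λ {u} u∈ → trans (*-identityʳ _) (cancel 8 0 (∈-units⁻ u∈)))) ∑-1

    private
      bound : ∀ k j i → i ≤ 4 → j ℕ.+ 4 ℕ.* suc k < r ℕ.+ 8 → i ℕ.+ j ℕ.+ 4 ℕ.* k < r ℕ.+ 8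
      bound k j i i≤4 lt = ℕₚ.≤-<-trans (begin
        i ℕ.+ j ℕ.+ 4 ℕ.* k     ≤⟨ ℕₚ.+-monoˡ-≤ (4 ℕ.* k) (ℕₚ.+-monoˡ-≤ j i≤4) ⟩
        4 ℕ.+ j ℕ.+ 4 ℕ.* k     ≡⟨ cong (ℕ._+ 4 ℕ.* k) (ℕₚ.+-comm 4 j) ⟩
        j ℕ.+ 4 ℕ.+ 4 ℕ.* k     ≡⟨ ℕₚ.+-assoc j 4 _ ⟩
        j ℕ.+ (4 ℕ.+ 4 ℕ.* k)   ≡⟨ cong (j ℕ.+_) (sym (ℕₚ.*-suc 4 k)) ⟩
        j ℕ.+ 4 ℕ.* suc k       ∎) lt
        where open ℕₚ.≤-Reasoning

    -- All exponents of u lie strictly between 0 and r, so every power sum vanishes. This justifies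
    -- the cut-off of `coefficient` beyond j = 8, which keeps the polynomials small.
    M-high : ∀ k j → 8 < j → j ℕ.+ 4 ℕ.* k < r ℕ.+ 8 → M k j ≡ 0#
    M-high zero j 8<j lt = M0-high j 8<j (subst (_< r ℕ.+ 8) (ℕₚ.+-identityʳ j) lt)
    M-high (suc k) j 8<j lt = begin
      M (suc k) j
        ≡⟨ M-suc k j ⟩
      (D * M k j + α * M k (2 ℕ.+ j)) + (β * M k (3 ℕ.+ j) + δ * M k (4 ℕ.+ j))
        ≡⟨ cong₂ _+_ (cong₂ (λ x y → D * x + α * y) (go 0 (from-yes (0 ℕ.≤? 4))) (go 2 (from-yes (2 ℕ.≤? 4))))
                     (cong₂ (λ x y → β * x + δ * y) (go 3 (from-yes (3 ℕ.≤? 4))) (go 4 (from-yes (4 ℕ.≤? 4)))) ⟩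
      (D * 0# + α * 0#) + (β * 0# + δ * 0#)
        ≡⟨ solve 4 (λ D α β δ → (D :* :n 0 :+ α :* :n 0) :+ (β :* :n 0 :+ δ :* :n 0) := :n 0) refl D α β δ ⟩
      0# ∎
      where
      open ≡-Reasoning
      go : ∀ i → i ≤ 4 → M k (i ℕ.+ j) ≡ 0#
      go i i≤4 = M-high k (i ℕ.+ j) (ℕₚ.≤-trans 8<j (ℕₚ.m≤n+m j i)) (bound k j i i≤4 lt)

    -- The bound on j keeps the highest exponent of u below r, and 8 < r keeps the lowest one above
    -- -r. In this range only the exponent 0 has a nonzero sum, namely r = -1.
    M-coefficient : 8 < r → ∀ k j → j ℕ.+ 4 ℕ.* k < r ℕ.+ 8 → M k j ≡ - ⟦ coefficient k j ⟧ ρ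
    M-coefficient 8<r zero j lt with j ℕ.≟ 8
    ... | yes refl = M0-diag
    ... | no j≢8 = trans vanish (solve 0 (:n 0 := :- :n 0) refl)
      where
      vanish : M 0 j ≡ 0#
      vanish with ℕₚ.<-cmp j 8
      ... | tri< j<8 _ _ = M0-low j j<8 8<r
      ... | tri≈ _ j≡8 _ = ⊥-elim (j≢8 j≡8)
      ... | tri> _ _ 8<j = M0-high j 8<j (subst (_< r ℕ.+ 8) (ℕₚ.+-identityʳ j) lt)
    M-coefficient 8<r (suc k) j lt with 8 ℕ.<? j
    ... | yes 8<j = trans (M-high (suc k) j 8<j lt) (solve 0 (:n 0 := :- :n 0) refl)
    ... | no _ = begin
      M (suc k) j
        ≡⟨ M-suc k j ⟩
      (D * M k j + α * M k (2 ℕ.+ j)) + (β * M k (3 ℕ.+ j) + δ * M k (4 ℕ.+ j))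
        ≡⟨ cong₂ _+_ (cong₂ (λ x y → D * x + α * y) (go 0 (from-yes (0 ℕ.≤? 4))) (go 2 (from-yes (2 ℕ.≤? 4))))
                     (cong₂ (λ x y → β * x + δ * y) (go 3 (from-yes (3 ℕ.≤? 4))) (go 4 (from-yes (4 ℕ.≤? 4)))) ⟩
      (D * - c 0 + α * - c 2) + (β * - c 3 + δ * - c 4)
        ≡⟨ solve 8 (λ D α β δ x y z t → (D :* :- x :+ α :* :- y) :+ (β :* :- z :+ δ :* :- t)
              := :- ((D :* x :+ α :* y) :+ (β :* z :+ δ :* t))) refl D α β δ (c 0) (c 2) (c 3) (c 4) ⟩
      - ((D * c 0 + α * c 2) + (β * c 3 + δ * c 4)) ∎
      where
      open ≡-Reasoning
      c : ℕ → Carrier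
      c i = ⟦ coefficient k (i ℕ.+ j) ⟧ ρ
      go : ∀ i → i ≤ 4 → M k (i ℕ.+ j) ≡ - c i
      go i i≤4 = M-coefficient 8<r k (i ℕ.+ j) (bound k j i i≤4 lt)

    power-term : ∀ k l {u} → k ℕ.+ l ≡ 8 → u ≢ 0# → φ u ↑ k ≡ term k l u
    power-term k l {u} eq u≢0 = sym (begin
      (u ⁻¹) ↑ 8 * u ↑ l * N u ↑ k
        ≡⟨ cong (λ e → (u ⁻¹) ↑ e * u ↑ l * N u ↑ k) (trans (sym eq) (ℕₚ.+-comm k l)) ⟩
      (u ⁻¹) ↑ (l ℕ.+ k) * u ↑ l * N u ↑ k  ≡⟨ cong (_* N u ↑ k) (cancel′ l k u≢0) ⟩
      (u ⁻¹) ↑ k * N u ↑ k                  ≡⟨ sym (^-distrib-* (u ⁻¹) (N u) k) ⟩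
      (u ⁻¹ * N u) ↑ k                      ≡⟨ cong (_↑ k) (begin
        u ⁻¹ * N u
          ≡⟨ solve 6 (λ i u D α β δ → i :* ((D :+ α :* (u :* u)) :+ (β :* (u :* u :* u) :+ δ :* (u :* u :* u :* u)))
               := D :* i :+ (u :* i) :* (α :* u :+ (β :* (u :* u) :+ δ :* (u :* u :* u)))) refl (u ⁻¹) u D α β δ ⟩
        D * u ⁻¹ + u * u ⁻¹ * (α * u + (β * (u * u) + δ * (u * u * u)))
          ≡⟨ cong (λ e → D * u ⁻¹ + e * (α * u + (β * (u * u) + δ * (u * u * u)))) (⁻¹-inverseʳ u≢0) ⟩
        D * u ⁻¹ + 1# * (α * u + (β * (u * u) + δ * (u * u * u)))
          ≡⟨ cong (D * u ⁻¹ +_) (*-identityˡ _) ⟩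
        φ u ∎) ⟩
      φ u ↑ k ∎)
      where open ≡-Reasoning

    -- The substitution u ↦ μu fixes these three products, and with them the constant term of every
    -- power of `φ`, which is therefore a polynomial in them.
    z = D * α
    B = D ↑ 2 * β
    E = D ↑ 3 * δ

    power-sum : 8 < r → ∀ k l → k ℕ.+ l ≡ 8 → l ℕ.+ 4 ℕ.* k < r ℕ.+ 8 →
                ∑ (map (λ u → φ u ↑ k) units) ≡ - ⟦ coefficient k l ⟧ ρ
    power-sum 8<r k l eq lt = trans (∑-cong units (λ u∈ → power-term k l eq (∈-units⁻ u∈)))
                                (M-coefficient 8<r k l lt)

  open import Data.Fin.Patterns

  private
    :z :B :E : Polynomial 4
    :z = var 0F :* var 1F
    :B = var 0F :^ 2 :* var 2F
    :E = var 0F :^ 3 :* var 3F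

  excess : ℕ → (z B E : Carrier) → Carrier
  excess k z B E = ⟦ :excess (var 0F) (var 1F) (var 2F) k ⟧ (z ∷ B ∷ E ∷ [])

  private
    difference : ∀ {a b c} → a ≡ b → a + - b ≡ c → c ≡ 0#
    difference {b = b} refl eq = trans (sym eq) (-‿inverseʳ b)

    -- Each v₁ᵏ + v₂ᵏ is expanded by Newton's identities in w = v₁ + v₂ and z = −v₁v₂.
    module _ (2≢0 : ι 2 ≢ 0#) (3≢0 : ι 3 ≢ 0#) where

      first-powers : ∀ {v₁ v₂ w} → v₁ ↑ 1 + v₂ ↑ 1 ≡ w ↑ 1 + 0# → w ≡ v₁ + v₂
      first-powers {v₁} {v₂} {w} eq = trans (solve 1 (λ w → w := w :^ 1 :+ :n 0) refl w)
        (trans (sym eq) (solve 2 (λ v w → v :^ 1 :+ w :^ 1 := v :+ w) refl v₁ v₂))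

      second-powers : ∀ {v₁ v₂ z} → v₁ ↑ 2 + v₂ ↑ 2 ≡ (v₁ + v₂) ↑ 2 + ι 2 * z → z ≡ - (v₁ * v₂)
      second-powers {v₁} {v₂} {z} eq = sym (x-y≡0⇒x≡y (cancel-unit 2≢0 (difference eq (solve 3 (λ v w z →
        (v :^ 2 :+ w :^ 2) :- ((v :+ w) :^ 2 :+ :n 2 :* z) := :n 2 :* (:- (v :* w) :- z)) refl v₁ v₂ z))))

      third-powers : ∀ {v₁ v₂ B} → v₁ ↑ 3 + v₂ ↑ 3 ≡ (v₁ + v₂) ↑ 3 + ι 3 * B →
                     B ≡ - (v₁ * v₂) * (v₁ + v₂)
      third-powers {v₁} {v₂} {B} eq = sym (x-y≡0⇒x≡y (cancel-unit 3≢0 (difference eq (solve 3 (λ v w B →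
        (v :^ 3 :+ w :^ 3) :- ((v :+ w) :^ 3 :+ :n 3 :* B) := :n 3 :* (:- (v :* w) :* (v :+ w) :- B)) refl v₁ v₂ B))))

      fourth-powers : ∀ {v₁ v₂ E} → let w = v₁ + v₂ ; z = - (v₁ * v₂) in
        v₁ ↑ 4 + v₂ ↑ 4 ≡ w ↑ 4 + (ι 4 * E + ι 6 * z ↑ 2) → E ≡ (w * w + - z) * z
      fourth-powers {v₁} {v₂} {E} eq = sym (x-y≡0⇒x≡y (cancel-unit 2≢0 (cancel-unit 2≢0 (difference eq (solve 3 (λ v w E →
        (v :^ 4 :+ w :^ 4) :- ((v :+ w) :^ 4 :+ (:n 4 :* E :+ :n 6 :* (:- (v :* w)) :^ 2)) :=
        :n 2 :* (:n 2 :* (((v :+ w) :* (v :+ w) :- :- (v :* w)) :* (:- (v :* w)) :- E))) refl v₁ v₂ E)))))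

      low-powers : ∀ {v₁ v₂ w z B E} →
        v₁ ↑ 1 + v₂ ↑ 1 ≡ w ↑ 1 + excess 1 z B E → v₁ ↑ 2 + v₂ ↑ 2 ≡ w ↑ 2 + excess 2 z B E →
        v₁ ↑ 3 + v₂ ↑ 3 ≡ w ↑ 3 + excess 3 z B E → v₁ ↑ 4 + v₂ ↑ 4 ≡ w ↑ 4 + excess 4 z B E →
        w ≡ v₁ + v₂ × z ≡ - (v₁ * v₂) × B ≡ z * w × E ≡ (w * w + - z) * z
      low-powers {v₁} {v₂} {w} {z} {B} {E} eq₁ eq₂ eq₃ eq₄ =
        w≡ , z≡ ,
        trans (third-powers (trans eq₃ (cong (λ x → x ↑ 3 + ι 3 * B) w≡))) (sym (cong₂ _*_ z≡ w≡)) ,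
        trans (fourth-powers (trans eq₄ (cong₂ (λ x y → x ↑ 4 + (ι 4 * E + ι 6 * y ↑ 2)) w≡ z≡)))
          (sym (cong₂ (λ x y → (x * x + - y) * y) w≡ z≡))
        where
        w≡ = first-powers eq₁
        z≡ = second-powers (trans eq₂ (cong (λ x → x ↑ 2 + ι 2 * z) w≡))

      -- With y = w², these remain of the conditions for the exponents 6, 8 and 7 after B and E are
      -- eliminated and the factors 6z, 8z and 7zw are split off.
      quadratic cubic seventh : (y z : Carrier) → Carrier
      quadratic y z = y * y + - (ι 6 * (y * z)) + ι 2 * (z * z)
      seventh y z = y * y + - (ι 4 * (y * z)) + - (ι 8 * (z * z))
      cubic y z = y * y * y + - (y * y * z) + - (ι 33 * (y * z * z)) + ι 9 * (z * z * z)

      sixth-powers : ∀ v₁ v₂ → let w = v₁ + v₂ ; z = - (v₁ * v₂) in z ≢ 0# →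
        v₁ ↑ 6 + v₂ ↑ 6 ≡ w ↑ 6 + excess 6 z (z * w) ((w * w + - z) * z) → quadratic (w * w) z ≡ 0#
      sixth-powers v₁ v₂ z≢0 eq = cancel-unit z≢0 (cancel-unit 3≢0 (cancel-unit 2≢0 (difference eq
        (solve 2 (λ v₁ v₂ → let w = v₁ :+ v₂ ; z = :- (v₁ :* v₂) ; y = w :* w in
          (v₁ :^ 6 :+ v₂ :^ 6) :- (w :^ 6 :+ :excess z (z :* w) ((w :* w :- z) :* z) 6) :=
          :n 2 :* (:n 3 :* (z :* (y :* y :- :n 6 :* (y :* z) :+ :n 2 :* (z :* z))))) refl v₁ v₂))))

      eighth-powers : ∀ v₁ v₂ → let w = v₁ + v₂ ; z = - (v₁ * v₂) in z ≢ 0# →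
        v₁ ↑ 8 + v₂ ↑ 8 ≡ w ↑ 8 + excess 8 z (z * w) ((w * w + - z) * z) → cubic (w * w) z ≡ 0#
      eighth-powers v₁ v₂ z≢0 eq = cancel-unit z≢0 (cancel-unit 2≢0 (cancel-unit 2≢0 (cancel-unit 2≢0 (difference eq
        (solve 2 (λ v₁ v₂ → let w = v₁ :+ v₂ ; z = :- (v₁ :* v₂) ; y = w :* w in
          (v₁ :^ 8 :+ v₂ :^ 8) :- (w :^ 8 :+ :excess z (z :* w) ((w :* w :- z) :* z) 8) :=
          :n 2 :* (:n 2 :* (:n 2 :* (z :* (y :* y :* y :- y :* y :* z :- :n 33 :* (y :* z :* z)
             :+ :n 9 :* (z :* z :* z)))))) refl v₁ v₂)))))

      seventh-powers : ∀ v₁ v₂ → let w = v₁ + v₂ ; z = - (v₁ * v₂) in z ≢ 0# → ι 7 ≢ 0# →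
        v₁ ↑ 7 + v₂ ↑ 7 ≡ w ↑ 7 + excess 7 z (z * w) ((w * w + - z) * z) → w * seventh (w * w) z ≡ 0#
      seventh-powers v₁ v₂ z≢0 7≢0 eq = cancel-unit z≢0 (cancel-unit 7≢0 (difference eq
        (solve 2 (λ v₁ v₂ → let w = v₁ :+ v₂ ; z = :- (v₁ :* v₂) ; y = w :* w in
          (v₁ :^ 7 :+ v₂ :^ 7) :- (w :^ 7 :+ :excess z (z :* w) ((w :* w :- z) :* z) 7) :=
          :n 7 :* (z :* (w :* (y :* y :- :n 4 :* (y :* z) :- :n 8 :* (z :* z))))) refl v₁ v₂)))

      quadratic-cubic⇒0 : ∀ {y z} → quadratic y z ≡ 0# → cubic y z ≡ 0# → z ≡ 0#
      quadratic-cubic⇒0 {y} {z} eq₂ eq₃ with z ≟ 0#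
      ... | yes z≡0 = z≡0
      ... | no z≢0 = ⊥-elim (*-≢0 (*-≢0 (*-≢0 3≢0 3≢0) (*-≢0 3≢0 3≢0)) (*-≢0 (*-≢0 z≢0 z≢0) (*-≢0 z≢0 z≢0)) (begin
        ι 3 * ι 3 * (ι 3 * ι 3) * (z * z * (z * z))
          -- The Euclidean algorithm: C = (y + 5z)Q - z²(5y + z), and 25Q = (5y - 31z)(5y + z) +
          -- 81z². The constant 81 is a power of 3, hence a unit.
          ≡⟨ solve 2 (λ y z → let Q = y :* y :- :n 6 :* (y :* z) :+ :n 2 :* (z :* z)
                                  C = y :* y :* y :- y :* y :* z :- :n 33 :* (y :* z :* z) :+ :n 9 :* (z :* z :* z) in
               :n 3 :* :n 3 :* (:n 3 :* :n 3) :* (z :* z :* (z :* z)) :=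
               (:n 25 :* (z :* z) :- (y :+ :n 5 :* z) :* (:n 5 :* y :- :n 31 :* z)) :* Q
                 :+ (:n 5 :* y :- :n 31 :* z) :* C) refl y z ⟩
        (ι 25 * (z * z) + - ((y + ι 5 * z) * (ι 5 * y + - (ι 31 * z)))) * quadratic y z
          + (ι 5 * y + - (ι 31 * z)) * cubic y z
          ≡⟨ cong₂ (λ a b → (ι 25 * (z * z) + - ((y + ι 5 * z) * (ι 5 * y + - (ι 31 * z)))) * a
                             + (ι 5 * y + - (ι 31 * z)) * b) eq₂ eq₃ ⟩
        (ι 25 * (z * z) + - ((y + ι 5 * z) * (ι 5 * y + - (ι 31 * z)))) * 0#
          + (ι 5 * y + - (ι 31 * z)) * 0#
          ≡⟨ cong₂ _+_ (zeroʳ _) (zeroʳ _) ⟩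
        0# + 0#
          ≡⟨ +-identityˡ 0# ⟩
        0# ∎))
        where open ≡-Reasoning

      quadratic-seventh⇒0 : ∀ {w z} → quadratic (w * w) z ≡ 0# → w * seventh (w * w) z ≡ 0# → z ≡ 0#
      quadratic-seventh⇒0 {w} {z} eq₂ eq₇ with z ≟ 0# | *-≡0 eq₇
      ... | yes z≡0 | _ = z≡0
      ... | no z≢0 | inj₁ refl = ⊥-elim (*-≢0 2≢0 (*-≢0 z≢0 z≢0) (trans
        (solve 1 (λ z → :n 2 :* (z :* z) := :n 0 :* :n 0 :* (:n 0 :* :n 0) :- :n 6 :* (:n 0 :* :n 0 :* z) :+ :n 2 :* (z :* z))
          refl z) eq₂))
      ... | no z≢0 | inj₂ eq = ⊥-elim (*-≢0 (*-≢0 2≢0 3≢0) (*-≢0 z≢0 (*-≢0 z≢0 z≢0)) (begin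
        ι 2 * ι 3 * (z * (z * z))
          -- Here S - Q = 2z(y - 5z), while (y - 5z)(y - z) = Q + 3z².
          ≡⟨ solve 2 (λ y z → let Q = y :* y :- :n 6 :* (y :* z) :+ :n 2 :* (z :* z)
                                  S = y :* y :- :n 4 :* (y :* z) :- :n 8 :* (z :* z) in
               :n 2 :* :n 3 :* (z :* (z :* z)) := (S :- Q) :* (y :- z) :- :n 2 :* z :* Q) refl (w * w) z ⟩
        (seventh (w * w) z + - quadratic (w * w) z) * (w * w + - z) + - (ι 2 * z * quadratic (w * w) z)
          ≡⟨ cong₂ (λ a b → (a + - b) * (w * w + - z) + - (ι 2 * z * b)) eq eq₂ ⟩
        (0# + - 0#) * (w * w + - z) + - (ι 2 * z * 0#)
          ≡⟨ solve 2 (λ y z → (:n 0 :- :n 0) :* (y :- z) :- :n 2 :* z :* :n 0 := :n 0) refl (w * w) z ⟩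
        0# ∎))
        where open ≡-Reasoning

      high-powers : ∀ {v₁ v₂ w z B E} →
        w ≡ v₁ + v₂ × z ≡ - (v₁ * v₂) × B ≡ z * w × E ≡ (w * w + - z) * z → z ≢ 0# →
        v₁ ↑ 6 + v₂ ↑ 6 ≡ w ↑ 6 + excess 6 z B E →
        (ι 7 ≢ 0# × v₁ ↑ 7 + v₂ ↑ 7 ≡ w ↑ 7 + excess 7 z B E) ⊎ v₁ ↑ 8 + v₂ ↑ 8 ≡ w ↑ 8 + excess 8 z B E →
        z ≡ 0#
      high-powers {v₁} {v₂} (refl , refl , refl , refl) z≢0 eq₆ (inj₁ (7≢0 , eq₇)) =
        quadratic-seventh⇒0 (sixth-powers v₁ v₂ z≢0 eq₆) (seventh-powers v₁ v₂ z≢0 7≢0 eq₇)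
      high-powers {v₁} {v₂} (refl , refl , refl , refl) z≢0 eq₆ (inj₂ eq₈) =
        quadratic-cubic⇒0 (sixth-powers v₁ v₂ z≢0 eq₆) (eighth-powers v₁ v₂ z≢0 eq₈)

  -- Laurent polynomials with D ≠ 0

  module NearPermutation (2≢0 : ι 2 ≢ 0#) (3≢0 : ι 3 ≢ 0#) (24≤r : 24 ≤ r)
    (24<r⊎char5 : 24 < r ⊎ ι 5 ≡ 0#) (D α β δ : Carrier) where
    open Sums D α β δ

    8<r : 8 < r
    8<r = ℕₚ.≤-trans (ℕₚ.m≤m+n 9 15) 24≤r

    module _ {w v₁ v₂ : Carrier}
      (eq : (h : Carrier → Carrier) →
            ∑ (map (λ u → h (φ u)) units) + (h v₁ + h v₂) ≡ ∑ (map h elements) + h w) where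

      powers : ∀ k l → suc k ℕ.+ l ≡ 8 → l ℕ.+ 4 ℕ.* suc k < r ℕ.+ 8 →
               ⟦ coefficient (suc k) l ⟧ ρ ≡ excess (suc k) z B E →
               v₁ ↑ suc k + v₂ ↑ suc k ≡ w ↑ suc k + excess (suc k) z B E
      powers k l k+l≡8 lt c≡s = begin
        V                                    ≡⟨ solve 2 (λ S V → V := (:- S :+ V) :+ S) refl S V ⟩
        - S + V + S                          ≡⟨ cong (λ x → - x + V + S) (sym c≡s) ⟩
        - ⟦ coefficient (suc k) l ⟧ ρ + V + S ≡⟨ cong (λ x → x + V + S) (sym (power-sum 8<r (suc k) l k+l≡8 lt)) ⟩
        ∑ (map (λ u → φ u ↑ suc k) units) + V + S ≡⟨ cong (_+ S) (eq (_↑ suc k)) ⟩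
        ∑ (map (_↑ suc k) elements) + w ↑ suc k + S
          ≡⟨ cong (λ x → x + w ↑ suc k + S) (∑-elements-↑ k (ℕₚ.≤-<-trans (ℕₚ.≤-trans (ℕₚ.m≤m+n (suc k) l) (ℕₚ.≤-reflexive k+l≡8)) 8<r)) ⟩
        0# + w ↑ suc k + S                   ≡⟨ cong (_+ S) (+-identityˡ _) ⟩
        w ↑ suc k + S ∎
        where
        open ≡-Reasoning
        V = v₁ ↑ suc k + v₂ ↑ suc k
        S = excess (suc k) z B E

      private
        small : ∀ {n} → n ≤ 31 → n < r ℕ.+ 8
        small le = ℕₚ.≤-trans (s≤s le) (ℕₚ.+-monoˡ-≤ 8 24≤r)

      low : w ≡ v₁ + v₂ × z ≡ - (v₁ * v₂) × B ≡ z * w × E ≡ (w * w + - z) * z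
      low = low-powers 2≢0 3≢0
        (powers 0 7 refl (small (ℕₚ.m≤m+n 11 20)) (prove ρ (coefficient 1 7) (:n 0) refl))
        (powers 1 6 refl (small (ℕₚ.m≤m+n 14 17)) (prove ρ (coefficient 2 6) (:excess :z :B :E 2) refl))
        (powers 2 5 refl (small (ℕₚ.m≤m+n 17 14)) (prove ρ (coefficient 3 5) (:excess :z :B :E 3) refl))
        (powers 3 4 refl (small (ℕₚ.m≤m+n 20 11)) (prove ρ (coefficient 4 4) (:excess :z :B :E 4) refl))

      z≡0 : z ≡ 0#
      z≡0 with z ≟ 0#
      ... | yes z≡0 = z≡0
      ... | no z≢0 = high-powers 2≢0 3≢0 low z≢0
              (powers 5 2 refl (small (ℕₚ.m≤m+n 26 5)) (prove ρ (coefficient 6 2) (:excess :z :B :E 6) refl))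
              (seventh-or-eighth 24<r⊎char5)
        where
        -- φ⁸ runs from u⁻⁸ to u²⁴. For r = 24 also u²⁴ = 1, so the power sum would not be the
        -- constant term alone. Then q = 25, the characteristic is 5, and 7 is a unit, so exponent 7
        -- can be used.
        seventh-or-eighth : 24 < r ⊎ ι 5 ≡ 0# →
          (ι 7 ≢ 0# × v₁ ↑ 7 + v₂ ↑ 7 ≡ w ↑ 7 + excess 7 z B E) ⊎ v₁ ↑ 8 + v₂ ↑ 8 ≡ w ↑ 8 + excess 8 z B E
        seventh-or-eighth (inj₁ 24<r) =
          inj₂ (powers 7 0 refl (ℕₚ.+-monoˡ-≤ 8 24<r) (prove ρ (coefficient 8 0) (:excess :z :B :E 8) refl))
        seventh-or-eighth (inj₂ 5≡0) = inj₁ (7≢0 ,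
          powers 6 1 refl (small (ℕₚ.m≤m+n 29 2)) (prove ρ (coefficient 7 1) (:excess :z :B :E 7) refl))
          where
          7≢0 : ι 7 ≢ 0#
          7≢0 7≡0 = 1≢0 (trans (solve 0 (:n 1 := :n 3 :* :n 5 :- :n 2 :* :n 7) refl)
            (trans (cong₂ (λ a b → ι 3 * a + - (ι 2 * b)) 5≡0 7≡0)
              (solve 0 (:n 3 :* :n 0 :- :n 2 :* :n 0 := :n 0) refl)))

    few-values-D≢0 : D ≢ 0# → ¬ (α ≡ 0# × β ≡ 0# × δ ≡ 0#) → #values φ units ℕ.+ 2 ≤ r
    few-values-D≢0 D≢0 nonzero with few-values⊎almost-permutation φ
    ... | inj₁ few = few
    ... | inj₂ (w , v₁ , v₂ , eq) = ⊥-elim (nonzero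
          ( cancel-unit D≢0 (z≡0 eq)
          , cancel-unit (↑-≢0 2 D≢0) (trans (proj₁ (proj₂ (proj₂ (low eq))))
              (trans (cong (_* w) (z≡0 eq)) (zeroˡ w)))
          , cancel-unit (↑-≢0 3 D≢0) (trans (proj₂ (proj₂ (proj₂ (low eq))))
              (trans (cong ((w * w + - z) *_) (z≡0 eq)) (zeroʳ (w * w + - z))))))

  -- Laurent polynomials with D = 0

  module Cubic (α β δ : Carrier) where
    private
      ψ : Carrier → Carrier
      ψ u = α * u + (β * (u * u) + δ * (u * u * u))

      U : ℕ → ℕ → Carrier
      U k j = ∑ (map (λ u → u ↑ j * ψ u ↑ k) units)

      U-suc : ∀ k j → U (suc k) j ≡ α * U k (1 ℕ.+ j) + (β * U k (2 ℕ.+ j) + δ * U k (3 ℕ.+ j))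
      U-suc k j = begin
        U (suc k) j
          ≡⟨ ∑-cong units (λ {u} _ → solve 6 (λ u α β δ p n →
               p :* ((α :* u :+ (β :* (u :* u) :+ δ :* (u :* u :* u))) :* n) :=
               α :* (u :* p :* n) :+ (β :* (u :* (u :* p) :* n) :+ δ :* (u :* (u :* (u :* p)) :* n)))
               refl u α β δ (u ↑ j) (ψ u ↑ k)) ⟩
        ∑ (map (λ u → α * (u ↑ (1 ℕ.+ j) * ψ u ↑ k) +
             (β * (u ↑ (2 ℕ.+ j) * ψ u ↑ k) + δ * (u ↑ (3 ℕ.+ j) * ψ u ↑ k))) units)
          ≡⟨ trans (∑-+ _ _ units) (cong₂ _+_ (∑-* _ _ units)
               (trans (∑-+ _ _ units) (cong₂ _+_ (∑-* _ _ units) (∑-* _ _ units)))) ⟩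
        α * U k (1 ℕ.+ j) + (β * U k (2 ℕ.+ j) + δ * U k (3 ℕ.+ j)) ∎
        where open ≡-Reasoning

      regroup : ∀ k j → suc j ℕ.+ 3 ℕ.* suc k ≡ 3 ℕ.+ suc j ℕ.+ 3 ℕ.* k
      regroup k j = trans (cong (suc j ℕ.+_) (ℕₚ.*-suc 3 k))
        (trans (sym (ℕₚ.+-assoc (suc j) 3 _)) (cong (ℕ._+ 3 ℕ.* k) (ℕₚ.+-comm (suc j) 3)))

      U-below : ∀ k j → suc j ℕ.+ 3 ℕ.* k < r → U k (suc j) ≡ 0#
      U-below zero j lt = trans (∑-cong units (λ _ → *-identityʳ _))
        (∑-↑ j (subst (_< r) (ℕₚ.+-identityʳ (suc j)) lt))
      U-below (suc k) j lt = trans (U-suc k (suc j)) (trans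
        (cong₂ _+_ (cong (α *_) (U-below k (suc j) (drop 2 lt′)))
          (cong₂ _+_ (cong (β *_) (U-below k (2 ℕ.+ j) (drop 1 lt′))) (cong (δ *_) (U-below k (3 ℕ.+ j) lt′))))
        (solve 3 (λ α β δ → α :* :n 0 :+ (β :* :n 0 :+ δ :* :n 0) := :n 0) refl α β δ))
        where
        lt′ : 3 ℕ.+ suc j ℕ.+ 3 ℕ.* k < r
        lt′ = subst (_< r) (regroup k j) lt
        drop : ∀ i {m} → i ℕ.+ m < r → m < r
        drop i = ℕₚ.≤-<-trans (ℕₚ.m≤n+m _ i)

      -- The only monomial that reaches the exponent r is δᵏuʳ, and uʳ = 1 sums to -1; all others
      -- have exponents between 1 and r - 1.
      U-exact : ∀ k j → suc j ℕ.+ 3 ℕ.* k ≡ r → U k (suc j) ≡ - (δ ↑ k)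
      U-exact zero j eq = trans (∑-cong units (λ {u} u∈ → trans (*-identityʳ _)
        (trans (cong (u ↑_) (trans (sym (ℕₚ.+-identityʳ (suc j))) eq)) (fermat (∈-units⁻ u∈))))) ∑-1
      U-exact (suc k) j eq = trans (U-suc k (suc j)) (trans
        (cong₂ _+_ (cong (α *_) (U-below k (suc j) (below 1 eq′)))
          (cong₂ _+_ (cong (β *_) (U-below k (2 ℕ.+ j) (below 0 eq′))) (cong (δ *_) (U-exact k (3 ℕ.+ j) eq′))))
        (solve 4 (λ α β δ p → α :* :n 0 :+ (β :* :n 0 :+ δ :* :- p) := :- (δ :* p)) refl α β δ (δ ↑ k)))
        where
        eq′ : 3 ℕ.+ suc j ℕ.+ 3 ℕ.* k ≡ r
        eq′ = trans (sym (regroup k j)) eq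
        below : ∀ i {m} → suc i ℕ.+ m ≡ r → m < r
        below i {m} eq = ℕₚ.≤-trans (s≤s (ℕₚ.m≤n+m m i)) (ℕₚ.≤-reflexive eq)

    -- Every term of ψ is divisible by u, so the expansion of ψ^(1+k) starts with exponent 1.
    cubic-power-sum : ∀ k → 3 ℕ.* suc k ≡ r → ∑ (map (λ u → ψ u ↑ suc k) units) ≡ - (δ ↑ suc k)
    cubic-power-sum k eq = trans (∑-cong units (λ _ → sym (*-identityˡ _))) (trans (U-suc k 0) (trans
      (cong₂ _+_ (cong (α *_) (U-below k 0 (below 1 eq′)))
        (cong₂ _+_ (cong (β *_) (U-below k 1 (below 0 eq′))) (cong (δ *_) (U-exact k 2 eq′))))
      (solve 4 (λ α β δ p → α :* :n 0 :+ (β :* :n 0 :+ δ :* :- p) := :- (δ :* p)) refl α β δ (δ ↑ k))))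
      where
      eq′ : 3 ℕ.+ 3 ℕ.* k ≡ r
      eq′ = trans (sym (ℕₚ.*-suc 3 k)) eq
      below : ∀ i {m} → suc i ℕ.+ m ≡ r → m < r
      below i {m} eq = ℕₚ.≤-trans (s≤s (ℕₚ.m≤n+m m i)) (ℕₚ.≤-reflexive eq)

  zero-product-↑ : ∀ {v w} k → v * w ≡ 0# → v ↑ suc k + w ↑ suc k ≡ (v + w) ↑ suc k
  zero-product-↑ {v} {w} k vw≡0 with *-≡0 vw≡0
  ... | inj₁ refl = trans (cong (_+ w ↑ suc k) (zeroˡ (0# ↑ k))) (trans (+-identityˡ _)
                      (cong (_↑ suc k) (sym (+-identityˡ w))))
  ... | inj₂ refl = trans (cong (v ↑ suc k +_) (zeroˡ (0# ↑ k))) (trans (+-identityʳ _)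
                      (cong (_↑ suc k) (sym (+-identityʳ v))))

  -- Otherwise the exponents 1 and 2 give w = v₁ + v₂ and v₁v₂ = 0, so one of v₁, v₂ is 0 and the
  -- corrections cancel in every power sum. The exponent r/3, for which the sum is -δ^(r/3), then
  -- contradicts δ ≠ 0.
  few-values-D≡0 : ι 2 ≢ 0# → 8 < r → ∀ k → 3 ℕ.* suc k ≡ r → ∀ D α β δ → D ≡ 0# → δ ≢ 0# →
                   #values (laurent D α β δ) units ℕ.+ 2 ≤ r
  few-values-D≡0 2≢0 8<r k 3k≡r D α β δ refl δ≢0 with few-values⊎almost-permutation (laurent 0# α β δ)
  ... | inj₁ few = few
  ... | inj₂ (w , v₁ , v₂ , eq) = ⊥-elim (↑-≢0 (suc k) δ≢0 (begin
      δ ↑ suc k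
        ≡⟨ solve 1 (λ x → x := :- :- x) refl (δ ↑ suc k) ⟩
      - - (δ ↑ suc k)
        ≡⟨ cong -_ (sym (Cubic.cubic-power-sum α β δ k 3k≡r)) ⟩
      - ∑ (map (λ u → (α * u + (β * (u * u) + δ * (u * u * u))) ↑ suc k) units)
        ≡⟨ cong -_ (sym (∑-cong units (λ {u} _ → cong (_↑ suc k) (trans (cong (_+ (α * u + (β * (u * u) + δ * (u * u * u)))) (zeroˡ (u ⁻¹))) (+-identityˡ _))))) ⟩
      - S
        ≡⟨ solve 2 (λ S W → :- S := :- (S :+ W) :+ W) refl S W ⟩
      - (S + W) + W
        ≡⟨ cong (λ x → - (S + x) + W) (sym (sums k)) ⟩
      - (S + (v₁ ↑ suc k + v₂ ↑ suc k)) + W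
        ≡⟨ cong (λ x → - x + W) (eq (_↑ suc k)) ⟩
      - (∑ (map (_↑ suc k) elements) + W) + W
        ≡⟨ cong (λ x → - (x + W) + W) (∑-elements-↑ k k<r) ⟩
      - (0# + W) + W
        ≡⟨ solve 1 (λ W → :- (:n 0 :+ W) :+ W := :n 0) refl W ⟩
      0# ∎))
    where
    open ≡-Reasoning
    S = ∑ (map (λ u → laurent 0# α β δ u ↑ suc k) units)
    W = w ↑ suc k
    k<r : suc k < r
    k<r = ℕₚ.<-≤-trans (ℕₚ.m<m+n (suc k) (s≤s z≤n)) (ℕₚ.≤-reflexive 3k≡r)
    open Sums 0# α β δ using (ρ; power-sum)
    low : ∀ k l → suc k ℕ.+ l ≡ 8 → l ℕ.+ 4 ℕ.* suc k < r ℕ.+ 8 → ⟦ coefficient (suc k) l ⟧ ρ ≡ 0# →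
          v₁ ↑ suc k + v₂ ↑ suc k ≡ w ↑ suc k
    low k l k+l≡8 lt c≡0 = begin
      v₁ ↑ suc k + v₂ ↑ suc k
        ≡⟨ solve 1 (λ V → V := :- :n 0 :+ V) refl (v₁ ↑ suc k + v₂ ↑ suc k) ⟩
      - 0# + (v₁ ↑ suc k + v₂ ↑ suc k)
        ≡⟨ cong (_+ (v₁ ↑ suc k + v₂ ↑ suc k)) (sym (trans (power-sum 8<r (suc k) l k+l≡8 lt) (cong -_ c≡0))) ⟩
      ∑ (map (λ u → laurent 0# α β δ u ↑ suc k) units) + (v₁ ↑ suc k + v₂ ↑ suc k)
        ≡⟨ eq (_↑ suc k) ⟩
      ∑ (map (_↑ suc k) elements) + w ↑ suc k
        ≡⟨ cong (_+ w ↑ suc k) (∑-elements-↑ k (ℕₚ.≤-<-trans (ℕₚ.≤-trans (ℕₚ.m≤m+n (suc k) l) (ℕₚ.≤-reflexive k+l≡8)) 8<r)) ⟩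
      0# + w ↑ suc k
        ≡⟨ +-identityˡ _ ⟩
      w ↑ suc k ∎
    w≡ : w ≡ v₁ + v₂
    w≡ = trans (solve 1 (λ w → w := w :^ 1) refl w) (trans
      (sym (low 0 7 refl (ℕₚ.≤-trans (ℕₚ.m≤m+n 12 5) (ℕₚ.+-monoˡ-≤ 8 8<r))
        (prove ρ (coefficient 1 7) (:n 0) refl)))
      (solve 2 (λ v w → v :^ 1 :+ w :^ 1 := v :+ w) refl v₁ v₂))
    c₂≡0 : ⟦ coefficient 2 6 ⟧ ρ ≡ 0#
    c₂≡0 = trans (prove ρ (coefficient 2 6) (:n 2 :* (var 0F :* var 1F)) refl)
      (trans (cong (ι 2 *_) (zeroˡ α)) (zeroʳ (ι 2)))
    squares : v₁ ↑ 2 + v₂ ↑ 2 ≡ w ↑ 2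
    squares = low 1 6 refl (ℕₚ.≤-trans (ℕₚ.m≤m+n 15 2) (ℕₚ.+-monoˡ-≤ 8 8<r)) c₂≡0
    v₁v₂≡0 : v₁ * v₂ ≡ 0#
    v₁v₂≡0 = cancel-unit 2≢0 (trans
      (solve 2 (λ v w → :n 2 :* (v :* w) := (v :+ w) :^ 2 :- (v :^ 2 :+ w :^ 2)) refl v₁ v₂)
      (trans (cong₂ (λ a b → a ↑ 2 + - b) (sym w≡) squares) (-‿inverseʳ (w ↑ 2))))
    sums : ∀ k → v₁ ↑ suc k + v₂ ↑ suc k ≡ w ↑ suc k
    sums k = trans (zero-product-↑ k v₁v₂≡0) (cong (_↑ suc k) (sym w≡))



-- Arithmetic modulo n = 1 + n′, where Fermat's little theorem supplies the inverse as uⁿ⁻².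
unit-pairs : ℕ → List (ℕ × ℕ)
unit-pairs n′ = map (λ i → suc i , (suc i ℕ.^ (n′ ℕ.∸ 1)) % suc n′) (upTo n′)

-- A certificate that 1, ..., n′ are units modulo n. It makes `ι` injective on the residues, so
-- every field with n elements is the image of 0, ..., n′.
inverses-correct : ℕ → Bool
inverses-correct n′ = all (λ (u , i) → (u ℕ.* i) % suc n′ ℕ.≡ᵇ 1) (unit-pairs n′)

laurent-mod : ℕ → (D a b e : ℕ) → ℕ × ℕ → ℕ
laurent-mod n′ D a b e (u , i) = (D ℕ.* i ℕ.+ (a ℕ.* u ℕ.+ (b ℕ.* (u ℕ.* u) ℕ.+ e ℕ.* (u ℕ.* u ℕ.* u)))) % suc n′

#values-mod : ℕ → List (ℕ × ℕ) → (D a b e : ℕ) → ℕ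
#values-mod n′ ps D a b e = length (deduplicate ℕ._≟_ (map (laurent-mod n′ D a b e) ps))

all-∈ : {A : Set} (p : A → Bool) {xs : List A} {x : A} → T (all p xs) → x ∈ xs → T (p x)
all-∈ p {xs} h x∈ = All.lookup (Allₚ.all⁺ p xs h) x∈

module PrimeOrder (n′ : ℕ) (F : FiniteField (suc n′)) (inverses! : T (inverses-correct n′)) where
  open FieldTheory F
  open PowerSums F
  open Quartic F

  n : ℕ
  n = suc n′

  ι-% : ∀ m → ι (m % n) ≡ ι m
  ι-% m = sym (begin
    ι m                            ≡⟨ cong ι (m≡m%n+[m/n]*n m n) ⟩
    ι (m % n ℕ.+ m / n ℕ.* n)      ≡⟨ ι-+ (m % n) _ ⟩
    ι (m % n) + ι (m / n ℕ.* n)    ≡⟨ cong (ι (m % n) +_) (trans (ι-* (m / n) n) (trans (cong (ι (m / n) *_) ι-q) (zeroʳ _))) ⟩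
    ι (m % n) + 0#                 ≡⟨ +-identityʳ _ ⟩
    ι (m % n)                      ∎)
    where open ≡-Reasoning

  pair-inverse : ∀ {u i} → (u , i) ∈ unit-pairs n′ → ι u * ι i ≡ 1#
  pair-inverse {u} {i} ui∈ = trans (sym (ι-* u i)) (trans (sym (ι-% (u ℕ.* i)))
    (cong ι (ℕₚ.≡ᵇ⇒≡ ((u ℕ.* i) % n) 1 (all-∈ _ {xs = unit-pairs n′} inverses! ui∈))))

  pair : ∀ {k} → k < n′ → (suc k , (suc k ℕ.^ (n′ ℕ.∸ 1)) % n) ∈ unit-pairs n′
  pair k<n′ = ∈-map⁺ _ (∈-upTo⁺ k<n′)

  ι-<≢0 : ∀ {k} → k < n′ → ι (suc k) ≢ 0#
  ι-<≢0 {k} k<n′ eq = 0≢1 (trans (sym (zeroˡ (ι i))) (trans (cong (_* ι i) (sym eq)) (pair-inverse (pair k<n′))))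
    where i = (suc k ℕ.^ (n′ ℕ.∸ 1)) % n

  ι-injective-< : ∀ {i j} → i < j → j < n → ι i ≢ ι j
  ι-injective-< {i} {j} i<j j<n eq with ℕₚ.m≤n⇒∃[o]m+o≡n i<j
  ... | d , refl = ι-<≢0 (ℕₚ.≤-<-trans (ℕₚ.m≤n+m d i) (ℕₚ.≤-pred j<n)) (+-cancelʳ (ι i) (begin
    ι (suc d) + ι i     ≡⟨ sym (ι-+ (suc d) i) ⟩
    ι (suc (d ℕ.+ i))   ≡⟨ cong (λ k → ι (suc k)) (ℕₚ.+-comm d i) ⟩
    ι (suc (i ℕ.+ d))   ≡⟨ sym eq ⟩
    ι i                 ≡⟨ sym (+-identityˡ _) ⟩
    0# + ι i            ∎))
    where open ≡-Reasoning

  ι-injective : ∀ {i j} → i < n → j < n → ι i ≡ ι j → i ≡ j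
  ι-injective {i} {j} i<n j<n eq with ℕₚ.<-cmp i j
  ... | tri< i<j _ _ = ⊥-elim (ι-injective-< i<j j<n eq)
  ... | tri≈ _ i≡j _ = i≡j
  ... | tri> _ _ j<i = ⊥-elim (ι-injective-< j<i i<n (sym eq))

  ιF : Fin n → Carrier
  ιF i = ι (toℕ i)

  ιU : Fin n′ → Carrier
  ιU i = ι (suc (toℕ i))

  elements-ι : elements ↭ map ιF (allFin n)
  elements-ι = unique-⊆⇒↭
    (Uniqueₚ.map⁺ (λ {i} {j} eq → Finₚ.toℕ-injective (ι-injective (Finₚ.toℕ<n i) (Finₚ.toℕ<n j) eq)) (Uniqueₚ.allFin⁺ n))
    (λ _ → ∈-elements _)
    (ℕₚ.≤-reflexive (trans length-elements (sym (trans (length-map ιF (allFin n)) (length-tabulate {n = n} (λ i → i))))))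

  units-ι : units ↭ map ιU (allFin n′)
  units-ι = unique-⊆⇒↭
    (Uniqueₚ.map⁺ (λ {i} {j} eq → Finₚ.toℕ-injective (ℕₚ.suc-injective
       (ι-injective (s≤s (Finₚ.toℕ<n i)) (s≤s (Finₚ.toℕ<n j)) eq))) (Uniqueₚ.allFin⁺ n′))
    (λ x∈ → let i , _ , eq = ∈-map⁻ ιU x∈ in ∈-units⁺ (λ x≡0 → ι-<≢0 {toℕ i} (Finₚ.toℕ<n i) (trans (sym eq) x≡0)))
    (ℕₚ.≤-reflexive (trans (ℕₚ.suc-injective length-units) (sym (trans (length-map ιU (allFin n′)) (length-tabulate {n = n′} (λ i → i))))))

  abstract
    ι-surjective : ∀ x → ∃ λ k → k < n × x ≡ ι k
    ι-surjective x = let i , _ , eq = ∈-map⁻ ιF {xs = allFin n} (∈-resp-↭ elements-ι (∈-elements x))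
                     in toℕ i , Finₚ.toℕ<n i , eq

    ι-surjective-unit : ∀ {x} → x ≢ 0# → ∃ λ k → k < n′ × x ≡ ι (suc k)
    ι-surjective-unit x≢0 = let i , _ , eq = ∈-map⁻ ιU {xs = allFin n′} (∈-resp-↭ units-ι (∈-units⁺ x≢0))
                            in toℕ i , Finₚ.toℕ<n i , eq

  -- Every value is the image under `ι` of a computed residue. An upper bound is enough, because
  -- computation is applied only to quantities that have to be small.
  #values-≤-mod : ∀ D a b e → #values (laurent (ι D) (ι a) (ι b) (ι e)) units ≤ #values-mod n′ (unit-pairs n′) D a b e
  #values-≤-mod D a b e = subst (#values (laurent (ι D) (ι a) (ι b) (ι e)) units ≤_) (length-map ι vs)
    (#values-≤ (laurent (ι D) (ι a) (ι b) (ι e)) units (map ι vs) covered)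
    where
    vs = deduplicate ℕ._≟_ (map (laurent-mod n′ D a b e) (unit-pairs n′))
    covered : ∀ {x} → x ∈ units → laurent (ι D) (ι a) (ι b) (ι e) x ∈ map ι vs
    covered {x} x∈ = let k , k<n′ , eq = ι-surjective-unit (∈-units⁻ x∈) in
      subst (λ y → laurent (ι D) (ι a) (ι b) (ι e) y ∈ map ι vs) (sym eq) (covered-ι k<n′)
      where
      covered-ι : ∀ {k} → k < n′ → laurent (ι D) (ι a) (ι b) (ι e) (ι (suc k)) ∈ map ι vs
      covered-ι {k} k<n′ = subst (_∈ map ι vs) eq
        (∈-map⁺ ι (∈-deduplicate⁺ ℕ._≟_ (∈-map⁺ (laurent-mod n′ D a b e) (pair k<n′))))
        where
        open ≡-Reasoning
        u = suc k
        i = (suc k ℕ.^ (n′ ℕ.∸ 1)) % n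
        i≡ : ι i ≡ ι u ⁻¹
        i≡ = *-cancelˡ (ι-<≢0 k<n′) (trans (pair-inverse (pair k<n′)) (sym (⁻¹-inverseʳ (ι-<≢0 k<n′))))
        *₃ : ∀ x y z → ι (x ℕ.* y ℕ.* z) ≡ ι x * ι y * ι z
        *₃ x y z = trans (ι-* (x ℕ.* y) z) (cong (_* ι z) (ι-* x y))
        eq : ι (laurent-mod n′ D a b e (u , i)) ≡ laurent (ι D) (ι a) (ι b) (ι e) (ι u)
        eq = begin
          ι (laurent-mod n′ D a b e (u , i))
            ≡⟨ ι-% (D ℕ.* i ℕ.+ (a ℕ.* u ℕ.+ (b ℕ.* (u ℕ.* u) ℕ.+ e ℕ.* (u ℕ.* u ℕ.* u)))) ⟩
          ι (D ℕ.* i ℕ.+ (a ℕ.* u ℕ.+ (b ℕ.* (u ℕ.* u) ℕ.+ e ℕ.* (u ℕ.* u ℕ.* u))))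
            ≡⟨ trans (ι-+ (D ℕ.* i) _) (cong₂ _+_ (trans (ι-* D i) (cong (ι D *_) i≡))
                 (trans (ι-+ (a ℕ.* u) _) (cong₂ _+_ (ι-* a u)
                   (trans (ι-+ (b ℕ.* (u ℕ.* u)) _) (cong₂ _+_
                     (trans (ι-* b (u ℕ.* u)) (cong (ι b *_) (ι-* u u)))
                     (trans (ι-* e (u ℕ.* u ℕ.* u)) (cong (ι e *_) (*₃ u u u)))))))) ⟩
          laurent (ι D) (ι a) (ι b) (ι e) (ι u) ∎

  -- `n′` plays the part of -1. Reduction at sums, products and negations keeps the intermediate
  -- numbers small in the large checks.
  eval-mod : ∀ {m} → Polynomial m → Vec ℕ m → ℕ
  eval-mod (op [+] p p′) ρ = (eval-mod p ρ ℕ.+ eval-mod p′ ρ) % n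
  eval-mod (op [*] p p′) ρ = (eval-mod p ρ ℕ.* eval-mod p′ ρ) % n
  eval-mod (con (ℤ.+ c)) ρ = c
  eval-mod (con -[1+ c ]) ρ = n′ ℕ.* suc c
  eval-mod (var x) ρ = Vec.lookup ρ x
  eval-mod (p :^ k) ρ = eval-mod p ρ ℕ.^ k
  eval-mod (:- p) ρ = (n′ ℕ.* eval-mod p ρ) % n

  ι-neg : ∀ m → ι (n′ ℕ.* m) ≡ - ι m
  ι-neg m = +-cancelʳ (ι m) (begin
    ι (n′ ℕ.* m) + ι m     ≡⟨ +-comm _ _ ⟩
    ι m + ι (n′ ℕ.* m)     ≡⟨ sym (ι-+ m _) ⟩
    ι (n ℕ.* m)            ≡⟨ ι-* n m ⟩
    ι n * ι m              ≡⟨ cong (_* ι m) ι-q ⟩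
    0# * ι m               ≡⟨ zeroˡ _ ⟩
    0#                     ≡⟨ sym (-‿inverseˡ _) ⟩
    - ι m + ι m            ∎)
    where open ≡-Reasoning

  ι-^ : ∀ m k → ι (m ℕ.^ k) ≡ ι m ↑ k
  ι-^ m zero = refl
  ι-^ m (suc k) = trans (ι-* m _) (cong (ι m *_) (ι-^ m k))

  ι-eval : ∀ {m} (p : Polynomial m) (ρ : Vec ℕ m) → ι (eval-mod p ρ) ≡ ⟦ p ⟧ (Vec.map ι ρ)
  ι-eval (op [+] p p′) ρ = trans (ι-% (eval-mod p ρ ℕ.+ eval-mod p′ ρ)) (trans (ι-+ (eval-mod p ρ) _) (cong₂ _+_ (ι-eval p ρ) (ι-eval p′ ρ)))
  ι-eval (op [*] p p′) ρ = trans (ι-% (eval-mod p ρ ℕ.* eval-mod p′ ρ)) (trans (ι-* (eval-mod p ρ) _) (cong₂ _*_ (ι-eval p ρ) (ι-eval p′ ρ)))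
  ι-eval (con (ℤ.+ c)) ρ = refl
  ι-eval (con -[1+ c ]) ρ = ι-neg (suc c)
  ι-eval (var x) ρ = sym (Vecₚ.lookup-map x ι ρ)
  ι-eval (p :^ k) ρ = trans (ι-^ (eval-mod p ρ) k) (cong (_↑ k) (ι-eval p ρ))
  ι-eval (:- p) ρ = trans (ι-% (n′ ℕ.* eval-mod p ρ)) (trans (ι-neg (eval-mod p ρ)) (cong -_ (ι-eval p ρ)))

-- After rescaling, δ = 1 with β = 0 or β = 1 represents every case with δ ≠ 0; only D and α still
-- run through all residues.
quartics-lossy : ℕ → List (ℕ × ℕ) → Bool
quartics-lossy n′ ps = all (λ D → all (λ a → all (λ b →
  #values-mod n′ ps D a b 1 ℕ.+ 2 ℕ.≤ᵇ n′) (upTo 2)) (upTo (suc n′))) (upTo (suc n′))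

binomials-lossy : ℕ → List (ℕ × ℕ) → Bool
binomials-lossy n′ ps = all (λ D → #values-mod n′ ps (suc D) 1 0 0 ℕ.+ 2 ℕ.≤ᵇ n′) (upTo n′)

-- Vertices at distance three

module Geometry {q : ℕ} (F : FiniteField q) where
  open FieldTheory F
  open PowerSums F
  open Quartic F
  open GraphR F
  open import Data.Fin.Patterns

  module _ {m : ℕ} where
    private P = Polynomial m

    -- The formulas are solver polynomials in any number of variables, so that the same expression
    -- serves in ring identities, for evaluation in the field and for computation modulo n.
    :G : P → P → P
    :G b y = b :* y :* (b :+ y :+ b :* y)

    -- Coefficients of (G(b, bA − B + t) − g(b − u)) / u, where g(a) = G(a, aA − B),
    -- as a Laurent polynomial in u; κ is the constant term.
    :c₂ :c₃ : (A B : P) → P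
    :lineD :lineα :lineβ :lineδ :lineκ : (A B b t : P) → P
    :lineD A B b t = :G b (b :* A :- B :+ t) :- :G b (b :* A :- B)
    :c₂ A B = :- (B :* (:n 1 :+ :n 2 :* A :- B))
    :c₃ A B = A :* (:n 1 :+ A :- :n 2 :* B)
    :lineκ A B b t = :n 4 :* (A :* A) :* (b :* b :* b) :+ :n 3 :* :c₃ A B :* (b :* b) :+ :n 2 :* :c₂ A B :* b :+ B :* B
    :lineα A B b t = :- (:n 6 :* (A :* A) :* (b :* b) :+ :n 3 :* :c₃ A B :* b :+ :c₂ A B)
    :lineβ A B b t = :n 4 :* (A :* A) :* b :+ :c₃ A B
    :lineδ A B b t = :- (A :* A)

    -- Coefficients of (G(a + v, c − s + Xv) − G(a, c)) / v as a Laurent polynomial in v.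
    :pointD :pointα :pointβ :pointδ :pointκ : (a c X s : P) → P
    :pointD a c X s = :G a (c :- s) :- :G a c
    :pointκ a c X s = let c = c :- s in
      a :* a :* X :+ :n 2 :* a :* c :+ :n 2 :* a :* c :* X :+ c :* c :+ :n 2 :* (a :* a) :* c :* X :+ :n 2 :* a :* (c :* c)
    :pointα a c X s = let c = c :- s in
      c :* (:n 1 :+ c) :+ X :* (:n 2 :* a :+ :n 2 :* c :+ :n 4 :* (a :* c)) :+ X :* X :* (a :* (:n 1 :+ a))
    :pointβ a c X s = let c = c :- s in X :* (:n 1 :+ :n 2 :* c :+ X :* (:n 1 :+ :n 2 :* a))
    :pointδ a c X s = X :* X

  at : (∀ {m} (x y z t : Polynomial m) → Polynomial m) → (x y z t : Carrier) → Carrier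
  at p x y z t = ⟦ p (var 0F) (var 1F) (var 2F) (var 3F) ⟧ (x ∷ y ∷ z ∷ t ∷ [])

  G : Carrier → Carrier → Carrier
  G b y = b * y * (b + y + b * y)

  lineφ pointφ : (x y z t : Carrier) → Carrier → Carrier
  lineφ A B b t = laurent (at :lineD A B b t) (at :lineα A B b t) (at :lineβ A B b t) (at :lineδ A B b t)
  pointφ a c X s = laurent (at :pointD a c X s) (at :pointα a c X s) (at :pointβ a c X s) (at :pointδ a c X s)

  divided : ∀ {u} D κ α β δ E → u ≢ 0# → E ≡ D + u * (κ + (α * u + (β * (u * u) + δ * (u * u * u)))) →
            κ + laurent D α β δ u ≡ E * u ⁻¹
  divided {u} D κ α β δ E u≢0 refl = begin
    κ + (D * u ⁻¹ + p)                     ≡⟨ solve 3 (λ κ d p → κ :+ (d :+ p) := d :+ :n 1 :* (κ :+ p)) refl κ (D * u ⁻¹) p ⟩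
    D * u ⁻¹ + 1# * (κ + p)                ≡⟨ cong (λ e → D * u ⁻¹ + e * (κ + p)) (sym (⁻¹-inverseʳ u≢0)) ⟩
    D * u ⁻¹ + u * u ⁻¹ * (κ + p)          ≡⟨ solve 4 (λ D i u k → D :* i :+ u :* i :* k := (D :+ u :* k) :* i) refl D (u ⁻¹) u (κ + p) ⟩
    (D + u * (κ + p)) * u ⁻¹ ∎
    where
    open ≡-Reasoning
    p = α * u + (β * (u * u) + δ * (u * u * u))

  line-divided : ∀ A B b t {u} → u ≢ 0# → at :lineκ A B b t + lineφ A B b t u ≡
    (G b (b * A + - B + t) + - G (b + - u) ((b + - u) * A + - B)) * u ⁻¹
  line-divided A B b t {u} u≢0 = divided _ _ _ _ _ _ u≢0
    (solve 5 (λ A B b t u → :G b (b :* A :- B :+ t) :- :G (b :- u) ((b :- u) :* A :- B) :=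
       :lineD A B b t :+ u :* (:lineκ A B b t :+ (:lineα A B b t :* u :+ (:lineβ A B b t :* (u :* u) :+ :lineδ A B b t :* (u :* u :* u)))))
     refl A B b t u)

  point-divided : ∀ a c X s {v} → v ≢ 0# → at :pointκ a c X s + pointφ a c X s v ≡
    (G (a + v) (c + - s + X * v) + - G a c) * v ⁻¹
  point-divided a c X s {v} v≢0 = divided _ _ _ _ _ _ v≢0
    (solve 5 (λ a c X s v → :G (a :+ v) (c :- s :+ X :* v) :- :G a c :=
       :pointD a c X s :+ v :* (:pointκ a c X s :+ (:pointα a c X s :* v :+ (:pointβ a c X s :* (v :* v) :+ :pointδ a c X s :* (v :* v :* v)))))
     refl a c X s v)

  transpose : ∀ {x y z} → x + y ≡ z → x ≡ z + - y
  transpose {x} {y} refl = solve 2 (λ x y → x := x :+ y :- y) refl x y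

  transpose′ : ∀ {x y z} → x + y ≡ z → y ≡ z + - x
  transpose′ {x} {y} eq = transpose (trans (+-comm y x) eq)

  incident-G : ∀ x p₁ p₂ → p₁ * p₂ * x * (p₁ + p₂ + p₁ * p₂) ≡ x * G p₁ p₂
  incident-G = solve 3 (λ x p₁ p₂ → p₁ :* p₂ :* x :* (p₁ :+ p₂ :+ p₁ :* p₂) := x :* :G p₁ p₂) refl

  pointOn : Carrier → F³ → F³
  pointOn a (A , B , C) = a , a * A + - B , A * G a (a * A + - B) + - C

  lineThrough : Carrier → F³ → F³
  lineThrough x (a , c , d) = x , a * x + - c , x * G a c + - d

  incident⇒pointOn : ∀ {p l} → Incident p l → p ≡ pointOn (proj₁ p) l
  incident⇒pointOn {p₁ , p₂ , p₃} {l₁ , l₂ , l₃} (eq₂ , eq₃) with transpose eq₂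
  ... | refl = cong (λ z → p₁ , p₂ , z) (trans (transpose eq₃) (cong (_+ - l₃) (incident-G l₁ p₁ p₂)))

  incident⇒lineThrough : ∀ {p l} → Incident p l → l ≡ lineThrough (proj₁ l) p
  incident⇒lineThrough {p₁ , p₂ , p₃} {l₁ , l₂ , l₃} (eq₂ , eq₃) =
    cong₂ (λ y z → l₁ , y , z) (transpose′ eq₂) (trans (transpose′ eq₃) (cong (_+ - p₃) (incident-G l₁ p₁ p₂)))

  pointOn-incident : ∀ a l → Incident (pointOn a l) l
  pointOn-incident a (A , B , C) =
    solve 2 (λ x B → x :- B :+ B := x) refl (a * A) B ,
    trans (solve 2 (λ x C → x :- C :+ C := x) refl (A * G a (a * A + - B)) C) (sym (incident-G A a (a * A + - B)))

  lineThrough-incident : ∀ x p → Incident p (lineThrough x p)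
  lineThrough-incident x (a , c , d) =
    solve 2 (λ x B → B :+ (x :- B) := x) refl (a * x) c ,
    trans (solve 2 (λ x C → C :+ (x :- C) := x) refl (x * G a c) d) (sym (incident-G x a c))

  -- t is the failure of the first incidence equation with the line. For t ≠ 0 the third coordinate
  -- is injective and affine in v, so κ does not affect the number of values.
  linePoint : F³ → Carrier → Carrier → Carrier → Vertex
  linePoint (A , B , C) b t v = point b (b * A + - B + t)
    (A * G b (b * A + - B + t) + - C + t * (at :lineκ A B b t + v))

  pointLine : F³ → Carrier → Carrier → Carrier → Vertex
  pointLine (a , c , d) X s v = line X (s + - c + a * X) (X * G a c + - d + s * (at :pointκ a c X s + v))

  Parametrises : Vertex → (Carrier → Carrier → Carrier → Vertex) → (Carrier → Carrier → Carrier → Carrier) → Set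
  Parametrises v dec φ = ∀ w → Dist3 v w → ∃ λ k → ∃₂ λ t u → t ≢ 0# × u ≢ 0# × w ≡ dec k t (φ k t u)

  private
    x-x≢0 : ∀ {x y} → x ≢ y → x + - y ≢ 0#
    x-x≢0 x≢y eq = x≢y (x-y≡0⇒x≡y eq)

    walk : ∀ {v w} → Dist3 v w → ∃₂ λ x y → Adj v x × Adj x y × Adj y w
    walk (inj₁ w₂ , ¬w₂) = ⊥-elim (¬w₂ w₂)
    walk (inj₂ (x , vx , inj₁ w₁) , ¬w₂) = ⊥-elim (¬w₂ (inj₂ (x , vx , w₁)))
    walk (inj₂ (x , vx , inj₂ (y , xy , inj₁ refl)) , ¬w₂) = ⊥-elim (¬w₂ (inj₂ (x , vx , inj₂ (y , xy , refl))))
    walk (inj₂ (x , vx , inj₂ (y , xy , inj₂ (z , yz , refl))) , _) = x , y , vx , xy , yz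

  line-parametrisation : ∀ A B C → Parametrises (line A B C) (linePoint (A , B , C)) (lineφ A B)
  line-parametrisation A B C (inj₂ w) d with walk d
  ... | inj₁ _ , inj₂ _ , _ , _ , ()
  ... | inj₁ _ , inj₁ _ , _ , () , _
  ... | inj₂ _ , _ , () , _
  line-parametrisation A B C (inj₁ (b , w₂ , w₃)) d@(_ , ¬w₂) with walk d
  ... | inj₁ _ , inj₁ _ , _ , () , _
  ... | inj₂ _ , _ , () , _
  ... | inj₁ p@(a , _) , inj₂ l@(x , _) , vp , pl , lw = b , t , u , *-≢0 u≢0 (x-x≢0 x≢A) , u≢0 , w≡
    where
    u = b + - a
    -- The starting line and `l` meet in `p`, at abscissa a; at abscissa b their second coordinates
    -- differ by (b - a)(x - A).
    t = u * (x + - A)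
    p≡ = incident⇒pointOn vp
    l≡ = incident⇒lineThrough pl
    -- A point of `l` is determined by its first coordinate, and so is a line through `p`. Hence a =
    -- b would make the endpoint equal to `p`, and x = A would make `l` the starting line; either
    -- way the endpoint would be too close.
    a≢b : b ≢ a
    a≢b refl = ¬w₂ (inj₁ (inj₂ (inj₁ p , vp , cong inj₁ (trans (incident⇒pointOn pl) (sym (incident⇒pointOn lw))))))
    x≢A : x ≢ A
    x≢A refl = ¬w₂ (inj₁ (inj₂ (inj₁ (b , w₂ , w₃) ,
      subst (Incident (b , w₂ , w₃)) (trans l≡ (sym (incident⇒lineThrough vp))) lw , refl)))
    u≢0 = x-x≢0 a≢b
    open ≡-Reasoning
    w≡ : inj₁ (b , w₂ , w₃) ≡ linePoint (A , B , C) b t (lineφ A B b t u)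
    w≡ = cong inj₁ (begin
      (b , w₂ , w₃)
        ≡⟨ incident⇒pointOn lw ⟩
      pointOn b l
        ≡⟨ cong (pointOn b) (trans l≡ (cong (lineThrough x) p≡)) ⟩
      pointOn b (lineThrough x (pointOn a (A , B , C)))
        ≡⟨ cong₂ (λ y z → b , y , z) y≡ (trans (cong (λ y → x * G b y + - (x * Ga + - (A * Ga + - C))) y≡) z≡) ⟩
      (b , Y , A * G b Y + - C + t * (at :lineκ A B b t + lineφ A B b t u)) ∎)
      where
      Y = b * A + - B + t
      Ga = G a (a * A + - B)
      y≡ : b * x + - (a * x + - (a * A + - B)) ≡ Y
      y≡ = solve 5 (λ A B a b x → b :* x :- (a :* x :- (a :* A :- B)) := b :* A :- B :+ (b :- a) :* (x :- A)) refl A B a b x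
      z≡ : x * G b Y + - (x * Ga + - (A * Ga + - C)) ≡ A * G b Y + - C + t * (at :lineκ A B b t + lineφ A B b t u)
      z≡ = begin
        x * G b Y + - (x * Ga + - (A * Ga + - C))
          -- The factor 1 is inserted in order to become u·u⁻¹, whose first half completes x - A to
          -- t.
          ≡⟨ solve 5 (λ A C x Gb Ga → x :* Gb :- (x :* Ga :- (A :* Ga :- C)) :=
               A :* Gb :- C :+ (x :- A) :* :n 1 :* (Gb :- Ga)) refl A C x (G b Y) Ga ⟩
        A * G b Y + - C + (x + - A) * 1# * (G b Y + - Ga)
          ≡⟨ cong₂ (λ e a → A * G b Y + - C + (x + - A) * e * (G b Y + - G a (a * A + - B))) (sym (⁻¹-inverseʳ u≢0))
               (solve 2 (λ a b → a := b :- (b :- a)) refl a b) ⟩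
        A * G b Y + - C + (x + - A) * (u * u ⁻¹) * (G b Y + - G (b + - u) ((b + - u) * A + - B))
          ≡⟨ cong (A * G b Y + - C +_) (solve 4 (λ y u i e → y :* (u :* i) :* e := (u :* y) :* (e :* i)) refl
               (x + - A) u (u ⁻¹) (G b Y + - G (b + - u) ((b + - u) * A + - B))) ⟩
        A * G b Y + - C + t * ((G b Y + - G (b + - u) ((b + - u) * A + - B)) * u ⁻¹)
          ≡⟨ cong (λ e → A * G b Y + - C + t * e) (sym (line-divided A B b t u≢0)) ⟩
        A * G b Y + - C + t * (at :lineκ A B b t + lineφ A B b t u) ∎

  line-dist3 : ∀ A B C b {t u} → t ≢ 0# → u ≢ 0# →
               Dist3 (line A B C) (linePoint (A , B , C) b t (lineφ A B b t u))
  line-dist3 A B C b {t} {u} t≢0 u≢0 =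
    inj₂ (inj₁ p , pointOn-incident a (A , B , C) ,
      inj₂ (inj₂ l , lineThrough-incident x p , inj₂ (inj₁ w , incident , refl))) , not-within
    where
    open ≡-Reasoning
    a = b + - u
    -- Solves t = u(x - A), which reverses the parametrisation.
    x = A + t * u ⁻¹
    p = pointOn a (A , B , C)
    l = lineThrough x p
    Y = b * A + - B + t
    w = b , Y , A * G b Y + - C + t * (at :lineκ A B b t + lineφ A B b t u)
    incident : Incident w l
    incident = (begin
      Y + (a * x + - (a * A + - B))
        ≡⟨ solve 6 (λ A B b t u i → (b :* A :- B :+ t) :+ ((b :- u) :* (A :+ t :* i) :- ((b :- u) :* A :- B)) :=
             b :* (A :+ t :* i) :+ t :* (:n 1 :- u :* i)) refl A B b t u (u ⁻¹) ⟩
      b * x + t * (1# + - (u * u ⁻¹))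
        ≡⟨ cong (λ e → b * x + t * (1# + - e)) (⁻¹-inverseʳ u≢0) ⟩
      b * x + t * (1# + - 1#)
        ≡⟨ solve 2 (λ y t → y :+ t :* (:n 1 :- :n 1) := y) refl (b * x) t ⟩
      b * x ∎) , (begin
      A * G b Y + - C + t * (at :lineκ A B b t + lineφ A B b t u) + (x * Ga + - (A * Ga + - C))
        ≡⟨ cong (λ e → A * G b Y + - C + t * e + (x * Ga + - (A * Ga + - C))) (line-divided A B b t u≢0) ⟩
      A * G b Y + - C + t * ((G b Y + - Ga) * u ⁻¹) + (x * Ga + - (A * Ga + - C))
        ≡⟨ solve 6 (λ A C t i Gb Ga → A :* Gb :- C :+ t :* ((Gb :- Ga) :* i) :+ ((A :+ t :* i) :* Ga :- (A :* Ga :- C)) :=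
             (A :+ t :* i) :* Gb) refl A C t (u ⁻¹) (G b Y) Ga ⟩
      x * G b Y
        ≡⟨ sym (incident-G x b Y) ⟩
      b * Y * x * (b + Y + b * Y) ∎)
      where Ga = G a (a * A + - B)
    not-incident : ¬ Incident w (A , B , C)
    not-incident (eq , _) = t≢0 (begin
      t                        ≡⟨ solve 3 (λ x B t → t := (x :- B :+ t :+ B) :- x) refl (b * A) B t ⟩
      Y + B + - (b * A)        ≡⟨ cong (_+ - (b * A)) eq ⟩
      b * A + - (b * A)        ≡⟨ -‿inverseʳ (b * A) ⟩
      0# ∎)
    -- The graph is bipartite, so a point within distance 2 of a line lies on it, and t ≠ 0 excludes
    -- this.
    not-within : ¬ Within 2 (line A B C) (inj₁ w)
    not-within (inj₁ (inj₁ ()))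
    not-within (inj₁ (inj₂ (_ , inc , refl))) = not-incident inc
    not-within (inj₂ (_ , inc , inj₁ refl)) = not-incident inc
    not-within (inj₂ (inj₁ _ , _ , inj₂ (inj₂ _ , _ , ())))
    not-within (inj₂ (inj₁ _ , _ , inj₂ (inj₁ _ , () , _)))

  point-parametrisation : ∀ a c d → Parametrises (point a c d) (pointLine (a , c , d)) (pointφ a c)
  point-parametrisation a c d (inj₁ w) dist with walk dist
  ... | inj₂ _ , inj₁ _ , _ , _ , ()
  ... | inj₂ _ , inj₂ _ , _ , () , _
  ... | inj₁ _ , _ , () , _
  point-parametrisation a c d (inj₂ (X , w₂ , w₃)) dist@(_ , ¬w₂) with walk dist
  ... | inj₂ _ , inj₂ _ , _ , () , _
  ... | inj₁ _ , _ , () , _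
  ... | inj₂ l@(x , _) , inj₁ p@(b , _) , vl , lp , pw = X , s , v , *-≢0 v≢0 (x-x≢0 X≢x) , v≢0 , w≡
    where
    v = b + - a
    s = v * (X + - x)
    l≡ = incident⇒lineThrough vl
    p≡ = incident⇒pointOn lp
    X≢x : X ≢ x
    X≢x refl = ¬w₂ (inj₁ (inj₂ (inj₂ l , vl , cong inj₂ (trans (incident⇒lineThrough lp) (sym (incident⇒lineThrough pw))))))
    b≢a : b ≢ a
    b≢a refl = ¬w₂ (inj₁ (inj₂ (inj₂ (X , w₂ , w₃) ,
      subst (λ p → Incident p (X , w₂ , w₃)) (trans p≡ (sym (incident⇒pointOn vl))) pw , refl)))
    v≢0 = x-x≢0 b≢a
    open ≡-Reasoning
    w≡ : inj₂ (X , w₂ , w₃) ≡ pointLine (a , c , d) X s (pointφ a c X s v)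
    w≡ = cong inj₂ (begin
      (X , w₂ , w₃)
        ≡⟨ incident⇒lineThrough pw ⟩
      lineThrough X p
        ≡⟨ cong (lineThrough X) (trans p≡ (cong (pointOn b) l≡)) ⟩
      lineThrough X (pointOn b (lineThrough x (a , c , d)))
        ≡⟨ cong₂ (λ y z → X , y , z)
             (solve 5 (λ X x a b c → b :* X :- (b :* x :- (a :* x :- c)) := (b :- a) :* (X :- x) :- c :+ a :* X) refl X x a b c)
             z≡ ⟩
      (X , s + - c + a * X , X * G a c + - d + s * (at :pointκ a c X s + pointφ a c X s v)) ∎)
      where
      Y = b * x + - (a * x + - c)
      z≡ : X * G b Y + - (x * G b Y + - (x * G a c + - d)) ≡ X * G a c + - d + s * (at :pointκ a c X s + pointφ a c X s v)
      z≡ = begin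
        X * G b Y + - (x * G b Y + - (x * G a c + - d))
          ≡⟨ solve 5 (λ X x d Gb Ga → X :* Gb :- (x :* Gb :- (x :* Ga :- d)) :=
               X :* Ga :- d :+ (X :- x) :* :n 1 :* (Gb :- Ga)) refl X x d (G b Y) (G a c) ⟩
        X * G a c + - d + (X + - x) * 1# * (G b Y + - G a c)
          ≡⟨ cong (λ e → X * G a c + - d + (X + - x) * e * (G b Y + - G a c)) (sym (⁻¹-inverseʳ v≢0)) ⟩
        X * G a c + - d + (X + - x) * (v * v ⁻¹) * (G b Y + - G a c)
          ≡⟨ cong₂ (λ b y → X * G a c + - d + (X + - x) * (v * v ⁻¹) * (G b y + - G a c))
               (solve 2 (λ a b → b := a :+ (b :- a)) refl a b)
               (solve 5 (λ X x a b c → b :* x :- (a :* x :- c) := c :- (b :- a) :* (X :- x) :+ X :* (b :- a)) refl X x a b c) ⟩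
        X * G a c + - d + (X + - x) * (v * v ⁻¹) * (G (a + v) (c + - s + X * v) + - G a c)
          ≡⟨ cong (X * G a c + - d +_) (solve 4 (λ y v i e → y :* (v :* i) :* e := (v :* y) :* (e :* i)) refl
               (X + - x) v (v ⁻¹) (G (a + v) (c + - s + X * v) + - G a c)) ⟩
        X * G a c + - d + s * ((G (a + v) (c + - s + X * v) + - G a c) * v ⁻¹)
          ≡⟨ cong (λ e → X * G a c + - d + s * e) (sym (point-divided a c X s v≢0)) ⟩
        X * G a c + - d + s * (at :pointκ a c X s + pointφ a c X s v) ∎

  #fibred : (Carrier → Carrier → Carrier → Carrier) → ℕ
  #fibred φ = Σ elements λ k → Σ units λ t → #values (φ k t) units

  module _ {v : Vertex} {n : ℕ} (dec : Carrier → Carrier → Carrier → Vertex)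
           (φ : Carrier → Carrier → Carrier → Carrier) where

    private
      row : Carrier → Carrier → List Vertex
      row k t = map (dec k t) (values (φ k t) units)

      all-rows : List Vertex
      all-rows = concatMap (λ k → concatMap (row k) units) elements

      length-all-rows : length all-rows ≡ #fibred φ
      length-all-rows = trans (Σ-length _ elements) (Σ-cong elements λ k →
        trans (Σ-length (row k) units) (Σ-cong units λ t → length-map (dec k t) (values (φ k t) units)))

    R3-≤ : R3 v n → Parametrises v dec φ → n ≤ #fibred φ
    R3-≤ (xs , xs! , refl , ∈xs) param = subst (length xs ≤_) length-all-rows
      (unique-⊆⇒length≤ xs! λ {w} w∈ → covered w (Equivalence.from (∈xs w) w∈))
      where
      covered : ∀ w → Dist3 v w → w ∈ all-rows
      covered w d = let k , t , u , t≢0 , u≢0 , eq = param w d in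
        ∈-concatMap (λ k → concatMap (row k) units) (∈-elements k) (∈-concatMap (row k) (∈-units⁺ t≢0)
          (subst (_∈ row k t) (sym eq) (∈-map⁺ (dec k t) (∈-values⁺ (φ k t) (∈-units⁺ u≢0)))))

    R3-≥ : R3 v n → (∀ {k k′ t t′ y y′} → dec k t y ≡ dec k′ t′ y′ → k ≡ k′ × t ≡ t′ × (t ≢ 0# → y ≡ y′)) →
           (∀ k {t u} → t ≢ 0# → u ≢ 0# → Dist3 v (dec k t (φ k t u))) → #fibred φ ≤ n
    R3-≥ (xs , xs! , refl , ∈xs) inj dist = subst (_≤ length xs) length-all-rows
      (unique-⊆⇒length≤ all-rows! λ {w} w∈ → Equivalence.to (∈xs w) (sound w∈))
      where
      all-rows! : Unique all-rows
      all-rows! = Unique-concatMap elements-unique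
        (λ k _ → Unique-concatMap units-unique
          (λ t t∈ → Uniqueₚ.map⁺ (λ eq → proj₂ (proj₂ (inj eq)) (∈-units⁻ t∈)) (values-unique (φ k t) units))
          λ {t} {t′} z∈ z∈′ → let _ , _ , eq = ∈-map⁻ (dec k t) z∈ ; _ , _ , eq′ = ∈-map⁻ (dec k t′) z∈′
                              in proj₁ (proj₂ (inj (trans (sym eq) eq′))))
        λ {k} {k′} z∈ z∈′ → let t , _ , h = ∈-concatMap-witness (row k) units z∈ ; t′ , _ , h′ = ∈-concatMap-witness (row k′) units z∈′
                                _ , _ , eq = ∈-map⁻ (dec k t) h ; _ , _ , eq′ = ∈-map⁻ (dec k′ t′) h′
                            in proj₁ (inj (trans (sym eq) eq′))
      sound : ∀ {w} → w ∈ all-rows → Dist3 v w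
      sound w∈ = let k , _ , h = ∈-concatMap-witness (λ k → concatMap (row k) units) elements w∈
                     t , t∈ , h′ = ∈-concatMap-witness (row k) units h
                     y , y∈ , eq = ∈-map⁻ (dec k t) h′
                     u , u∈ , eq′ = ∈-values⁻ (φ k t) units y∈
                 in subst (Dist3 v) (sym (trans eq (cong (dec k t) eq′))) (dist k (∈-units⁻ t∈) (∈-units⁻ u∈))

  -- The three coordinates yield k, t and y in turn; the last step divides by t.
  linePoint-injective : ∀ {l k k′ t t′ y y′} → linePoint l k t y ≡ linePoint l k′ t′ y′ →
                        k ≡ k′ × t ≡ t′ × (t ≢ 0# → y ≡ y′)
  linePoint-injective {A , B , C} {k} {k′} {t} {t′} {y} {y′} eq = k≡ , t≡ k≡ , λ t≢0 → y≡ k≡ (t≡ k≡) t≢0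
    where
    eq₁ = inj₁-injective eq
    k≡ : k ≡ k′
    k≡ = ,-injectiveˡ eq₁
    +-cancelˡ : ∀ {x y} z → z + x ≡ z + y → x ≡ y
    +-cancelˡ z eq = +-cancelʳ z (trans (+-comm _ z) (trans eq (+-comm z _)))
    t≡ : k ≡ k′ → t ≡ t′
    t≡ refl = +-cancelˡ (k * A + - B) (cong (λ w → proj₁ (proj₂ w)) eq₁)
    y≡ : k ≡ k′ → t ≡ t′ → t ≢ 0# → y ≡ y′
    y≡ refl refl t≢0 = +-cancelˡ (at :lineκ A B k t)
      (*-cancelˡ t≢0 (+-cancelˡ (A * G k (k * A + - B + t) + - C) (cong (λ w → proj₂ (proj₂ w)) eq₁)))

  R3-line : ∀ {A B C n} → R3 (line A B C) n → n ≡ #fibred (lineφ A B)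
  R3-line {A} {B} {C} r3 = ℕₚ.≤-antisym
    (R3-≤ (linePoint (A , B , C)) (lineφ A B) r3 (line-parametrisation A B C))
    (R3-≥ (linePoint (A , B , C)) (lineφ A B) r3 linePoint-injective (line-dist3 A B C))

  -- Points stand only on the smaller side of the comparison, so an upper bound suffices.
  R3-point : ∀ {a c d n} → R3 (point a c d) n → n ≤ #fibred (pointφ a c)
  R3-point {a} {c} {d} r3 = R3-≤ (pointLine (a , c , d)) (pointφ a c) r3 (point-parametrisation a c d)

-- Bounds for the sums over all fibres

module Counting {q : ℕ} (F : FiniteField q) where
  open FieldTheory F
  open PowerSums F
  open Quartic F
  open Geometry F
  open import Data.Fin.Patterns

  -- The first case covers lines with A ≠ 0, where δ = -A², and points with X ≠ 0, where δ = X². The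
  -- second covers A = 0, where only α = B(1 - B) and D can be nonzero.
  NonDegenerate : (D α β δ : Carrier) → Set
  NonDegenerate D α β δ = δ ≢ 0# ⊎ (β ≡ 0# × δ ≡ 0# × α ≢ 0# × D ≢ 0#)

  Lossy : Set
  Lossy = ∀ D α β δ → NonDegenerate D α β δ → #values (laurent D α β δ) units ℕ.+ 2 ≤ r

  #line #point : (x y k : Carrier) → ℕ
  #line A B b = Σ units λ t → #values (lineφ A B b t) units
  #point a c X = Σ units λ s → #values (pointφ a c X s) units

  Σ-elements : (c : Carrier → ℕ) → Σ elements c ≡ c 0# ℕ.+ Σ units c
  Σ-elements c = Σ-↭ elements-↭

  Σ-units-≤ : (φ : Carrier → Carrier → Carrier) → Σ units (λ t → #values (φ t) units) ≤ r ℕ.* r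
  Σ-units-≤ φ = Σ-≤-const units λ {t} _ → #values-≤-length (φ t) units

  -x≢0 : ∀ {x} → x ≢ 0# → - x ≢ 0#
  -x≢0 {x} x≢0 eq = x≢0 (trans (solve 1 (λ x → x := :- :- x) refl x) (trans (cong -_ eq) (solve 0 (:- :n 0 := :n 0) refl)))

  lineD-factors : ∀ A B b t → at :lineD A B b t ≡
    b * t * (b + (1# + b) * (ι 2 * (b * A + - B) + t))
  lineD-factors = solve 4 (λ A B b t → :lineD A B b t :=
    b :* t :* (b :+ (:n 1 :+ b) :* (:n 2 :* (b :* A :- B) :+ t))) refl

  lineD-root : ∀ A B b → b ≢ 0# → ∃ λ t₀ → ∀ {t} → t ≢ 0# → t ≢ t₀ → at :lineD A B b t ≢ 0#
  lineD-root A B b b≢0 = t₀ , λ {t} t≢0 t≢t₀ D≡0 →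
    third t≢t₀ (cancel-unit (*-≢0 b≢0 t≢0) (trans (sym (lineD-factors A B b t)) D≡0))
    where
    open ≡-Reasoning
    p = ι 2 * (b * A + - B)
    j = (1# + b) ⁻¹
    -- Root of the last factor of D, which is linear in t. For b = -1 that factor is the nonzero
    -- constant b, and t₀ is a dummy.
    t₀ = - (b * j) + - p
    third : ∀ {t} → t ≢ t₀ → b + (1# + b) * (p + t) ≢ 0#
    third {t} t≢t₀ eq with 1# + b ≟ 0#
    ... | yes b+1≡0 = b≢0 (begin
      b                                ≡⟨ solve 2 (λ b x → b := b :+ :n 0 :* x) refl b (p + t) ⟩
      b + 0# * (p + t)                 ≡⟨ cong (λ e → b + e * (p + t)) (sym b+1≡0) ⟩
      b + (1# + b) * (p + t)           ≡⟨ eq ⟩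
      0# ∎)
    ... | no b+1≢0 = t≢t₀ (*-cancelˡ b+1≢0 (begin
      (1# + b) * t
        ≡⟨ solve 3 (λ b p t → (:n 1 :+ b) :* t := (b :+ (:n 1 :+ b) :* (p :+ t)) :- b :* :n 1 :- (:n 1 :+ b) :* p) refl b p t ⟩
      (b + (1# + b) * (p + t)) + - (b * 1#) + - ((1# + b) * p)
        ≡⟨ cong₂ (λ e o → e + - (b * o) + - ((1# + b) * p)) eq (sym (⁻¹-inverseʳ b+1≢0)) ⟩
      0# + - (b * ((1# + b) * j)) + - ((1# + b) * p)
        ≡⟨ solve 3 (λ b p j → :n 0 :- b :* ((:n 1 :+ b) :* j) :- (:n 1 :+ b) :* p := (:n 1 :+ b) :* (:- (b :* j) :- p)) refl b p j ⟩
      (1# + b) * t₀ ∎))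

  module Upper (lossy : Lossy) {d : ℕ} (r≡ : r ≡ 2 ℕ.+ d) where

    few : ∀ {D α β δ} → NonDegenerate D α β δ → #values (laurent D α β δ) units ≤ d
    few {D} {α} {β} {δ} nd = ℕₚ.+-cancelʳ-≤ 2 _ d
      (ℕₚ.≤-trans (lossy D α β δ nd) (ℕₚ.≤-reflexive (trans r≡ (ℕₚ.+-comm 2 d))))

    oblique-lines : ∀ A B → A ≢ 0# → #fibred (lineφ A B) ≤ q ℕ.* (r ℕ.* d)
    oblique-lines A B A≢0 = ℕₚ.≤-trans
      (Σ-≤-const elements {r ℕ.* d} λ {b} _ → Σ-≤-const units λ {t} _ → few (inj₁ (-x≢0 (*-≢0 A≢0 A≢0))))
      (ℕₚ.≤-reflexive (cong (ℕ._* (r ℕ.* d)) length-elements))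

    -- On the row X = 0 the coefficient δ = X² vanishes and only the trivial bound r² is available.
    points : ∀ a c → #fibred (pointφ a c) ≤ r ℕ.* r ℕ.+ r ℕ.* (r ℕ.* d)
    points a c = ℕₚ.≤-trans (ℕₚ.≤-reflexive (Σ-elements (#point a c))) (ℕₚ.+-mono-≤
      (Σ-units-≤ (pointφ a c 0#))
      (Σ-≤-const units λ {X} X∈ → Σ-≤-const units λ {s} _ → few (inj₁ (*-≢0 (∈-units⁻ X∈) (∈-units⁻ X∈)))))

    -- Where D = 0 the fibre is αu and does take all r = d + 2 values. This happens on the whole row
    -- b = 0 and for at most one t in every other row, whence the terms r² and 2.
    flat-lines : ∀ B → B ≢ 0# → B ≢ 1# → #fibred (lineφ 0# B) ≤ r ℕ.* r ℕ.+ r ℕ.* (r ℕ.* d ℕ.+ 2)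
    flat-lines B B≢0 B≢1 = ℕₚ.≤-trans (ℕₚ.≤-reflexive (Σ-elements (#line 0# B))) (ℕₚ.+-mono-≤
      (Σ-units-≤ (lineφ 0# B 0#)) (Σ-≤-const units λ b∈ → row (∈-units⁻ b∈)))
      where
      α≢0 : ∀ b t → at :lineα 0# B b t ≢ 0#
      α≢0 b t eq = *-≢0 B≢0 (λ 1-B≡0 → B≢1 (sym (x-y≡0⇒x≡y 1-B≡0)))
        (trans (sym (solve 3 (λ B b t → :lineα (:n 0) B b t := B :* (:n 1 :- B)) refl B b t)) eq)
      row : ∀ {b} → b ≢ 0# → #line 0# B b ≤ r ℕ.* d ℕ.+ 2
      row {b} b≢0 = ℕₚ.≤-trans
        (Σ-mono-except _≟_ (proj₁ root) 2 units-unique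
          (λ {t} t∈ t≢t₀ → few (inj₂ (
              solve 3 (λ B b t → :lineβ (:n 0) B b t := :n 0) refl B b t ,
              solve 3 (λ B b t → :lineδ (:n 0) B b t := :n 0) refl B b t ,
              α≢0 b t , proj₂ root (∈-units⁻ t∈) t≢t₀)))
          (ℕₚ.≤-trans (#values-≤-length (lineφ 0# B b (proj₁ root)) units) (ℕₚ.≤-reflexive (trans r≡ (ℕₚ.+-comm 2 d)))))
        (ℕₚ.+-monoˡ-≤ 2 (ℕₚ.≤-reflexive (Σ-const units d)))
        where root = lineD-root 0# B b b≢0

  laurent-D≢0 : ∀ {D α β δ} → D ≢ 0# → α ≡ 0# → β ≡ 0# → δ ≡ 0# → r ≤ #values (laurent D α β δ) units
  laurent-D≢0 {D} D≢0 refl refl refl = #values-injective (laurent D 0# 0# 0#) injective units-unique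
    where
    open ≡-Reasoning
    simplify : ∀ u → laurent D 0# 0# 0# u ≡ D * u ⁻¹
    simplify u = solve 3 (λ D i u → D :* i :+ (:n 0 :* u :+ (:n 0 :* (u :* u) :+ :n 0 :* (u :* u :* u))) := D :* i) refl D (u ⁻¹) u
    injective : ∀ {x y} → x ∈ units → y ∈ units → laurent D 0# 0# 0# x ≡ laurent D 0# 0# 0# y → x ≡ y
    injective {x} {y} x∈ y∈ eq = *-cancelˡ (⁻¹-≢0 (∈-units⁻ x∈)) (begin
      x ⁻¹ * x    ≡⟨ trans (*-comm _ _) (⁻¹-inverseʳ (∈-units⁻ x∈)) ⟩
      1#          ≡⟨ sym (trans (*-comm _ _) (⁻¹-inverseʳ (∈-units⁻ y∈))) ⟩
      y ⁻¹ * y    ≡⟨ cong (_* y) (sym (*-cancelˡ D≢0 (trans (sym (simplify x)) (trans eq (simplify y))))) ⟩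
      x ⁻¹ * y    ∎)

  laurent-D≡0 : ∀ {D α β δ} → D ≡ 0# → α ≡ 0# → β ≡ 0# → δ ≡ 0# → #values (laurent D α β δ) units ≤ 1
  laurent-D≡0 refl refl refl refl = #values-≤ (laurent 0# 0# 0# 0#) units (0# ∷ [])
    λ {u} _ → here (solve 2 (λ i u → :n 0 :* i :+ (:n 0 :* u :+ (:n 0 :* (u :* u) :+ :n 0 :* (u :* u :* u))) := :n 0) refl (u ⁻¹) u)

  1≤#values : (φ : Carrier → Carrier) → 1 ≤ #values φ units
  1≤#values φ with values φ units | ∈-values⁺ φ (∈-units⁺ 1≢0)
  ... | _ ∷ _ | _ = s≤s z≤n

  -- Over the lines [0,B,C] with B ∈ {0, 1} every fibre is u ↦ D/u.
  IsFlat : Carrier → Set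
  IsFlat B = B * (1# + - B) ≡ 0#

  module Flat {B : Carrier} (flat : IsFlat B) where
    α≡0 : ∀ b t → at :lineα 0# B b t ≡ 0#
    α≡0 b t = trans (solve 3 (λ B b t → :lineα (:n 0) B b t := B :* (:n 1 :- B)) refl B b t) flat
    β≡0 : ∀ b t → at :lineβ 0# B b t ≡ 0#
    β≡0 b t = solve 3 (λ B b t → :lineβ (:n 0) B b t := :n 0) refl B b t
    δ≡0 : ∀ b t → at :lineδ 0# B b t ≡ 0#
    δ≡0 b t = solve 3 (λ B b t → :lineδ (:n 0) B b t := :n 0) refl B b t

    full : ∀ {b t} → at :lineD 0# B b t ≢ 0# → r ≤ #values (lineφ 0# B b t) units
    full {b} {t} D≢0 = laurent-D≢0 D≢0 (α≡0 b t) (β≡0 b t) (δ≡0 b t)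

    single : ∀ {b t} → at :lineD 0# B b t ≡ 0# → #values (lineφ 0# B b t) units ≤ 1
    single {b} {t} D≡0 = laurent-D≡0 D≡0 (α≡0 b t) (β≡0 b t) (δ≡0 b t)

    single-row : #line 0# B 0# ≡ r
    single-row = trans (Σ-cong units λ t → ℕₚ.≤-antisym
        (single (solve 2 (λ B t → :lineD (:n 0) B (:n 0) t := :n 0) refl B t))
        (1≤#values (lineφ 0# B 0# t)))
      (trans (Σ-const units 1) (ℕₚ.*-identityʳ r))

    full-row : ∀ {b} → (∀ {t} → t ≢ 0# → at :lineD 0# B b t ≢ 0#) → r ℕ.* r ≤ #line 0# B b
    full-row D≢0 = Σ-≥-const units λ t∈ → full (D≢0 (∈-units⁻ t∈))

    -- Only the fibre at the root of D may drop below r values, and it keeps at least one.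
    almost-full-row : ∀ {b r′} → r ≡ suc r′ → b ≢ 0# → r ℕ.* r ≤ #line 0# B b ℕ.+ r′
    almost-full-row {b} {r′} r≡ b≢0 = ℕₚ.≤-trans (ℕₚ.≤-reflexive (sym (Σ-const units r)))
      (Σ-mono-except _≟_ (proj₁ root) r′ units-unique
        (λ t∈ t≢t₀ → full (proj₂ root (∈-units⁻ t∈) t≢t₀))
        (ℕₚ.≤-trans (ℕₚ.≤-reflexive r≡) (ℕₚ.+-monoˡ-≤ r′ (1≤#values (lineφ 0# B b (proj₁ root))))))
      where root = lineD-root 0# B b b≢0

    -- For b = −1 the factor b + (1 + b)(…) of D is the constant b.
    full-row-−1 : r ℕ.* r ≤ #line 0# B (- 1#)
    full-row-−1 = full-row λ {t} t≢0 D≡0 → *-≢0 (*-≢0 (-x≢0 1≢0) t≢0) (-x≢0 1≢0)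
      (trans (solve 2 (λ B t → (:- :n 1 :* t) :* :- :n 1 :=
        :- :n 1 :* t :* (:- :n 1 :+ (:n 1 :+ :- :n 1) :* (:n 2 :* (:- :n 1 :* :n 0 :- B) :+ t))) refl B t)
       (trans (sym (lineD-factors 0# B (- 1#) t)) D≡0))

  flat-0 : IsFlat 0#
  flat-0 = zeroˡ _

  flat-1 : IsFlat 1#
  flat-1 = trans (*-identityˡ _) (-‿inverseʳ 1#)

  -- The row b = 0 has r values, one for each t. Each of the r other rows has at least r(r - 1) + 1,
  -- with at most one deficient fibre. The last summand r - 1 comes from the row b = -1, which has
  -- no deficient fibre.
  origin-≥ : ∀ {r′} → r ≡ suc r′ → r ℕ.+ (r ℕ.* (r ℕ.* r′ ℕ.+ 1) ℕ.+ r′) ≤ #fibred (lineφ 0# 0#)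
  origin-≥ {r′} r≡ = ℕₚ.≤-trans
    (ℕₚ.+-mono-≤ (ℕₚ.≤-reflexive (sym single-row)) (ℕₚ.≤-trans
      (ℕₚ.+-monoˡ-≤ r′ (ℕₚ.≤-reflexive (sym (Σ-const units (r ℕ.* r′ ℕ.+ 1)))))
      (Σ-gap units (∈-units⁺ (-x≢0 1≢0)) (λ b∈ → row (∈-units⁻ b∈)) (ℕₚ.≤-trans (ℕₚ.≤-reflexive (split r′ r≡)) full-row-−1))))
    (ℕₚ.≤-reflexive (sym (Σ-elements (#line 0# 0#))))
    where
    open Flat flat-0
    split : ∀ r′ → r ≡ suc r′ → r ℕ.* r′ ℕ.+ 1 ℕ.+ r′ ≡ r ℕ.* r
    split r′ r≡ = trans (ℕₚ.+-assoc (r ℕ.* r′) 1 r′) (trans (cong (r ℕ.* r′ ℕ.+_) (sym r≡))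
      (trans (ℕₚ.+-comm _ r) (trans (sym (ℕₚ.*-suc r r′)) (cong (r ℕ.*_) (sym r≡)))))
    row : ∀ {b} → b ≢ 0# → r ℕ.* r′ ℕ.+ 1 ≤ #line 0# 0# b
    row b≢0 = ℕₚ.+-cancelʳ-≤ r′ _ _ (ℕₚ.≤-trans (ℕₚ.≤-reflexive (split r′ r≡)) (almost-full-row r≡ b≢0))

  -- For B = 0 the root -b/(1 + b) of D is a unit in every row b ≠ 0, -1, so each such row is
  -- deficient. For B = 1 the root is (2 + b)/(1 + b), which leaves the units at b = -2; there D =
  -- 2t² and the row is full.
  origin<[0,1,0] : ∀ {r′} → r ≡ suc r′ → 1 ≤ r′ → ι 2 ≢ 0# → #fibred (lineφ 0# 0#) < #fibred (lineφ 0# 1#)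
  origin<[0,1,0] {r′} r≡ 1≤r′ 2≢0 = ℕₚ.<-≤-trans (ℕₚ.m<m+n _ 1≤r′)
    (Σ-gap elements (∈-elements (- ι 2)) (λ {b} _ → row b) gap)
    where
    open ≡-Reasoning
    module Z = Flat flat-0
    module O = Flat flat-1

    deficient-row : ∀ {b} → b ≢ 0# → 1# + b ≢ 0# → #line 0# 0# b ℕ.+ r′ ≤ r ℕ.* r
    deficient-row {b} b≢0 b+1≢0 = ℕₚ.≤-trans
      (Σ-gap units (∈-units⁺ t₀≢0) (λ {t} _ → #values-≤-length (lineφ 0# 0# b t) units)
        (ℕₚ.≤-trans (ℕₚ.+-monoˡ-≤ r′ (Z.single D≡0)) (ℕₚ.≤-reflexive (sym r≡))))
      (ℕₚ.≤-reflexive (Σ-const units r))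
      where
      j = (1# + b) ⁻¹
      t₀ = - (b * j)
      t₀≢0 : t₀ ≢ 0#
      t₀≢0 = -x≢0 (*-≢0 b≢0 (⁻¹-≢0 b+1≢0))
      D≡0 : at :lineD 0# 0# b t₀ ≡ 0#
      D≡0 = begin
        at :lineD 0# 0# b t₀
          ≡⟨ solve 2 (λ b j → :lineD (:n 0) (:n 0) b (:- (b :* j)) :=
               b :* :- (b :* j) :* (b :* (:n 1 :- (:n 1 :+ b) :* j))) refl b j ⟩
        b * t₀ * (b * (1# + - ((1# + b) * j)))
          ≡⟨ cong (λ e → b * t₀ * (b * (1# + - e))) (⁻¹-inverseʳ b+1≢0) ⟩
        b * t₀ * (b * (1# + - 1#))
          ≡⟨ solve 2 (λ b t → b :* t :* (b :* (:n 1 :- :n 1)) := :n 0) refl b t₀ ⟩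
        0# ∎

    row : ∀ b → #line 0# 0# b ≤ #line 0# 1# b
    row b with b ≟ 0# | 1# + b ≟ 0#
    ... | yes refl | _ = ℕₚ.≤-reflexive (trans Z.single-row (sym O.single-row))
    ... | no b≢0 | no b+1≢0 = ℕₚ.+-cancelʳ-≤ r′ _ _
          (ℕₚ.≤-trans (deficient-row b≢0 b+1≢0) (O.almost-full-row r≡ b≢0))
    ... | no _ | yes b+1≡0 = ℕₚ.≤-trans (Σ-units-≤ (lineφ 0# 0# b))
          (subst (λ b → r ℕ.* r ≤ #line 0# 1# b) (sym b≡-1) O.full-row-−1)
      where
      b≡-1 : b ≡ - 1#
      b≡-1 = trans (solve 1 (λ b → b := (:n 1 :+ b) :- :n 1) refl b)
               (trans (cong (_+ - 1#) b+1≡0) (+-identityˡ _))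

    gap : #line 0# 0# (- ι 2) ℕ.+ r′ ≤ #line 0# 1# (- ι 2)
    gap = ℕₚ.≤-trans (deficient-row (-x≢0 2≢0) (λ eq → -x≢0 1≢0 (trans
            (solve 0 (:- :n 1 := :n 1 :+ :- :n 2) refl) eq)))
          (O.full-row λ {t} t≢0 D≡0 → *-≢0 2≢0 (*-≢0 t≢0 t≢0) (trans
            (solve 1 (λ t → :n 2 :* (t :* t) := :lineD (:n 0) (:n 1) (:- :n 2) t) refl t) D≡0))

-- Small orders

module Rescaling {q : ℕ} (F : FiniteField q) where
  open FieldTheory F
  open PowerSums F
  open Quartic F
  open Counting F

  -- The first function at u, multiplied by c, is the second at μ⁻¹u, and u ↦ μ⁻¹u preserves the
  -- units.
  rescale : ∀ D α β δ {c μ} → c ≢ 0# → μ ≢ 0# →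
    #values (laurent D α β δ) units ≤
    #values (laurent (c * D * μ ⁻¹) (c * α * μ) (c * β * (μ * μ)) (c * δ * (μ * μ * μ))) units
  rescale D α β δ {c} {μ} c≢0 μ≢0 = subst (#values L units ≤_) (length-map (c ⁻¹ *_) (values L′ units))
    (#values-≤ L units (map (c ⁻¹ *_) (values L′ units)) λ {u} u∈ →
      subst (_∈ map (c ⁻¹ *_) (values L′ units)) (sym (scaled (∈-units⁻ u∈)))
        (∈-map⁺ (c ⁻¹ *_) (∈-values⁺ L′ (∈-units⁺ (*-≢0 (⁻¹-≢0 μ≢0) (∈-units⁻ u∈))))))
    where
    open ≡-Reasoning
    L = laurent D α β δ
    L′ = laurent (c * D * μ ⁻¹) (c * α * μ) (c * β * (μ * μ)) (c * δ * (μ * μ * μ))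
    scaled : ∀ {u} → u ≢ 0# → L u ≡ c ⁻¹ * L′ (μ ⁻¹ * u)
    scaled {u} u≢0 = *-cancelˡ c≢0 (begin
      c * L u
        ≡⟨ solve 7 (λ c D α β δ i u → c :* (D :* i :+ (α :* u :+ (β :* (u :* u) :+ δ :* (u :* u :* u)))) :=
             c :* D :* (:n 1 :* i) :+ (c :* α :* (:n 1 :* u) :+ (c :* β :* ((:n 1 :* u) :* (:n 1 :* u)) :+
               c :* δ :* ((:n 1 :* u) :* (:n 1 :* u) :* (:n 1 :* u))))) refl c D α β δ (u ⁻¹) u ⟩
      form 1#
        ≡⟨ cong form (sym (⁻¹-inverseʳ μ≢0)) ⟩
      form (μ * μ ⁻¹)
        ≡⟨ cong (λ e → c * D * e + rest (μ * μ ⁻¹)) inverse-scaled ⟩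
      c * D * (μ ⁻¹ * (μ ⁻¹ * u) ⁻¹) + rest (μ * μ ⁻¹)
        ≡⟨ solve 9 (λ c D α β δ m j i u →
             c :* D :* (j :* i) :+ (c :* α :* (m :* j :* u) :+ (c :* β :* ((m :* j :* u) :* (m :* j :* u)) :+
               c :* δ :* ((m :* j :* u) :* (m :* j :* u) :* (m :* j :* u)))) :=
             (c :* D :* j) :* i :+ ((c :* α :* m) :* (j :* u) :+ ((c :* β :* (m :* m)) :* ((j :* u) :* (j :* u)) :+
               (c :* δ :* (m :* m :* m)) :* ((j :* u) :* (j :* u) :* (j :* u)))))
             refl c D α β δ μ (μ ⁻¹) ((μ ⁻¹ * u) ⁻¹) u ⟩
      L′ (μ ⁻¹ * u)
        ≡⟨ sym (*-identityˡ _) ⟩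
      1# * L′ (μ ⁻¹ * u)
        ≡⟨ cong (_* L′ (μ ⁻¹ * u)) (sym (⁻¹-inverseʳ c≢0)) ⟩
      c * c ⁻¹ * L′ (μ ⁻¹ * u)
        ≡⟨ *-assoc c (c ⁻¹) _ ⟩
      c * (c ⁻¹ * L′ (μ ⁻¹ * u)) ∎)
      where
      rest form : Carrier → Carrier
      rest e = c * α * (e * u) + (c * β * ((e * u) * (e * u)) + c * δ * ((e * u) * (e * u) * (e * u)))
      form e = c * D * (e * u ⁻¹) + rest e
      inverse-scaled : μ * μ ⁻¹ * u ⁻¹ ≡ μ ⁻¹ * (μ ⁻¹ * u) ⁻¹
      inverse-scaled = *-cancelˡ u≢0 (begin
        u * (μ * μ ⁻¹ * u ⁻¹)
          ≡⟨ solve 4 (λ u m j i → u :* (m :* j :* i) := (u :* i) :* (m :* j)) refl u μ (μ ⁻¹) (u ⁻¹) ⟩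
        u * u ⁻¹ * (μ * μ ⁻¹)
          ≡⟨ cong₂ _*_ (⁻¹-inverseʳ u≢0) (⁻¹-inverseʳ μ≢0) ⟩
        1# * 1#
          ≡⟨ *-identityˡ 1# ⟩
        1#
          ≡⟨ sym (⁻¹-inverseʳ (*-≢0 (⁻¹-≢0 μ≢0) u≢0)) ⟩
        μ ⁻¹ * u * (μ ⁻¹ * u) ⁻¹
          ≡⟨ solve 3 (λ u j i → j :* u :* i := u :* (j :* i)) refl u (μ ⁻¹) ((μ ⁻¹ * u) ⁻¹) ⟩
        u * (μ ⁻¹ * (μ ⁻¹ * u) ⁻¹) ∎)

  -- Scaling the argument and the value makes δ = 1 and β ∈ {0, 1}, respectively α = 1.
  NormalFormsLossy : Set
  NormalFormsLossy = (∀ D α → #values (laurent D α 0# 1#) units ℕ.+ 2 ≤ r) ×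
                     (∀ D α → #values (laurent D α 1# 1#) units ℕ.+ 2 ≤ r) ×
                     (∀ D → D ≢ 0# → #values (laurent D 1# 0# 0#) units ℕ.+ 2 ≤ r)

  normal-forms⇒lossy : NormalFormsLossy → Lossy
  normal-forms⇒lossy (quartic₀ , quartic₁ , binomial) D α β δ nondegenerate with β ≟ 0# | nondegenerate
  ... | yes refl | inj₁ δ≢0 = ℕₚ.≤-trans (ℕₚ.+-monoˡ-≤ 2 (rescale D α 0# δ (⁻¹-≢0 δ≢0) 1≢0))
    (subst₂ (λ b d → #values (laurent D′ α′ b d) units ℕ.+ 2 ≤ r)
      (solve 1 (λ c → :n 0 := c :* :n 0 :* (:n 1 :* :n 1)) refl (δ ⁻¹))
      (trans (sym (⁻¹-inverseʳ δ≢0)) (solve 2 (λ d c → d :* c := c :* d :* (:n 1 :* :n 1 :* :n 1)) refl δ (δ ⁻¹)))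
      (quartic₀ D′ α′))
    where
    D′ = δ ⁻¹ * D * 1# ⁻¹
    α′ = δ ⁻¹ * α * 1#
  ... | no β≢0 | inj₁ δ≢0 = ℕₚ.≤-trans (ℕₚ.+-monoˡ-≤ 2 (rescale D α β δ c≢0 μ≢0))
    (subst₂ (λ b d → #values (laurent (c * D * μ ⁻¹) (c * α * μ) b d) units ℕ.+ 2 ≤ r)
      (sym cβμ²≡1) (sym (trans cδμ³≡cβμ² cβμ²≡1)) (quartic₁ (c * D * μ ⁻¹) (c * α * μ)))
    where
    open ≡-Reasoning
    -- This choice gives βμ² = δμ³, so that a single c turns both coefficients into 1.
    μ = β * δ ⁻¹
    μ≢0 = *-≢0 β≢0 (⁻¹-≢0 δ≢0)
    βμ²≢0 : β * (μ * μ) ≢ 0#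
    βμ²≢0 = *-≢0 β≢0 (*-≢0 μ≢0 μ≢0)
    c = (β * (μ * μ)) ⁻¹
    c≢0 = ⁻¹-≢0 βμ²≢0
    cβμ²≡1 : c * β * (μ * μ) ≡ 1#
    cβμ²≡1 = trans (*-assoc c β _) (trans (*-comm c _) (⁻¹-inverseʳ βμ²≢0))
    cδμ³≡cβμ² : c * δ * (μ * μ * μ) ≡ c * β * (μ * μ)
    cδμ³≡cβμ² = begin
      c * δ * (μ * μ * (β * δ ⁻¹))
        ≡⟨ solve 5 (λ c d m b i → c :* d :* (m :* m :* (b :* i)) := (d :* i) :* (c :* b :* (m :* m))) refl c δ μ β (δ ⁻¹) ⟩
      δ * δ ⁻¹ * (c * β * (μ * μ))
        ≡⟨ cong (_* (c * β * (μ * μ))) (⁻¹-inverseʳ δ≢0) ⟩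
      1# * (c * β * (μ * μ))
        ≡⟨ *-identityˡ _ ⟩
      c * β * (μ * μ) ∎
  ... | _ | inj₂ (refl , refl , α≢0 , D≢0) = ℕₚ.≤-trans (ℕₚ.+-monoˡ-≤ 2 (rescale D α 0# 0# (⁻¹-≢0 α≢0) 1≢0))
    (subst (λ a → #values (laurent D′ a (α ⁻¹ * 0# * (1# * 1#)) (α ⁻¹ * 0# * (1# * 1# * 1#))) units ℕ.+ 2 ≤ r)
      (trans (sym (⁻¹-inverseʳ α≢0)) (solve 2 (λ d c → d :* c := c :* d :* :n 1) refl α (α ⁻¹)))
      (subst₂ (λ b d → #values (laurent D′ 1# b d) units ℕ.+ 2 ≤ r)
        (solve 1 (λ c → :n 0 := c :* :n 0 :* (:n 1 :* :n 1)) refl (α ⁻¹))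
        (solve 1 (λ c → :n 0 := c :* :n 0 :* (:n 1 :* :n 1 :* :n 1)) refl (α ⁻¹))
        (binomial D′ (*-≢0 (*-≢0 (⁻¹-≢0 α≢0) D≢0) (⁻¹-≢0 1≢0)))))
    where D′ = α ⁻¹ * D * 1# ⁻¹

-- Computation in fields of small prime order

module SmallPrime (n′ : ℕ) (F : FiniteField (suc n′)) (inverses! : T (inverses-correct n′)) where
  open FieldTheory F
  open PowerSums F
  open Quartic F
  open Geometry F
  open Counting F
  open Rescaling F
  open PrimeOrder n′ F inverses!
  open import Data.Fin.Patterns

  r≡n′ : r ≡ n′
  r≡n′ = ℕₚ.suc-injective length-units

  checked-lossy : T (quartics-lossy n′ (unit-pairs n′)) → T (binomials-lossy n′ (unit-pairs n′)) → Lossy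
  checked-lossy quartics binomials = normal-forms⇒lossy
    ( (λ D α → quartic 0 (s≤s z≤n) D α)
    , (λ D α → quartic 1 (s≤s (s≤s z≤n)) D α)
    , λ D D≢0 → binomial D≢0)
    where
    bounded : ∀ {D a b e} → T (#values-mod n′ (unit-pairs n′) D a b e ℕ.+ 2 ℕ.≤ᵇ n′) →
              #values (laurent (ι D) (ι a) (ι b) (ι e)) units ℕ.+ 2 ≤ r
    bounded {D} {a} {b} {e} h = ℕₚ.≤-trans (ℕₚ.+-monoˡ-≤ 2 (#values-≤-mod D a b e))
      (subst (#values-mod n′ (unit-pairs n′) D a b e ℕ.+ 2 ≤_) (sym r≡n′)
        (ℕₚ.≤ᵇ⇒≤ (#values-mod n′ (unit-pairs n′) D a b e ℕ.+ 2) n′ h))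
    quartic : ∀ b → b < 2 → ∀ D α → #values (laurent D α (ι b) 1#) units ℕ.+ 2 ≤ r
    quartic b b<2 D α = let d , d<n , D≡ = ι-surjective D ; a , a<n , α≡ = ι-surjective α in
      subst₂ (λ D α → #values (laurent D α (ι b) 1#) units ℕ.+ 2 ≤ r) (sym D≡) (sym α≡)
        (bounded {d} {a} {b} {1} (all-∈ (λ b → #values-mod n′ (unit-pairs n′) d a b 1 ℕ.+ 2 ℕ.≤ᵇ n′) {xs = upTo 2} (all-∈ _ {xs = upTo n} (all-∈ _ {xs = upTo n} quartics
          (∈-upTo⁺ d<n)) (∈-upTo⁺ a<n)) (∈-upTo⁺ b<2)))
    binomial : ∀ {D} → D ≢ 0# → #values (laurent D 1# 0# 0#) units ℕ.+ 2 ≤ r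
    binomial D≢0 = let d , d<n′ , D≡ = ι-surjective-unit D≢0 in
      subst (λ D → #values (laurent D 1# 0# 0#) units ℕ.+ 2 ≤ r) (sym D≡)
        (bounded {suc d} {1} {0} {0} (all-∈ _ {xs = upTo n′} binomials (∈-upTo⁺ d<n′)))

  Coefficient : Set
  Coefficient = ∀ {m} (x y z t : Polynomial m) → Polynomial m

  at-mod : Coefficient → (x y z t : ℕ) → ℕ
  at-mod p x y z t = eval-mod (p (var 0F) (var 1F) (var 2F) (var 3F)) (x ∷ y ∷ z ∷ t ∷ [])

  #fibred-mod : List (ℕ × ℕ) → (D α β δ : Coefficient) → (x y : ℕ) → ℕ
  #fibred-mod ps D α β δ x y = Σ (allFin n) λ i → Σ (allFin n′) λ j →
    #values-mod n′ ps (at-mod D x y (toℕ i) (suc (toℕ j))) (at-mod α x y (toℕ i) (suc (toℕ j)))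
                      (at-mod β x y (toℕ i) (suc (toℕ j))) (at-mod δ x y (toℕ i) (suc (toℕ j)))

  #fibred-≤-mod : ∀ (D α β δ : Coefficient) x y →
    #fibred (λ z t → laurent (at D (ι x) (ι y) z t) (at α (ι x) (ι y) z t) (at β (ι x) (ι y) z t) (at δ (ι x) (ι y) z t))
      ≤ #fibred-mod (unit-pairs n′) D α β δ x y
  #fibred-≤-mod D α β δ x y = ℕₚ.≤-trans
    (ℕₚ.≤-reflexive (trans (Σ-↭ elements-ι) (Σ-map ιF (allFin n))))
    (Σ-mono (allFin n) λ {i} _ → ℕₚ.≤-trans
      (ℕₚ.≤-reflexive (trans (Σ-↭ units-ι) (Σ-map ιU (allFin n′))))
      (Σ-mono (allFin n′) λ {j} _ → fibre (toℕ i) (suc (toℕ j))))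
    where
    Σ-map : ∀ {A B : Set} {c : B → ℕ} (f : A → B) (xs : List A) → Σ (map f xs) c ≡ Σ xs (λ x → c (f x))
    Σ-map f xs = cong sum (sym (map-∘ xs))
    fibre : ∀ z t → #values (laurent (at D (ι x) (ι y) (ι z) (ι t)) (at α (ι x) (ι y) (ι z) (ι t))
                                     (at β (ι x) (ι y) (ι z) (ι t)) (at δ (ι x) (ι y) (ι z) (ι t))) units ≤
      #values-mod n′ (unit-pairs n′) (at-mod D x y z t) (at-mod α x y z t) (at-mod β x y z t) (at-mod δ x y z t)
    fibre z t = subst (_≤ #values-mod n′ (unit-pairs n′) (at-mod D x y z t) (at-mod α x y z t) (at-mod β x y z t) (at-mod δ x y z t))
      (cong₂ (λ (D , α) (β , δ) → #values (laurent D α β δ) units) (cong₂ _,_ (eval D) (eval α)) (cong₂ _,_ (eval β) (eval δ)))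
      (#values-≤-mod (at-mod D x y z t) (at-mod α x y z t) (at-mod β x y z t) (at-mod δ x y z t))
      where
      eval : (p : Coefficient) → ι (at-mod p x y z t) ≡ at p (ι x) (ι y) (ι z) (ι t)
      eval p = ι-eval (p (var 0F) (var 1F) (var 2F) (var 3F)) (x ∷ y ∷ z ∷ t ∷ [])

  oblique-below flat-below points-below : ℕ → List (ℕ × ℕ) → Bool
  oblique-below N ps = all (λ A → all (λ B →
    #fibred-mod ps :lineD :lineα :lineβ :lineδ (suc A) B ℕ.<ᵇ N) (upTo n)) (upTo n′)
  flat-below N ps = all (λ B → #fibred-mod ps :lineD :lineα :lineβ :lineδ 0 (suc (suc B)) ℕ.<ᵇ N) (upTo (ℕ.pred n′))
  points-below N ps = all (λ a → all (λ c →
    #fibred-mod ps :pointD :pointα :pointβ :pointδ a c ℕ.<ᵇ N) (upTo n)) (upTo n)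

  checked-lines : ∀ N → T (oblique-below N (unit-pairs n′)) → T (flat-below N (unit-pairs n′)) →
                  ∀ A B → ¬ (A ≡ 0# × B ≡ 0#) → ¬ (A ≡ 0# × B ≡ 1#) → #fibred (lineφ A B) < N
  checked-lines N oblique! flat! A B ¬00 ¬01 = case (A ≟ 0#) (B ≟ 0#)
    where
    below : ∀ A B → T (#fibred-mod (unit-pairs n′) :lineD :lineα :lineβ :lineδ A B ℕ.<ᵇ N) → #fibred (lineφ (ι A) (ι B)) < N
    below A B h = ℕₚ.≤-<-trans (#fibred-≤-mod :lineD :lineα :lineβ :lineδ A B) (ℕₚ.<ᵇ⇒< _ N h)
    flat : ∀ k → k < n′ → B ≡ ι (suc k) → A ≡ 0# → #fibred (lineφ A B) < N
    flat zero _ B≡1 A≡0 = ⊥-elim (¬01 (A≡0 , B≡1))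
    flat (suc k) k<n′ B≡ A≡0 = subst₂ (λ A B → #fibred (lineφ A B) < N) (sym A≡0) (sym B≡)
      (below 0 (suc (suc k)) (all-∈ _ {xs = upTo (ℕ.pred n′)} flat! (∈-upTo⁺ (ℕₚ.pred-mono-≤ k<n′))))
    case : Dec (A ≡ 0#) → Dec (B ≡ 0#) → #fibred (lineφ A B) < N
    case (no A≢0) _ = let a , a<n′ , A≡ = ι-surjective-unit A≢0 ; b , b<n , B≡ = ι-surjective B in
      subst₂ (λ A B → #fibred (lineφ A B) < N) (sym A≡) (sym B≡)
        (below (suc a) b (all-∈ _ {xs = upTo n} (all-∈ _ {xs = upTo n′} oblique! (∈-upTo⁺ a<n′)) (∈-upTo⁺ b<n)))
    case (yes A≡0) (yes B≡0) = ⊥-elim (¬00 (A≡0 , B≡0))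
    case (yes A≡0) (no B≢0) = let b , b<n′ , B≡ = ι-surjective-unit B≢0 in flat b b<n′ B≡ A≡0

  checked-points : ∀ N → T (points-below N (unit-pairs n′)) → ∀ a c → #fibred (pointφ a c) < N
  checked-points N points! a c = let i , i<n , a≡ = ι-surjective a ; j , j<n , c≡ = ι-surjective c in
    subst₂ (λ a c → #fibred (pointφ a c) < N) (sym a≡) (sym c≡)
      (ℕₚ.≤-<-trans (#fibred-≤-mod :pointD :pointα :pointβ :pointδ i j)
        (ℕₚ.<ᵇ⇒< _ N (all-∈ _ {xs = upTo n} (all-∈ _ {xs = upTo n} points! (∈-upTo⁺ i<n)) (∈-upTo⁺ j<n))))

-- The comparison for all orders

odd-^ : ∀ p k → p % 2 ≡ 1 → (p ^ k) % 2 ≡ 1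
odd-^ p zero _ = refl
odd-^ p (suc k) odd = trans (%-distribˡ-* p (p ^ k) 2) (cong₂ (λ x y → (x ℕ.* y) % 2) odd (odd-^ p k odd))

-- The congruences amount to q ≡ 1 modulo 6, and the finitely many orders below 26 are decided by
-- evaluation.
orders : ∀ q → 7 ≤ q → q % 2 ≡ 1 → q % 3 ≡ 1 → (q ≡ 7 ⊎ q ≡ 13 ⊎ q ≡ 19) ⊎ (q ≡ 25 ⊎ 25 < q)
orders q 7≤q odd q≡1 with q ℕ.<? 26
... | no q≮26 = inj₂ (inj₂ (ℕₚ.≮⇒≥ q≮26))
... | yes q<26 = from-yes (ℕₚ.allUpTo? (λ q → (7 ℕ.≤? q) →-dec ((q % 2 ℕ.≟ 1) →-dec ((q % 3 ℕ.≟ 1) →-dec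
      (((q ℕ.≟ 7) ⊎-dec ((q ℕ.≟ 13) ⊎-dec (q ℕ.≟ 19))) ⊎-dec ((q ℕ.≟ 25) ⊎-dec (25 ℕ.<? q)))))) 26) q<26 7≤q odd q≡1

module Comparison {q : ℕ} (F : FiniteField q) where
  open FieldTheory F
  open PowerSums F
  open Quartic F
  open Geometry F
  open Counting F

  OriginDominates : Set
  OriginDominates =
    (∀ A B → ¬ (A ≡ 0# × B ≡ 0#) → ¬ (A ≡ 0# × B ≡ 1#) → #fibred (lineφ A B) < #fibred (lineφ 0# 0#)) ×
    (∀ a c → #fibred (pointφ a c) < #fibred (lineφ 0# 0#))

  residue-1⇒unit : ∀ m .{{_ : ℕ.NonZero m}} → q % m ≡ 1 → ι m ≢ 0#
  residue-1⇒unit m q≡1 = ι-≢0 m (q / m) (trans (m≡m%n+[m/n]*n q m)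
    (cong₂ ℕ._+_ q≡1 (ℕₚ.*-comm (q / m) m)))

  large⇒24≤r : q ≡ 25 ⊎ 25 < q → 24 ≤ r
  large⇒24≤r (inj₁ q≡25) = ℕₚ.≤-reflexive (ℕₚ.suc-injective (sym (trans length-units q≡25)))
  large⇒24≤r (inj₂ 25<q) = ℕₚ.<⇒≤ (ℕₚ.≤-pred (subst (25 <_) (sym length-units) 25<q))

  large⇒24<r⊎char5 : q ≡ 25 ⊎ 25 < q → 24 < r ⊎ ι 5 ≡ 0#
  large⇒24<r⊎char5 (inj₂ 25<q) = inj₁ (ℕₚ.≤-pred (subst (25 <_) (sym length-units) 25<q))
  large⇒24<r⊎char5 (inj₁ q≡25) with *-≡0 (trans (sym (ι-* 5 5)) (trans (cong ι (sym q≡25)) ι-q))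
  ... | inj₁ 5≡0 = inj₂ 5≡0
  ... | inj₂ 5≡0 = inj₂ 5≡0

  large-lossy : q % 2 ≡ 1 → q % 3 ≡ 1 → q ≡ 25 ⊎ 25 < q → Lossy
  large-lossy odd q≡1 large D α β δ nondegenerate with D ≟ 0# | nondegenerate
  ... | no D≢0 | inj₁ δ≢0 = NearPermutation.few-values-D≢0 (residue-1⇒unit 2 odd) (residue-1⇒unit 3 q≡1)
          (large⇒24≤r large) (large⇒24<r⊎char5 large) D α β δ D≢0 (λ (_ , _ , δ≡0) → δ≢0 δ≡0)
  ... | no D≢0 | inj₂ (_ , _ , α≢0 , _) = NearPermutation.few-values-D≢0 (residue-1⇒unit 2 odd) (residue-1⇒unit 3 q≡1)
          (large⇒24≤r large) (large⇒24<r⊎char5 large) D α β δ D≢0 (λ (α≡0 , _) → α≢0 α≡0)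
  ... | yes D≡0 | inj₂ (_ , _ , _ , D≢0) = ⊥-elim (D≢0 D≡0)
  ... | yes D≡0 | inj₁ δ≢0 = third (q / 3) refl
    where
    3*third : 3 ℕ.* (q / 3) ≡ r
    3*third = ℕₚ.suc-injective (sym (trans length-units (trans (m≡m%n+[m/n]*n q 3)
                (cong₂ ℕ._+_ q≡1 (ℕₚ.*-comm (q / 3) 3)))))
    third : ∀ k → q / 3 ≡ k → #values (laurent D α β δ) units ℕ.+ 2 ≤ r
    third zero q/3≡0 = ⊥-elim (ℕₚ.n≮0 (subst (24 ≤_) (trans (sym 3*third) (cong (3 ℕ.*_) q/3≡0)) (large⇒24≤r large)))
    third (suc k) q/3≡k = few-values-D≡0 (residue-1⇒unit 2 odd) (ℕₚ.≤-trans (ℕₚ.m≤m+n 9 15) (large⇒24≤r large)) k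
      (trans (cong (3 ℕ.*_) (sym q/3≡k)) 3*third) D α β δ D≡0 δ≢0

  lossy⇒dominates : 7 ≤ q → Lossy → OriginDominates
  lossy⇒dominates 7≤q lossy = lines , points-below
    where
    open +-*-Solver using () renaming (solve to solveℕ; _:+_ to _⊕_; _:*_ to _⊗_; con to conℕ; _:=_ to _≈_)
    r≡ : ∃ λ d → r ≡ 2 ℕ.+ d
    r≡ = let d , eq = ℕₚ.m≤n⇒∃[o]m+o≡n (ℕₚ.≤-pred (subst (7 ≤_) (sym length-units) 7≤q)) in 4 ℕ.+ d , sym eq
    d = proj₁ r≡
    open Upper lossy (proj₂ r≡)
    lower-bound : ℕ → ℕ
    lower-bound r = r ℕ.+ (r ℕ.* (r ℕ.* suc d ℕ.+ 1) ℕ.+ suc d)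
    origin : lower-bound (2 ℕ.+ d) ≤ #fibred (lineφ 0# 0#)
    origin = subst (λ r → lower-bound r ≤ #fibred (lineφ 0# 0#)) (proj₂ r≡) (origin-≥ (proj₂ r≡))
    -- `e` is the slack left after the strict inequality, as a polynomial in d = r - 2. The lines
    -- with A = 0 come closest, with slack d.
    below : ∀ {n} (U : ℕ → ℕ) e → n ≤ U r → suc (U (2 ℕ.+ d)) ℕ.+ e ≡ lower-bound (2 ℕ.+ d) → n < #fibred (lineφ 0# 0#)
    below U e n≤ eq = ℕₚ.≤-trans (s≤s (subst (λ r → _ ≤ U r) (proj₂ r≡) n≤))
      (ℕₚ.≤-trans (ℕₚ.m≤m+n _ e) (ℕₚ.≤-trans (ℕₚ.≤-reflexive eq) origin))
    lines : ∀ A B → ¬ (A ≡ 0# × B ≡ 0#) → ¬ (A ≡ 0# × B ≡ 1#) → #fibred (lineφ A B) < #fibred (lineφ 0# 0#)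
    lines A B ¬00 ¬01 with A ≟ 0#
    ... | no A≢0 = below (λ r → suc r ℕ.* (r ℕ.* d)) (5 ℕ.* d ℕ.+ 8)
          (subst (λ q → #fibred (lineφ A B) ≤ q ℕ.* (r ℕ.* d)) (sym length-units) (oblique-lines A B A≢0))
          (solveℕ 1 (λ d → let r = conℕ 2 ⊕ d in
            conℕ 1 ⊕ (conℕ 1 ⊕ r) ⊗ (r ⊗ d) ⊕ (conℕ 5 ⊗ d ⊕ conℕ 8) ≈
            r ⊕ (r ⊗ (r ⊗ (conℕ 1 ⊕ d) ⊕ conℕ 1) ⊕ (conℕ 1 ⊕ d))) refl d)
    ... | yes refl = below (λ r → r ℕ.* r ℕ.+ r ℕ.* (r ℕ.* d ℕ.+ 2)) d
          (flat-lines B (λ B≡0 → ¬00 (refl , B≡0)) (λ B≡1 → ¬01 (refl , B≡1)))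
          (solveℕ 1 (λ d → let r = conℕ 2 ⊕ d in
            conℕ 1 ⊕ (r ⊗ r ⊕ r ⊗ (r ⊗ d ⊕ conℕ 2)) ⊕ d ≈
            r ⊕ (r ⊗ (r ⊗ (conℕ 1 ⊕ d) ⊕ conℕ 1) ⊕ (conℕ 1 ⊕ d))) refl d)
    points-below : ∀ a c → #fibred (pointφ a c) < #fibred (lineφ 0# 0#)
    points-below a c = below (λ r → r ℕ.* r ℕ.+ r ℕ.* (r ℕ.* d)) (3 ℕ.* d ℕ.+ 4) (points a c)
      (solveℕ 1 (λ d → let r = conℕ 2 ⊕ d in
        conℕ 1 ⊕ (r ⊗ r ⊕ r ⊗ (r ⊗ d)) ⊕ (conℕ 3 ⊗ d ⊕ conℕ 4) ≈
        r ⊕ (r ⊗ (r ⊗ (conℕ 1 ⊕ d) ⊕ conℕ 1) ⊕ (conℕ 1 ⊕ d))) refl d)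

module Order7 (F : FiniteField 7) where
  open FieldTheory F
  open PowerSums F
  open Geometry F
  open Counting F
  open SmallPrime 6 F tt

  -- 197 = 6 + 6·(6·5 + 1) + 5 is the bound of `origin-≥` at r = 6.
  197≤origin : 197 ≤ #fibred (lineφ 0# 0#)
  197≤origin = subst (λ r → r ℕ.+ (r ℕ.* (r ℕ.* 5 ℕ.+ 1) ℕ.+ 5) ≤ #fibred (lineφ 0# 0#)) r≡n′ (origin-≥ {5} r≡n′)

  dominates : Comparison.OriginDominates F
  dominates =
    (λ A B ¬00 ¬01 → ℕₚ.<-≤-trans (checked-lines 197 tt tt A B ¬00 ¬01) 197≤origin) ,
    (λ a c → ℕₚ.<-≤-trans (checked-points 197 tt a c) 197≤origin)

lossy-13 : (F : FiniteField 13) → Counting.Lossy F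
lossy-13 F = SmallPrime.checked-lossy 12 F tt tt tt

lossy-19 : (F : FiniteField 19) → Counting.Lossy F
lossy-19 F = SmallPrime.checked-lossy 18 F tt tt tt

origin-dominates : ∀ q → 7 ≤ q → q % 2 ≡ 1 → q % 3 ≡ 1 → (F : FiniteField q) → Comparison.OriginDominates F
origin-dominates q 7≤q odd q≡1 F with orders q 7≤q odd q≡1
... | inj₁ (inj₁ refl) = Order7.dominates F
... | inj₁ (inj₂ (inj₁ refl)) = Comparison.lossy⇒dominates F 7≤q (lossy-13 F)
... | inj₁ (inj₂ (inj₂ refl)) = Comparison.lossy⇒dominates F 7≤q (lossy-19 F)
... | inj₂ large = Comparison.lossy⇒dominates F 7≤q (Comparison.large-lossy F odd q≡1 large)

theorem3p2 : (p k q : ℕ) → Prime p → p % 2 ≡ 1 → q ≡ p ^ k → 7 ≤ q → q % 3 ≡ 1 →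
    (F : FiniteField q) →
    let open FiniteField F
        open GraphR F
    in ((A B C : Carrier) → ¬ (A ≡ 0# × B ≡ 0#) → ¬ (A ≡ 0# × B ≡ 1#) →
          (n m l : ℕ) → R3 (line A B C) n → R3 (line 0# 0# 0#) m → R3 (line 0# 1# 0#) l →
          (n < m) × (m < l))
       × ((p₁ p₂ p₃ : Carrier) → (n m : ℕ) → R3 (point p₁ p₂ p₃) n → R3 (line 0# 0# 0#) m → n < m)
theorem3p2 p k q _ p-odd q≡ 7≤q q≡1 F =
  (λ A B C ¬00 ¬01 n m l N M L →
    subst₂ _<_ (sym (R3-line N)) (sym (R3-line M)) (proj₁ dominates A B ¬00 ¬01) ,
    subst₂ _<_ (sym (R3-line M)) (sym (R3-line L)) (origin<[0,1,0] (proj₂ r≡) (proj₁ r≡) (residue-1⇒unit 2 odd))) ,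
  (λ p₁ p₂ p₃ n m N M → ℕₚ.≤-<-trans (R3-point N) (subst (_ <_) (sym (R3-line M)) (proj₂ dominates p₁ p₂)))
  where
  open FieldTheory F
  open PowerSums F
  open Geometry F
  open Counting F
  open Comparison F
  odd : q % 2 ≡ 1
  odd = trans (cong (_% 2) q≡) (odd-^ p k p-odd)
  dominates : OriginDominates
  dominates = origin-dominates q 7≤q odd q≡1 F
  r≡ : 1 ≤ ℕ.pred r × r ≡ suc (ℕ.pred r)
  r≡ with r | subst (7 ≤_) (sym length-units) 7≤q
  ... | suc r′ | s≤s (s≤s 5≤r′) = ℕₚ.≤-trans (ℕₚ.m≤m+n 1 4) 5≤r′ , refl
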